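{- Suppose $Y$ is a complete bipartite graph and $Y^f$ is a cyclic $r$-fold 2ev-cover of $Y$. Then $Y=K_{n,n}$ for some $n$ with $r\mid n$, and $Y^f$ is bipartite and distance-regular with diameter $4$.
   Context: All graphs are finite, simple and undirected. Covers: let $Y=(V,E)$ be a connected graph and $G$ a permutation group on $R=\{1,\dots,r\}$. A symmetric arc function is a function $f:V\times V\to G\cup\{0\}$ such that $f(u,v)=0$ if and only if $\{u,v\}\notin E$, and $f(u,v)=f(v,u)^{ -1}$ whenever $f(u,v)\in G$. The cover $Y^f$ (of index $r$, or $r$-fold) is the graph with vertex set $V\times R$ in which $(v,j)$ is adjacent to $(u,k)$ exactly when $v$ is adjacent to $u$ in $Y$ and $f(u,v)j=k$. The function $f$ is normalized if $f(u,v)=\mathrm{id}$ for all edges $\{u,v\}$ of some spanning tree of $Y$. Denote by $\langle f\rangle$ the subgroup of $\mathrm{Sym}(r)$ generated by the (non-zero) values of $f$. Standing assumptions: $f$ is normalized and $\langle f\rangle$ acts regularly (i.e. simply transitively) on $\{1,\dots,r\}$. The cover is called cyclic if $\langle f\rangle$ is a cyclic group. Two-eigenvalue cover (2ev-cover): $\mathrm{Spec}(A)$ denotes the spectrum of $A$ as a multiset, and $A(\cdot)$ the adjacency matrix. One has $\mathrm{Spec}(A(Y))\subseteq\mathrm{Spec}(A(Y^f))$ as multisets, and $Y^f$ is a 2ev-cover of $Y$ if the multiset difference $\mathrm{Spec}(A(Y^f))\setminus\mathrm{Spec}(A(Y))$ has exactly two distinct elements. Distance-regular has its standard meaning: a connected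 graph of diameter $d$ such that for vertices $v,w$ at distance $i$, the numbers of neighbours of $w$ at distance $i+1$, respectively $i-1$, from $v$ depend only on $i$. -}

module Defs where

open import Algebra.Bundles.Raw using (RawRing)
import Algebra.Definitions.RawSemiring as RawSemiringDefinitions
open import Data.Bool.Base using (Bool; if_then_else_)
open import Data.Empty using (⊥)
open import Data.Fin.Base as Fin using (Fin; zero; suc; toℕ; punchIn)
import Data.Fin.Properties as Fin
open import Data.Fin.Permutation as Perm
  using (Permutation′; _⟨$⟩ʳ_; _∘ₚ_; flip)
open import Data.List.Base as List using (List; []; _∷_; _++_; length)
import Data.List.Membership.Propositional as ListMembership
import Data.List.Membership.Setoid as SetoidMembership
import Data.List.Relation.Binary.Permutation.Setoid as SetoidPermutation
open import Data.List.Relation.Unary.All using (All)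
open import Data.List.Relation.Unary.Unique.Propositional using (Unique)
open import Data.Maybe.Base using (Maybe; just; nothing)
open import Data.Maybe.Properties using (just-injective)
open import Data.Nat.Base as ℕ using (ℕ; suc)
import Data.Nat.Properties as ℕ
open import Data.Product using (Σ; ∃; ∃₂; ∃!; _×_; _,_; map₂)
open import Data.Product.Function.NonDependent.Propositional using (_×-↔_)
open import Data.Rational.Base as ℚ using (ℚ; 0ℚ; 1ℚ)
import Data.Rational.Properties as ℚ
open import Data.Rational.Solver using (module +-*-Solver)
open import Data.Sum.Base using (_⊎_; inj₁; inj₂)
open import Data.Unit.Base using (⊤; tt)
open import Function.Bundles using (_↔_; _⇔_; Inverse)
open import Function.Construct.Composition using (_↔-∘_)
open import Function.Construct.Identity using (↔-id)
open import Function.Construct.Symmetry using (↔-sym)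
open import Level using (0ℓ)
open import Relation.Binary.Bundles using (Setoid)
open import Relation.Binary.Definitions using (Decidable; Symmetric; Irreflexive)
open import Relation.Binary.PropositionalEquality
  using (_≡_; _≢_; refl; sym; trans; cong; cong₂; subst)
open import Relation.Binary.Structures using (IsEquivalence)
open import Relation.Nullary using (¬_; Dec; yes; no; does)
open import Relation.Nullary.Decidable using (_×-dec_; map′)
open import Relation.Unary using (Pred; _∈_; _≐_)

private
  half : ℚ → ℚ
  half ε = ε ℚ.* ℚ.½

  half-pos : ∀ {ε} → 0ℚ ℚ.< ε → 0ℚ ℚ.< half ε
  half-pos {ε} 0<ε = subst (ℚ._< half ε) (ℚ.*-zeroˡ ℚ.½) (ℚ.*-monoˡ-<-pos ℚ.½ 0<ε)

  half+half : ∀ ε → half ε ℚ.+ half ε ≡ ε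
  half+half ε = trans (sym (ℚ.*-distribˡ-+ ε ℚ.½ ℚ.½)) (ℚ.*-identityʳ ε)

  ∣x-x∣≡0 : ∀ x → ℚ.∣ x ℚ.- x ∣ ≡ 0ℚ
  ∣x-x∣≡0 x = cong ℚ.∣_∣ (ℚ.+-inverseʳ x)

  ∣x-y∣≡∣y-x∣ : ∀ x y → ℚ.∣ x ℚ.- y ∣ ≡ ℚ.∣ y ℚ.- x ∣
  ∣x-y∣≡∣y-x∣ x y = trans (cong ℚ.∣_∣ (solve 2 (λ a b → a :- b := :- (b :- a)) refl x y))
                          (ℚ.∣-p∣≡∣p∣ (y ℚ.- x))
    where open +-*-Solver

  triangle : ∀ x y z → ℚ.∣ x ℚ.- z ∣ ℚ.≤ ℚ.∣ x ℚ.- y ∣ ℚ.+ ℚ.∣ y ℚ.- z ∣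
  triangle x y z = subst (λ w → ℚ.∣ w ∣ ℚ.≤ ℚ.∣ x ℚ.- y ∣ ℚ.+ ℚ.∣ y ℚ.- z ∣)
    (solve 3 (λ a b c → (a :- b) :+ (b :- c) := a :- c) refl x y z)
    (ℚ.∣p+q∣≤∣p∣+∣q∣ (x ℚ.- y) (y ℚ.- z))
    where open +-*-Solver

  +-close : ∀ {ε a b c d} → ℚ.∣ a ℚ.- c ∣ ℚ.< half ε → ℚ.∣ b ℚ.- d ∣ ℚ.< half ε →
            ℚ.∣ (a ℚ.+ b) ℚ.- (c ℚ.+ d) ∣ ℚ.< ε
  +-close {ε} {a} {b} {c} {d} ac bd = begin-strict
    ℚ.∣ (a ℚ.+ b) ℚ.- (c ℚ.+ d) ∣
      ≡⟨ cong ℚ.∣_∣ (solve 4 (λ a b c d → (a :+ b) :- (c :+ d) := (a :- c) :+ (b :- d))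
                       refl a b c d) ⟩
    ℚ.∣ (a ℚ.- c) ℚ.+ (b ℚ.- d) ∣
      ≤⟨ ℚ.∣p+q∣≤∣p∣+∣q∣ (a ℚ.- c) (b ℚ.- d) ⟩
    ℚ.∣ a ℚ.- c ∣ ℚ.+ ℚ.∣ b ℚ.- d ∣
      <⟨ ℚ.+-mono-< ac bd ⟩
    half ε ℚ.+ half ε
      ≡⟨ half+half ε ⟩
    ε ∎
    where open +-*-Solver
          open ℚ.≤-Reasoning

-- Real numbers, as Cauchy sequences of rationals; equality is _≈ℝ_.
record ℝ : Set where
  constructor mkℝ
  field
    seq    : ℕ → ℚ
    cauchy : ∀ ε → 0ℚ ℚ.< ε →
             ∃ λ N → ∀ m n → N ℕ.≤ m → N ℕ.≤ n → ℚ.∣ seq m ℚ.- seq n ∣ ℚ.< ε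

open ℝ

infix 4 _≈ℝ_

_≈ℝ_ : ℝ → ℝ → Set
x ≈ℝ y = ∀ ε → 0ℚ ℚ.< ε → ∃ λ N → ∀ n → N ℕ.≤ n → ℚ.∣ seq x n ℚ.- seq y n ∣ ℚ.< ε

≈ℝ-isEquivalence : IsEquivalence _≈ℝ_
≈ℝ-isEquivalence = record
  { refl  = λ {x} ε 0<ε → 0 , λ n _ → subst (ℚ._< ε) (sym (∣x-x∣≡0 (seq x n))) 0<ε
  ; sym   = λ {x} {y} x≈y ε 0<ε → map₂ (λ p n N≤n →
              subst (ℚ._< ε) (∣x-y∣≡∣y-x∣ (seq x n) (seq y n)) (p n N≤n)) (x≈y ε 0<ε)
  ; trans = λ {x} {y} {z} → tr {x} {y} {z}
  }
  where
  tr : ∀ {x y z} → x ≈ℝ y → y ≈ℝ z → x ≈ℝ z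
  tr {x} {y} {z} x≈y y≈z ε 0<ε with x≈y (half ε) (half-pos 0<ε) | y≈z (half ε) (half-pos 0<ε)
  ... | M , p | N , q = M ℕ.⊔ N , λ n le →
    ℚ.≤-<-trans (triangle (seq x n) (seq y n) (seq z n))
      (subst (_ ℚ.<_) (half+half ε)
        (ℚ.+-mono-< (p n (ℕ.m⊔n≤o⇒m≤o M N le)) (q n (ℕ.m⊔n≤o⇒n≤o M N le))))

ℝ-setoid : Setoid 0ℓ 0ℓ
ℝ-setoid = record { isEquivalence = ≈ℝ-isEquivalence }

fromℚ : ℚ → ℝ
fromℚ q = mkℝ (λ _ → q) λ ε 0<ε → 0 , λ _ _ _ _ → subst (ℚ._< ε) (sym (∣x-x∣≡0 q)) 0<ε

infixl 6 _+ℝ_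
infixl 7 _*ℝ_
infix  8 -ℝ_

_+ℝ_ : ℝ → ℝ → ℝ
x +ℝ y = mkℝ (λ n → seq x n ℚ.+ seq y n) +-cauchy
  where
  +-cauchy : ∀ ε → 0ℚ ℚ.< ε → ∃ λ N → ∀ m n → N ℕ.≤ m → N ℕ.≤ n →
             ℚ.∣ (seq x m ℚ.+ seq y m) ℚ.- (seq x n ℚ.+ seq y n) ∣ ℚ.< ε
  +-cauchy ε 0<ε with cauchy x (half ε) (half-pos 0<ε) | cauchy y (half ε) (half-pos 0<ε)
  ... | M , p | N , q = M ℕ.⊔ N , λ m n lm ln →
    +-close {ε} {seq x m} {seq y m} {seq x n} {seq y n}
            (p m n (ℕ.m⊔n≤o⇒m≤o M N lm) (ℕ.m⊔n≤o⇒m≤o M N ln))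
            (q m n (ℕ.m⊔n≤o⇒n≤o M N lm) (ℕ.m⊔n≤o⇒n≤o M N ln))

-ℝ_ : ℝ → ℝ
-ℝ x = mkℝ (λ n → ℚ.- seq x n) λ ε 0<ε → map₂ (λ p m n lm ln →
  subst (ℚ._< ε) (sym (trans (cong ℚ.∣_∣ (sym (ℚ.neg-distrib-+ (seq x m) (ℚ.- seq x n))))
                             (ℚ.∣-p∣≡∣p∣ (seq x m ℚ.- seq x n))))
        (p m n lm ln)) (cauchy x ε 0<ε)

private
  eventually-bounded : ∀ x → ∃₂ λ N B → (0ℚ ℚ.< B) × (∀ n → N ℕ.≤ n → ℚ.∣ seq x n ∣ ℚ.≤ B)
  eventually-bounded x with cauchy x 1ℚ (ℚ.positive⁻¹ 1ℚ)
  ... | N , p = N , 1ℚ ℚ.+ ℚ.∣ seq x N ∣ ,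
    ℚ.+-mono-<-≤ (ℚ.positive⁻¹ 1ℚ) (ℚ.0≤∣p∣ (seq x N)) ,
    λ n le → begin
      ℚ.∣ seq x n ∣
        ≡⟨ cong ℚ.∣_∣ (solve 2 (λ a b → a := (a :- b) :+ b) refl (seq x n) (seq x N)) ⟩
      ℚ.∣ (seq x n ℚ.- seq x N) ℚ.+ seq x N ∣
        ≤⟨ ℚ.∣p+q∣≤∣p∣+∣q∣ (seq x n ℚ.- seq x N) (seq x N) ⟩
      ℚ.∣ seq x n ℚ.- seq x N ∣ ℚ.+ ℚ.∣ seq x N ∣
        ≤⟨ ℚ.+-monoˡ-≤ ℚ.∣ seq x N ∣ (ℚ.<⇒≤ (p n N le ℕ.≤-refl)) ⟩
      1ℚ ℚ.+ ℚ.∣ seq x N ∣ ∎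
    where open +-*-Solver
          open ℚ.≤-Reasoning

  quotient : ∀ {ε B} → 0ℚ ℚ.< ε → 0ℚ ℚ.< B → ∃ λ δ → (0ℚ ℚ.< δ) × (B ℚ.* δ ≡ ε)
  quotient {ε} {B} 0<ε 0<B = ε ℚ.* 1/B ,
    subst (ℚ._< ε ℚ.* 1/B) (ℚ.*-zeroˡ 1/B)
      (ℚ.*-monoˡ-<-pos 1/B {{ℚ.1/pos⇒pos B {{ℚ.positive 0<B}}}} 0<ε) ,
    trans (solve 3 (λ b e i → b :* (e :* i) := e :* (b :* i)) refl B ε 1/B)
      (trans (cong (ε ℚ.*_) (ℚ.*-inverseʳ B {{B≢0}})) (ℚ.*-identityʳ ε))
    where
    open +-*-Solver
    B≢0 : ℚ.NonZero B
    B≢0 = ℚ.pos⇒nonZero B {{ℚ.positive 0<B}}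
    1/B : ℚ
    1/B = ℚ.1/_ B {{B≢0}}

  ∣*∣-bound : ∀ {B δ u v} → 0ℚ ℚ.< B → ℚ.∣ u ∣ ℚ.≤ B → ℚ.∣ v ∣ ℚ.< δ →
              ℚ.∣ u ℚ.* v ∣ ℚ.< B ℚ.* δ
  ∣*∣-bound {B} {δ} {u} {v} 0<B u≤B v<δ = begin-strict
    ℚ.∣ u ℚ.* v ∣         ≡⟨ ℚ.∣p*q∣≡∣p∣*∣q∣ u v ⟩
    ℚ.∣ u ∣ ℚ.* ℚ.∣ v ∣   ≤⟨ ℚ.*-monoʳ-≤-nonNeg ℚ.∣ v ∣ {{ℚ.nonNegative (ℚ.0≤∣p∣ v)}} u≤B ⟩
    B ℚ.* ℚ.∣ v ∣         <⟨ ℚ.*-monoʳ-<-pos B {{ℚ.positive 0<B}} v<δ ⟩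
    B ℚ.* δ               ∎
    where open ℚ.≤-Reasoning

  *-close : ∀ {B C β γ a b c d} → 0ℚ ℚ.< B → 0ℚ ℚ.< C →
            ℚ.∣ a ∣ ℚ.≤ B → ℚ.∣ d ∣ ℚ.≤ C →
            ℚ.∣ b ℚ.- d ∣ ℚ.< β → ℚ.∣ a ℚ.- c ∣ ℚ.< γ →
            ℚ.∣ a ℚ.* b ℚ.- c ℚ.* d ∣ ℚ.< B ℚ.* β ℚ.+ C ℚ.* γ
  *-close {B} {C} {β} {γ} {a} {b} {c} {d} 0<B 0<C a≤B d≤C bd ac = begin-strict
    ℚ.∣ a ℚ.* b ℚ.- c ℚ.* d ∣
      ≡⟨ cong ℚ.∣_∣ (solve 4 (λ a b c d →
           a :* b :- c :* d := a :* (b :- d) :+ d :* (a :- c)) refl a b c d) ⟩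
    ℚ.∣ a ℚ.* (b ℚ.- d) ℚ.+ d ℚ.* (a ℚ.- c) ∣
      ≤⟨ ℚ.∣p+q∣≤∣p∣+∣q∣ (a ℚ.* (b ℚ.- d)) (d ℚ.* (a ℚ.- c)) ⟩
    ℚ.∣ a ℚ.* (b ℚ.- d) ∣ ℚ.+ ℚ.∣ d ℚ.* (a ℚ.- c) ∣
      <⟨ ℚ.+-mono-< (∣*∣-bound {B} {β} {a} {b ℚ.- d} 0<B a≤B bd)
                    (∣*∣-bound {C} {γ} {d} {a ℚ.- c} 0<C d≤C ac) ⟩
    B ℚ.* β ℚ.+ C ℚ.* γ ∎
    where open +-*-Solver
          open ℚ.≤-Reasoning

_*ℝ_ : ℝ → ℝ → ℝ
x *ℝ y = mkℝ (λ n → seq x n ℚ.* seq y n) λ ε 0<ε →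
  let K , B , 0<B , x≤B = eventually-bounded x
      L , C , 0<C , y≤C = eventually-bounded y
      β , 0<β , Bβ≡     = quotient (half-pos 0<ε) 0<B
      γ , 0<γ , Cγ≡     = quotient (half-pos 0<ε) 0<C
      M , p             = cauchy x γ 0<γ
      N , q             = cauchy y β 0<β
  in (K ℕ.⊔ L) ℕ.⊔ (M ℕ.⊔ N) , λ m n lm ln →
    let KL≤m = ℕ.m⊔n≤o⇒m≤o (K ℕ.⊔ L) (M ℕ.⊔ N) lm
        KL≤n = ℕ.m⊔n≤o⇒m≤o (K ℕ.⊔ L) (M ℕ.⊔ N) ln
        MN≤m = ℕ.m⊔n≤o⇒n≤o (K ℕ.⊔ L) (M ℕ.⊔ N) lm
        MN≤n = ℕ.m⊔n≤o⇒n≤o (K ℕ.⊔ L) (M ℕ.⊔ N) ln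
    in subst (ℚ.∣ seq x m ℚ.* seq y m ℚ.- seq x n ℚ.* seq y n ∣ ℚ.<_)
         (trans (cong₂ ℚ._+_ Bβ≡ Cγ≡) (half+half ε))
         (*-close {B} {C} {β} {γ} {seq x m} {seq y m} {seq x n} {seq y n} 0<B 0<C
           (x≤B m (ℕ.m⊔n≤o⇒m≤o K L KL≤m)) (y≤C n (ℕ.m⊔n≤o⇒n≤o K L KL≤n))
           (q m n (ℕ.m⊔n≤o⇒n≤o M N MN≤m) (ℕ.m⊔n≤o⇒n≤o M N MN≤n))
           (p m n (ℕ.m⊔n≤o⇒m≤o M N MN≤m) (ℕ.m⊔n≤o⇒m≤o M N MN≤n)))

ℝ-rawRing : RawRing 0ℓ 0ℓ
ℝ-rawRing = record
  { Carrier = ℝ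
  ; _≈_     = _≈ℝ_
  ; _+_     = _+ℝ_
  ; _*_     = _*ℝ_
  ; -_      = -ℝ_
  ; 0#      = fromℚ 0ℚ
  ; 1#      = fromℚ 1ℚ
  }

module LinearAlgebra {c ℓ} (R : RawRing c ℓ) where

  open RawRing R
  open RawSemiringDefinitions rawSemiring using (sum; _^_)

  Matrix : ℕ → Set c
  Matrix n = Fin n → Fin n → Carrier

  -- Laplace expansion along the first row.
  det : ∀ {n} → Matrix n → Carrier
  det {ℕ.zero} M = 1#
  det {suc n}  M = sum λ j →
    ((- 1#) ^ toℕ j) * (M zero j * det (λ i k → M (suc i) (punchIn j k)))

  identity : ∀ {n} → Matrix n
  identity i j = if does (i Fin.≟ j) then 1# else 0#

  -- The value at x of the characteristic polynomial, det (x I - M).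
  charpoly : ∀ {n} → Matrix n → Carrier → Carrier
  charpoly M x = det λ i j → (x * identity i j) + (- M i j)

  -- The list L, regarded as a multiset, consists of the roots of the
  -- characteristic polynomial of M counted with multiplicity. Over ℝ an
  -- identity between values at all points is an identity of polynomials.
  IsSpectrum : ∀ {n} → Matrix n → List Carrier → Set _
  IsSpectrum M L = ∀ x → charpoly M x ≈ List.foldr (λ t p → (x + (- t)) * p) 1# L

open LinearAlgebra ℝ-rawRing public

TwoDistinctElements : List ℝ → Set
TwoDistinctElements D = ∃₂ λ θ τ →
  ¬ (θ ≈ℝ τ) × θ ∈ℝ D × τ ∈ℝ D × All (λ t → t ≈ℝ θ ⊎ t ≈ℝ τ) D
  where open SetoidMembership ℝ-setoid renaming (_∈_ to _∈ℝ_)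

record Graph (V : Set) : Set₁ where
  field
    order       : ℕ
    enumeration : V ↔ Fin order
    Adj         : V → V → Set
    adj?        : Decidable Adj
    symmetric   : Symmetric Adj
    irreflexive : Irreflexive _≡_ Adj

open Graph public using (Adj)

adjacencyMatrix : ∀ {V} (Y : Graph V) → Matrix (Graph.order Y)
adjacencyMatrix Y i j = if does (adj? (from i) (from j)) then fromℚ 1ℚ else fromℚ 0ℚ
  where open Graph Y using (adj?; enumeration)
        open Inverse enumeration using (from)

infix 4 _≅_

_≅_ : ∀ {V W} → Graph V → Graph W → Set
_≅_ {V} {W} Y Z = Σ (V ↔ W) λ φ →
  ∀ u v → Adj Y u v ⇔ Adj Z (Inverse.to φ u) (Inverse.to φ v)

Bipartite : ∀ {V} → Graph V → Set
Bipartite {V} Y = ∃ λ (side : V → Bool) → ∀ {u v} → Adj Y u v → side u ≢ side v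

K : (m n : ℕ) → Graph (Fin m ⊎ Fin n)
K m n = record
  { order       = m ℕ.+ n
  ; enumeration = ↔-sym Fin.+↔⊎
  ; Adj         = Opposite
  ; adj?        = λ where
      (inj₁ _) (inj₁ _) → no λ()
      (inj₁ _) (inj₂ _) → yes tt
      (inj₂ _) (inj₁ _) → yes tt
      (inj₂ _) (inj₂ _) → no λ()
  ; symmetric   = λ {u} {v} → opposite-sym u v
  ; irreflexive = λ {u} → opposite-irrefl u
  }
  where
  Opposite : Fin m ⊎ Fin n → Fin m ⊎ Fin n → Set
  Opposite (inj₁ _) (inj₁ _) = ⊥
  Opposite (inj₁ _) (inj₂ _) = ⊤
  Opposite (inj₂ _) (inj₁ _) = ⊤
  Opposite (inj₂ _) (inj₂ _) = ⊥

  opposite-sym : ∀ u v → Opposite u v → Opposite v u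
  opposite-sym (inj₁ _) (inj₂ _) _ = tt
  opposite-sym (inj₂ _) (inj₁ _) _ = tt

  opposite-irrefl : ∀ u {v} → u ≡ v → ¬ Opposite u v
  opposite-irrefl (inj₁ _) refl ()
  opposite-irrefl (inj₂ _) refl ()

CompleteBipartite : ∀ {V} → Graph V → Set
CompleteBipartite Y = ∃₂ λ m n → 1 ℕ.≤ m × 1 ℕ.≤ n × Y ≅ K m n

module _ {V : Set} (Y : Graph V) where

  data Walk : V → V → ℕ → Set where
    nil  : ∀ {v} → Walk v v 0
    cons : ∀ {u v w n} → Adj Y u v → Walk v w n → Walk u w (suc n)

  vertices : ∀ {u v n} → Walk u v n → List V
  vertices {u} nil        = u ∷ []
  vertices {u} (cons _ p) = u ∷ vertices p

  IsPath : ∀ {u v n} → Walk u v n → Set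
  IsPath p = Unique (vertices p)

  Connected : Set
  Connected = ∀ u v → ∃ (Walk u v)

  -- A cycle is a path of length at least 2 whose end vertices are adjacent.
  Acyclic : Set
  Acyclic = ∀ {u v n} (p : Walk u v n) → IsPath p → 2 ℕ.≤ n → ¬ Adj Y v u

  Distance : V → V → ℕ → Set
  Distance u v d = Walk u v d × (∀ {n} → Walk u v n → d ℕ.≤ n)

  HasDiameter : ℕ → Set
  HasDiameter d = (∀ u v → ∃ λ i → Distance u v i × i ℕ.≤ d) ×
                  (∃₂ λ u v → Distance u v d)

HasCardinality : {A : Set} → Pred A 0ℓ → ℕ → Set
HasCardinality P k = ∃ λ xs → Unique xs × (∀ x → x ∈ₗ xs ⇔ P x) × length xs ≡ k
  where open ListMembership renaming (_∈_ to _∈ₗ_)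

DistanceRegular : ∀ {V} → Graph V → Set
DistanceRegular Y = Connected Y × ∃₂ λ (b c : ℕ → ℕ) →
  ∀ i v w → Distance Y v w i →
    HasCardinality (λ x → Adj Y w x × Distance Y v x (suc i)) (b i) ×
    HasCardinality (λ x → Adj Y w x × ∃ λ j → suc j ≡ i × Distance Y v x j) (c i)

IsSpanningTree : ∀ {V} → Graph V → Graph V → Set
IsSpanningTree T Y = (∀ {u v} → Adj T u v → Adj Y u v) × Connected T × Acyclic T

-- Perm._≈_ is pointwise equality; closure under it makes Mem a set of
-- permutations rather than of their representations.
record PermutationGroup (r : ℕ) : Set₁ where
  field
    Mem    : Pred (Permutation′ r) 0ℓ
    resp   : ∀ {g h} → g Perm.≈ h → Mem g → Mem h
    id-mem : Mem Perm.id
    ∘-mem  : ∀ {g h} → Mem g → Mem h → Mem (g ∘ₚ h)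
    ⁻¹-mem : ∀ {g} → Mem g → Mem (flip g)

open PermutationGroup public using (Mem)

data Generated {r} (S : Pred (Permutation′ r) 0ℓ) : Permutation′ r → Set where
  generator : ∀ {g} → g ∈ S → Generated S g
  identityᵍ : Generated S Perm.id
  compose   : ∀ {g h} → Generated S g → Generated S h → Generated S (g ∘ₚ h)
  inverse   : ∀ {g} → Generated S g → Generated S (flip g)
  respects  : ∀ {g h} → g Perm.≈ h → Generated S g → Generated S h

⟪_⟫ : ∀ {r} → Pred (Permutation′ r) 0ℓ → PermutationGroup r
⟪ S ⟫ = record
  { Mem    = Generated S
  ; resp   = respects
  ; id-mem = identityᵍ
  ; ∘-mem  = compose
  ; ⁻¹-mem = inverse
  }

ActsRegularly : ∀ {r} → PermutationGroup r → Set
ActsRegularly {r} H = ∀ (i j : Fin r) → ∃! Perm._≈_ λ h → Mem H h × h ⟨$⟩ʳ i ≡ j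

CyclicGroup : ∀ {r} → PermutationGroup r → Set
CyclicGroup H = ∃ λ g → Mem H ≐ Mem ⟪ g ≡_ ⟫

-- The value 0 of an arc function is represented by nothing.
record ArcFunction {V : Set} (Y : Graph V) {r : ℕ} (G : PermutationGroup r) : Set where
  field
    value   : V → V → Maybe (Permutation′ r)
    in-G    : ∀ {u v g} → value u v ≡ just g → Mem G g
    zero⇔   : ∀ u v → value u v ≡ nothing ⇔ (¬ Adj Y u v)
    reverse : ∀ {u v g} → value u v ≡ just g →
              ∃ λ h → value v u ≡ just h × g Perm.≈ flip h

module _ {V : Set} {Y : Graph V} {r : ℕ} {G : PermutationGroup r} (f : ArcFunction Y G) where

  open ArcFunction f

  CoverAdj : V × Fin r → V × Fin r → Set
  CoverAdj (v , j) (u , k) = Adj Y v u × ∃ λ g → value u v ≡ just g × g ⟨$⟩ʳ j ≡ k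

  private
    carries? : ∀ (w : Maybe (Permutation′ r)) j k → Dec (∃ λ g → w ≡ just g × g ⟨$⟩ʳ j ≡ k)
    carries? nothing  j k = no λ ()
    carries? (just g) j k = map′ (λ e → g , refl , e) (λ where (_ , refl , e) → e)
                                 (g ⟨$⟩ʳ j Fin.≟ k)

    CoverAdj-sym : Symmetric CoverAdj
    CoverAdj-sym {_ , j} (v~u , g , eq , refl) with reverse eq
    ... | h , eq′ , g≈h⁻¹ =
      Graph.symmetric Y v~u , h , eq′ ,
      trans (cong (h ⟨$⟩ʳ_) (g≈h⁻¹ j)) (Perm.inverseʳ h)

  cover : Graph (V × Fin r)
  cover = record
    { order       = Graph.order Y ℕ.* r
    ; enumeration = ↔-sym Fin.*↔× ↔-∘ (Graph.enumeration Y ×-↔ ↔-id (Fin r))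
    ; Adj         = CoverAdj
    ; adj?        = λ where
        (v , j) (u , k) → Graph.adj? Y v u ×-dec carries? (value u v) j k
    ; symmetric   = CoverAdj-sym
    ; irreflexive = λ where refl (v~v , _) → Graph.irreflexive Y refl v~v
    }

  Normalized : Set₁
  Normalized = ∃ λ (T : Graph V) → IsSpanningTree T Y ×
    (∀ {u v} → Adj T u v → ∃ λ g → value u v ≡ just g × g Perm.≈ Perm.id)

  ⟨f⟩ : PermutationGroup r
  ⟨f⟩ = ⟪ (λ g → ∃₂ λ u v → value u v ≡ just g) ⟫

  -- The multiset difference is a D with Spec(A(Yᶠ)) = Spec(A(Y)) + D.
  Is2evCover : Set
  Is2evCover = ∃₂ λ L M → IsSpectrum (adjacencyMatrix Y) L ×
                          IsSpectrum (adjacencyMatrix cover) M ×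
                          ∃ λ D → M ↭ L ++ D × TwoDistinctElements D
    where open SetoidPermutation ℝ-setoid using (_↭_)

{-# OPTIONS --safe #-}
module Submission where

-- Let A and B be the adjacency matrices of Y and of the cover. Multiplicativity of det gives
-- χ(M²)(x²) = ± χ(M)(x) χ(M)(-x), so χ(B) = χ(A) ∏_D (x - λ) implies the same identity for the squares
-- and the fourth powers, and comparing subleading coefficients expresses ∑_D λ² and ∑_D λ⁴ by traces.
-- Both graphs are bipartite, so the multiset D is symmetric under negation; having two distinct
-- elements, it consists of θ and -θ. Hence |D| (tr B⁴ - tr A⁴) = (tr B² - tr A²)².
-- For K_{m,n} this is an identity between squares of numbers of common neighbours, which Cauchy-Schwarz
-- turns into: m = n, and vertices in different fibres on the same side have exactly n/r common
-- neighbours. That determines all distances in the cover and its intersection array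
-- {n, n-1, n-n/r, 1; 1, n/r, n-1, n}.

open import Algebra.Bundles using (CommutativeRing)
open import Algebra.Bundles.Raw using (RawRing)
import Algebra.Properties.Semiring.Mult
import Algebra.Properties.Semiring.Sum
open import Algebra.Structures using (IsCommutativeRing)
open import Data.Bool.Base using (Bool; true; false; not; if_then_else_)
import Data.Bool.Properties as Bool
open import Data.Fin.Base as Fin using (Fin; zero; suc; punchIn; punchOut; toℕ; splitAt; quotRem)
open import Data.Fin.Permutation as Perm using (_⟨$⟩ʳ_; _⟨$⟩ˡ_)
import Data.Fin.Properties as Fin
open import Data.Integer.Base as ℤ using (ℤ; -[1+_])
import Data.Integer.Properties as ℤ
open import Data.List.Base as List using (List; []; _∷_; _++_; length; filter)
open import Data.List.Membership.Propositional using () renaming (_∈_ to _∈ₗ_)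
open import Data.List.Membership.Propositional.Properties
  using (∈-filter⁺; ∈-filter⁻; ∈-tabulate⁺; ∈-tabulate⁻; ∈-map⁺; ∈-map⁻)
import Data.List.Membership.Setoid
import Data.List.Properties as List
import Data.List.Relation.Binary.Permutation.Setoid
open import Data.List.Relation.Binary.Pointwise using (Pointwise; []; _∷_)
open import Data.List.Relation.Unary.All using (All; []; _∷_)
open import Data.List.Relation.Unary.Any using (here; there)
import Data.List.Relation.Unary.Unique.Propositional.Properties as Unique
open import Data.Maybe.Base as Maybe using (just; nothing)
open import Data.Maybe.Properties using (just-injective)
open import Data.Nat.Base as ℕ using (ℕ; zero; suc; NonZero)
open import Data.Nat.Divisibility using (_∣_; divides)
open import Data.Nat.GeneralisedArithmetic using (fold)
import Data.Nat.Properties as ℕ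
import Data.Nat.Solver as ℕ-Solver
open import Data.Product.Base using (_×_; _,_; proj₁; proj₂; ∃; ∃₂; map₂; swap)
open import Data.Rational.Base as ℚ using (ℚ; 0ℚ; 1ℚ)
import Data.Rational.Properties as ℚ
import Data.Rational.Solver as ℚ-Solver
open import Data.Sum.Base as Sum using (_⊎_; inj₁; inj₂; [_,_]′)
open import Data.Sum.Function.Propositional using (_⊎-↔_)
open import Data.Unit.Base using (tt)
import Data.Unit.Polymorphic.Base as Polymorphic
open import Data.Vec.Base using (Vec; []; _∷_)
open import Data.Vec.Functional using (insertAt; removeAt)
import Data.Vec.Properties as Vec
open import Function.Base using (_∘_; id)
open import Function.Bundles using (_↔_; _⇔_; Inverse; Equivalence; mk⇔; mk↔ₛ′)
open import Function.Construct.Composition using (_↔-∘_)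
open import Function.Construct.Identity using (↔-id)
open import Function.Construct.Symmetry using (↔-sym)
open import Level using (0ℓ; _⊔_)
open import Relation.Binary.Definitions using (tri<; tri≈; tri>)
open import Relation.Binary.PropositionalEquality as ≡ using (_≡_; _≢_)
open import Relation.Nullary using (¬_; Dec; yes; no; does; contradiction)
open import Relation.Nullary.Decidable using (does-⇔; dec-true; dec-false; dec⇒maybe)
open import Relation.Unary using (Pred; Decidable)
open import Defs using (module LinearAlgebra)

-- Two obstacles shape the algebra. `IsSpectrum` equates values at every point, so polynomials
-- appear as functions with a degree bound, and characteristic zero supplies the infinitely many
-- points that turn pointwise identities into identities of coefficients. Equality of reals is
-- undecidable, so no proof branches on it: roots are located under a double negation, which
-- `stable` removes, and a factor is cancelled by comparing coefficients instead of dividing. Closed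
-- walk counts return to ℕ because naturals embed injectively. The rigidity comes from positivity.
-- With |D| = (m + n)(r - 1) and tr B² - tr A² = 2mn(r - 1), the trace identity says that a positive
-- multiple of (m - n)² plus a positive multiple of the Cauchy-Schwarz defects of both sides is
-- zero, so all of them vanish at once. Then n/r is a number of common neighbours, hence an integer,
-- and r divides n. A walk of length 3 between non-adjacent points of opposite sides uses a second
-- fibre on a side, so K_{1,1} is treated apart: there a normalized cover has a trivial group, and
-- transitivity forces r = 1.

module IntegerSolver {c ℓ} (R : CommutativeRing c ℓ) where

  open CommutativeRing R
  open import Data.Integer.Base using (+_) public
  open import Algebra.Properties.Ring ring
  open import Algebra.Properties.AbelianGroup +-abelianGroup
  open import Algebra.Properties.CommutativeSemigroup +-commutativeSemigroup using (interchange)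
  open import Algebra.Properties.Semiring.Mult.TCOptimised semiring renaming (_×_ to _×ₙ_)
  open import Algebra.Solver.Ring.AlmostCommutativeRing
  open import Relation.Binary.Reasoning.Setoid setoid

  -- Integer coefficients give the ring solver a decidable test for equal coefficients, which the
  -- ring itself need not have; cancellations such as 1 - 1 = 0 thereby become automatic in every
  -- commutative ring.
  ⟦_⟧ℤ : ℤ → Carrier
  ⟦ + n ⟧ℤ      = n ×ₙ 1#
  ⟦ -[1+ n ] ⟧ℤ = - (suc n ×ₙ 1#)

  ⟦⟧-⊖ : ∀ m n → ⟦ m ℤ.⊖ n ⟧ℤ ≈ m ×ₙ 1# - n ×ₙ 1#
  ⟦⟧-⊖ m       zero    = sym (trans (+-congˡ ε⁻¹≈ε) (+-identityʳ _))
  ⟦⟧-⊖ zero    (suc n) = sym (+-identityˡ _)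
  ⟦⟧-⊖ (suc m) (suc n) = begin
    ⟦ suc m ℤ.⊖ suc n ⟧ℤ               ≡⟨ ≡.cong ⟦_⟧ℤ (ℤ.[1+m]⊖[1+n]≡m⊖n m n) ⟩
    ⟦ m ℤ.⊖ n ⟧ℤ                       ≈⟨ ⟦⟧-⊖ m n ⟩
    m ×ₙ 1# - n ×ₙ 1#                    ≈⟨ +-identityˡ _ ⟨
    0# + (m ×ₙ 1# - n ×ₙ 1#)             ≈⟨ +-congʳ (-‿inverseʳ 1#) ⟨
    1# - 1# + (m ×ₙ 1# - n ×ₙ 1#)        ≈⟨ interchange 1# (- 1#) (m ×ₙ 1#) (- (n ×ₙ 1#)) ⟩
    1# + m ×ₙ 1# + (- 1# - n ×ₙ 1#)      ≈⟨ +-congˡ (⁻¹-∙-comm 1# (n ×ₙ 1#)) ⟩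
    1# + m ×ₙ 1# - (1# + n ×ₙ 1#)        ≈⟨ +-cong (1+× m 1#) (-‿cong (1+× n 1#)) ⟨
    suc m ×ₙ 1# - suc n ×ₙ 1#            ∎

  ⟦⟧-+ : ∀ i j → ⟦ i ℤ.+ j ⟧ℤ ≈ ⟦ i ⟧ℤ + ⟦ j ⟧ℤ
  ⟦⟧-+ (+ m)      (+ n)      = ×-homo-+ 1# m n
  ⟦⟧-+ (+ m)      -[1+ n ]   = ⟦⟧-⊖ m (suc n)
  ⟦⟧-+ -[1+ m ]   (+ n)      = trans (⟦⟧-⊖ n (suc m)) (+-comm _ _)
  ⟦⟧-+ -[1+ m ]   -[1+ n ]   = begin
    - (suc (suc (m ℕ.+ n)) ×ₙ 1#)       ≡⟨ ≡.cong (λ k → - (suc k ×ₙ 1#)) (ℕ.+-suc m n) ⟨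
    - ((suc m ℕ.+ suc n) ×ₙ 1#)         ≈⟨ -‿cong (×-homo-+ 1# (suc m) (suc n)) ⟩
    - (suc m ×ₙ 1# + suc n ×ₙ 1#)        ≈⟨ ⁻¹-∙-comm _ _ ⟨
    - (suc m ×ₙ 1#) - suc n ×ₙ 1#        ∎

  ⟦⟧-neg : ∀ i → ⟦ ℤ.- i ⟧ℤ ≈ - ⟦ i ⟧ℤ
  ⟦⟧-neg (+ zero)   = sym ε⁻¹≈ε
  ⟦⟧-neg (+ suc n)  = refl
  ⟦⟧-neg -[1+ n ]   = sym (⁻¹-involutive _)

  ⟦⟧-pos* : ∀ m j → ⟦ + m ℤ.* j ⟧ℤ ≈ (m ×ₙ 1#) * ⟦ j ⟧ℤ
  ⟦⟧-pos* m (+ n) = trans (reflexive (≡.cong ⟦_⟧ℤ (≡.sym (ℤ.pos-* m n)))) (×1-homo-* m n)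
  ⟦⟧-pos* m -[1+ n ] = begin
    ⟦ + m ℤ.* ℤ.- (+ suc n) ⟧ℤ         ≡⟨ ≡.cong ⟦_⟧ℤ (ℤ.neg-distribʳ-* (+ m) (+ suc n)) ⟨
    ⟦ ℤ.- (+ m ℤ.* + suc n) ⟧ℤ         ≈⟨ ⟦⟧-neg (+ m ℤ.* + suc n) ⟩
    - ⟦ + m ℤ.* + suc n ⟧ℤ             ≈⟨ -‿cong (⟦⟧-pos* m (+ suc n)) ⟩
    - ((m ×ₙ 1#) * (suc n ×ₙ 1#))        ≈⟨ -‿distribʳ-* _ _ ⟩
    (m ×ₙ 1#) * - (suc n ×ₙ 1#)          ∎

  ⟦⟧-* : ∀ i j → ⟦ i ℤ.* j ⟧ℤ ≈ ⟦ i ⟧ℤ * ⟦ j ⟧ℤ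
  ⟦⟧-* (+ m) j = ⟦⟧-pos* m j
  ⟦⟧-* -[1+ m ] j = begin
    ⟦ ℤ.- (+ suc m) ℤ.* j ⟧ℤ           ≡⟨ ≡.cong ⟦_⟧ℤ (ℤ.neg-distribˡ-* (+ suc m) j) ⟨
    ⟦ ℤ.- (+ suc m ℤ.* j) ⟧ℤ           ≈⟨ ⟦⟧-neg (+ suc m ℤ.* j) ⟩
    - ⟦ + suc m ℤ.* j ⟧ℤ               ≈⟨ -‿cong (⟦⟧-pos* (suc m) j) ⟩
    - ((suc m ×ₙ 1#) * ⟦ j ⟧ℤ)          ≈⟨ -‿distribˡ-* _ _ ⟩
    - (suc m ×ₙ 1#) * ⟦ j ⟧ℤ            ∎

  morphism : CommutativeRing.rawRing ℤ.+-*-commutativeRing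
               -Raw-AlmostCommutative⟶ fromCommutativeRing R
  morphism = record
    { ⟦_⟧    = ⟦_⟧ℤ
    ; +-homo = ⟦⟧-+
    ; *-homo = ⟦⟧-*
    ; -‿homo = ⟦⟧-neg
    ; 0-homo = refl
    ; 1-homo = refl
    }

  open import Algebra.Solver.Ring _ _ morphism
    (λ i j → Maybe.map (λ i≡j → reflexive (≡.cong ⟦_⟧ℤ i≡j))
                                 (dec⇒maybe (i ℤ.≟ j))) public
    using (solve; _:=_; _:+_; _:*_; _:-_; :-_; con)

-- Determinants: alternating multilinear forms and multiplicativity

module Determinant {c ℓ} (R : CommutativeRing c ℓ) where

  open CommutativeRing R hiding (zero)
  open LinearAlgebra rawRing
  open import Data.Vec.Base using (lookup; map; tabulate)
  open IntegerSolver R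
  open import Algebra.Properties.Ring ring
  open import Algebra.Properties.AbelianGroup +-abelianGroup
  open import Algebra.Properties.Semiring.Sum semiring
  open import Algebra.Properties.Semiring.Exp semiring using (_^_)
  open import Relation.Binary.Reasoning.Setoid setoid

  Row : ℕ → Set c
  Row m = Fin m → Carrier

  Form : ℕ → ℕ → Set c
  Form n m = Vec (Row m) n → Carrier

  infix  4 _≋_
  infixl 6 _⊕_
  infixl 7 _⊙_

  _≋_ : ∀ {m} → Row m → Row m → Set ℓ
  u ≋ w = ∀ k → u k ≈ w k

  _⊕_ : ∀ {m} → Row m → Row m → Row m
  (u ⊕ w) k = u k + w k

  _⊙_ : ∀ {m} → Carrier → Row m → Row m
  (a ⊙ w) k = a * w k

  sgn : ∀ {n} → Fin n → Carrier
  sgn j = (- 1#) ^ toℕ j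

  -- Additivity and homogeneity are merged into the single law `comb`. Rows are functions compared
  -- pointwise, so invariance under `≋` has to be part of linearity.
  record Linear {m} (G : Row m → Carrier) : Set (c ⊔ ℓ) where
    field
      resp : ∀ {u w} → u ≋ w → G u ≈ G w
      comb : ∀ u a w → G (u ⊕ a ⊙ w) ≈ G u + a * G w

  open Linear

  VanishesOnEqualHead : ∀ {m} n → Form (suc n) m → Set (c ⊔ ℓ)
  VanishesOnEqualHead zero    F = Polymorphic.⊤
  VanishesOnEqualHead (suc n) F = ∀ v t → F (v ∷ v ∷ t) ≈ 0#

  -- The recursion follows the vector of rows: a form is linear in its head, vanishes when the first
  -- two rows agree, and is again such a form in the tail for each fixed head. Only neighbouring
  -- rows are compared; `ma-vanishes` recovers the other pairs.
  MultiAlternating : ∀ {m} n → Form n m → Set (c ⊔ ℓ)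
  MultiAlternating zero    F = Polymorphic.⊤
  MultiAlternating (suc n) F = (∀ t → Linear (λ v → F (v ∷ t)))
                             × VanishesOnEqualHead n F
                             × (∀ v → MultiAlternating n (λ t → F (v ∷ t)))

  linear-zero : ∀ {m} {G : Row m → Carrier} → Linear G → G (λ _ → 0#) ≈ 0#
  linear-zero {G = G} L = x+x≈x⇒x≈0 _ (begin
    G (λ _ → 0#) + G (λ _ → 0#)       ≈⟨ +-congˡ (*-identityˡ _) ⟨
    G (λ _ → 0#) + 1# * G (λ _ → 0#)  ≈⟨ comb L _ _ _ ⟨
    G (λ _ → 0# + 1# * 0#)            ≈⟨ resp L (λ _ → trans (+-identityˡ _) (*-identityˡ _)) ⟩
    G (λ _ → 0#)                      ∎)

  linear-sum : ∀ {m} {G : Row m → Carrier} → Linear G → ∀ {n} (a : Fin n → Carrier) (x : Fin n → Row m) →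
               G (λ k → sum λ j → a j * x j k) ≈ sum λ j → a j * G (x j)
  linear-sum L {zero}  a x = linear-zero L
  linear-sum {G = G} L {suc n} a x = begin
    G (a zero ⊙ x zero ⊕ rest)          ≈⟨ resp L (λ _ → +-comm _ _) ⟩
    G (rest ⊕ a zero ⊙ x zero)          ≈⟨ comb L _ _ _ ⟩
    G rest + a zero * G (x zero)        ≈⟨ +-comm _ _ ⟩
    a zero * G (x zero) + G rest        ≈⟨ +-congˡ (linear-sum L (a ∘ suc) (x ∘ suc)) ⟩
    (sum λ j → a j * G (x j))           ∎
    where rest = λ k → sum λ j → a (suc j) * x (suc j) k

  linear-cong : ∀ {m} {G H : Row m → Carrier} → (∀ v → G v ≈ H v) → Linear G → Linear H
  linear-cong e L .resp u≋w    = trans (sym (e _)) (trans (resp L u≋w) (e _))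
  linear-cong e L .comb u a w = trans (sym (e _)) (trans (comb L u a w) (+-cong (e _) (*-congˡ (e _))))

  ma-cong : ∀ {m} n {F G : Form n m} → (∀ t → F t ≈ G t) → MultiAlternating n F → MultiAlternating n G
  ma-cong zero    e _ = _
  ma-cong (suc n) e (l , h , r) = (λ t → linear-cong (λ v → e (v ∷ t)) (l t)) , head n e h ,
                                  λ v → ma-cong n (λ t → e (v ∷ t)) (r v)
    where
    head : ∀ {m} n {F G : Form (suc n) m} → (∀ t → F t ≈ G t) →
           VanishesOnEqualHead n F → VanishesOnEqualHead n G
    head zero    e h = _
    head (suc n) e h v t = trans (sym (e _)) (h v t)

  linear-0 : ∀ {m} → Linear {m} (λ _ → 0#)
  linear-0 .resp _ = refl
  linear-0 .comb _ a _ = sym (trans (+-identityˡ _) (zeroʳ a))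

  ma-0 : ∀ {m} n → MultiAlternating {m} n (λ _ → 0#)
  ma-0 zero    = _
  ma-0 (suc n) = (λ _ → linear-0) , head n , λ _ → ma-0 n
    where
    head : ∀ {m} n → VanishesOnEqualHead {m} n (λ _ → 0#)
    head zero    = _
    head (suc n) _ _ = refl

  linear-+* : ∀ {m} {G H : Row m → Carrier} b → Linear G → Linear H → Linear (λ v → b * G v + H v)
  linear-+* b L K .resp e = +-cong (*-congˡ (resp L e)) (resp K e)
  linear-+* {G = G} {H} b L K .comb u a w = begin
    b * G (u ⊕ a ⊙ w) + H (u ⊕ a ⊙ w)                ≈⟨ +-cong (*-congˡ (comb L u a w)) (comb K u a w) ⟩
    b * (G u + a * G w) + (H u + a * H w)
      ≈⟨ solve 6 (λ b gu a gw hu hw → b :* (gu :+ a :* gw) :+ (hu :+ a :* hw)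
                    := b :* gu :+ hu :+ a :* (b :* gw :+ hw)) refl b (G u) a (G w) (H u) (H w) ⟩
    b * G u + H u + a * (b * G w + H w)              ∎

  ma-+* : ∀ {m} n {F G : Form n m} b → MultiAlternating n F → MultiAlternating n G →
          MultiAlternating n (λ t → b * F t + G t)
  ma-+* zero    b _ _ = _
  ma-+* (suc n) b (l , h , r) (l′ , h′ , r′) =
    (λ t → linear-+* b (l t) (l′ t)) , head n h h′ , λ v → ma-+* n b (r v) (r′ v)
    where
    head : ∀ {m} n {F G : Form (suc n) m} → VanishesOnEqualHead n F → VanishesOnEqualHead n G →
           VanishesOnEqualHead n (λ t → b * F t + G t)
    head zero    _ _ = _
    head (suc n) h h′ v t = trans (+-cong (trans (*-congˡ (h v t)) (zeroʳ b)) (h′ v t)) (+-identityˡ _)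

  ma-sum : ∀ {m} n {k} (b : Fin k → Carrier) {F : Fin k → Form n m} →
           (∀ j → MultiAlternating n (F j)) → MultiAlternating n (λ t → sum λ j → b j * F j t)
  ma-sum n {zero}  b r = ma-0 n
  ma-sum n {suc k} b r = ma-+* n (b zero) (r zero) (ma-sum n (b ∘ suc) (r ∘ suc))

  record LinearMap {m m′} (φ : Row m → Row m′) : Set (c ⊔ ℓ) where
    field
      φ-resp : ∀ {u w} → u ≋ w → φ u ≋ φ w
      φ-comb : ∀ u a w → φ (u ⊕ a ⊙ w) ≋ φ u ⊕ a ⊙ φ w

  open LinearMap

  ma-∘ : ∀ {m m′} n {F : Form n m′} {φ : Row m → Row m′} → LinearMap φ →
         MultiAlternating n F → MultiAlternating n (F ∘ map φ)
  ma-∘ zero    Φ _ = _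
  ma-∘ (suc n) {F} {φ} Φ (l , h , r) = lin , head n h , λ v → ma-∘ n Φ (r _)
    where
    lin : ∀ t → Linear (λ v → F (φ v ∷ map φ t))
    lin t .resp e = resp (l _) (φ-resp Φ e)
    lin t .comb u a w = trans (resp (l _) (φ-comb Φ u a w)) (comb (l _) _ a _)
    head : ∀ n {F} → VanishesOnEqualHead n F → VanishesOnEqualHead n (F ∘ map φ)
    head zero    _ = _
    head (suc n) h v t = h _ _

  removeAt-linear : ∀ {m} (j : Fin (suc m)) → LinearMap (λ v → removeAt v j)
  removeAt-linear j .φ-resp e k = e _
  removeAt-linear j .φ-comb u a w k = refl

  -- Polarisation: the form vanishes on u + w in both of the first two places, and expanding leaves
  -- exactly the two mixed terms.
  ma-swap : ∀ {m} n {F : Form (suc (suc n)) m} → MultiAlternating (suc (suc n)) F →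
            ∀ u w t → F (u ∷ w ∷ t) ≈ - F (w ∷ u ∷ t)
  ma-swap n {F} (l , h , r) u w t = inverseˡ-unique _ _ (begin
    F (u ∷ w ∷ t) + F (w ∷ u ∷ t)
      ≈⟨ +-cong (trans (sym (+-identityˡ _)) (+-cong (sym (h u t)) (sym (*-identityˡ _))))
                (trans (sym (+-identityʳ _)) (+-cong refl (trans (sym (h w t)) (sym (*-identityˡ _))))) ⟩
    F (u ∷ u ∷ t) + 1# * F (u ∷ w ∷ t) + (F (w ∷ u ∷ t) + 1# * F (w ∷ w ∷ t))
      ≈⟨ +-cong (comb (proj₁ (r u) t) u 1# w) (comb (proj₁ (r w) t) u 1# w) ⟨
    F (u ∷ s ∷ t) + F (w ∷ s ∷ t)             ≈⟨ +-congˡ (*-identityˡ _) ⟨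
    F (u ∷ s ∷ t) + 1# * F (w ∷ s ∷ t)        ≈⟨ comb (l (s ∷ t)) u 1# w ⟨
    F (s ∷ s ∷ t)                             ≈⟨ h s t ⟩
    0#                                        ∎)
    where s = u ⊕ 1# ⊙ w

  VanishesAt : ∀ {m} → Row m → ∀ n → Form n m → Set (c ⊔ ℓ)
  VanishesAt u zero    F = Polymorphic.⊤
  VanishesAt u (suc n) F = (∀ t → F (u ∷ t) ≈ 0#) × (∀ w → VanishesAt u n (λ t → F (w ∷ t)))

  vanishes-neg : ∀ {m} {u : Row m} n {F G : Form n m} → (∀ t → F t ≈ - G t) →
                 VanishesAt u n G → VanishesAt u n F
  vanishes-neg zero    e _ = _
  vanishes-neg (suc n) e (h , r) =
    (λ t → trans (e _) (trans (-‿cong (h t)) ε⁻¹≈ε)) , λ w → vanishes-neg n (λ t → e (w ∷ t)) (r w)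

  -- A second copy of u further down is reached by swapping u with its successor w: with w fixed in
  -- front, u heads a shorter form and the induction applies.
  ma-vanishes : ∀ {m} n {F : Form (suc n) m} → MultiAlternating (suc n) F →
                ∀ u → VanishesAt u n (λ t → F (u ∷ t))
  ma-vanishes zero    ma u = _
  ma-vanishes (suc n) {F} ma@(l , h , r) u = h u , λ w →
    vanishes-neg n (ma-swap n {F} ma u w) (ma-vanishes n (r w) u)

  -- If u already occurs among the rows, multiples of u may be dropped elsewhere.
  drop-multiples : ∀ {m} {u : Row m} n {F : Form n m} → MultiAlternating n F → VanishesAt u n F →
                   (ψ : Row m → Row m) (κ : Row m → Carrier) → (∀ w → w ≋ ψ w ⊕ κ w ⊙ u) →
                   ∀ t → F t ≈ F (map ψ t)
  drop-multiples zero    ma va ψ κ e [] = refl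
  drop-multiples {u = u} (suc n) {F} (l , _ , r) (h , r′) ψ κ e (w ∷ t) = begin
    F (w ∷ t)                        ≈⟨ resp (l t) (e w) ⟩
    F (ψ w ⊕ κ w ⊙ u ∷ t)            ≈⟨ comb (l t) _ _ _ ⟩
    F (ψ w ∷ t) + κ w * F (u ∷ t)    ≈⟨ +-congˡ (trans (*-congˡ (h t)) (zeroʳ _)) ⟩
    F (ψ w ∷ t) + 0#                 ≈⟨ +-identityʳ _ ⟩
    F (ψ w ∷ t)                      ≈⟨ drop-multiples n (r (ψ w)) (r′ (ψ w)) ψ κ e t ⟩
    F (ψ w ∷ map ψ t)                ∎

  ma-resp : ∀ {m} n {F : Form n m} → MultiAlternating n F → ∀ (x y : Fin n → Row m) →
            (∀ i → x i ≋ y i) → F (tabulate x) ≈ F (tabulate y)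
  ma-resp zero    ma x y e = refl
  ma-resp (suc n) (l , _ , r) x y e =
    trans (resp (l _) (e zero)) (ma-resp n (r _) (x ∘ suc) (y ∘ suc) (e ∘ suc))

  -1*sgn : ∀ {n} (j : Fin n) x → - (sgn j * x) ≈ sgn (suc j) * x
  -1*sgn j x = solve 2 (λ s x → :- (s :* x) := (:- con (+ 1)) :* s :* x) refl (sgn j) x

  -- Row j travels to the front by j swaps of neighbours, each of which costs a sign.
  ma-rotate : ∀ {m} n {F : Form (suc n) m} → MultiAlternating (suc n) F →
              ∀ (x : Fin (suc n) → Row m) j →
              F (x j ∷ tabulate (x ∘ punchIn j)) ≈ sgn j * F (tabulate x)
  ma-rotate n       ma x zero = sym (*-identityˡ _)
  ma-rotate (suc n) {F} ma@(l , h , r) x (suc j) = begin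
    F (x (suc j) ∷ x zero ∷ tabulate (x ∘ suc ∘ punchIn j))
      ≈⟨ ma-swap n {F} ma _ _ _ ⟩
    - F (x zero ∷ x (suc j) ∷ tabulate (x ∘ suc ∘ punchIn j))
      ≈⟨ -‿cong (ma-rotate n (r (x zero)) (x ∘ suc) j) ⟩
    - (sgn j * F (tabulate x))            ≈⟨ -1*sgn j _ ⟩
    sgn (suc j) * F (tabulate x)          ∎

  -- The same Laplace expansion as `det`, on a vector of rows, so that its recursion matches that of
  -- `MultiAlternating`.
  detᵛ : ∀ {n} → Form n n
  detᵛ []      = 1#
  detᵛ (v ∷ t) = sum λ j → sgn j * (v j * detᵛ (map (λ w → removeAt w j) t))

  det-cong : ∀ {n} {M N : Matrix n} → (∀ i k → M i k ≈ N i k) → det M ≈ det N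
  det-cong {zero}  e = refl
  det-cong {suc n} {M} {N} e = sum-cong-≋ λ j →
    *-congˡ {sgn j} (*-cong {M zero j} (e zero j) (det-cong {M = λ i k → M (suc i) (punchIn j k)} λ i k → e (suc i) (punchIn j k)))

  det-tabulate : ∀ {n} (M : Matrix n) → det M ≈ detᵛ (tabulate M)
  det-tabulate {zero}  M = refl
  det-tabulate {suc n} M = sum-cong-≋ λ j → *-congˡ {sgn j} (*-congˡ {M zero j} (trans
    (det-tabulate (λ i k → M (suc i) (punchIn j k)))
    (reflexive (≡.cong detᵛ (Vec.tabulate-∘ (λ w → removeAt w j) (M ∘ suc))))))

  -- G pairs off into opposite terms under (j , punchIn j k) ↔ (punchIn j k , j)
  Antisymmetric : ∀ n → (Fin (suc n) → Fin n → Carrier) → Set ℓ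
  Antisymmetric zero    G = Polymorphic.⊤
  Antisymmetric (suc n) G = (∀ k → G zero k + G (suc k) zero ≈ 0#)
                          × Antisymmetric n (λ j k → G (suc j) (suc k))

  antisymmetric-sum : ∀ n G → Antisymmetric n G → (sum λ j → sum λ k → G j k) ≈ 0#
  antisymmetric-sum zero    _ _ = +-identityˡ _
  antisymmetric-sum (suc n) G (e , a) = begin
    (sum λ k → G zero k) + (sum λ j → G (suc j) zero + (sum λ k → G (suc j) (suc k)))
      ≈⟨ +-congˡ (∑-distrib-+ (λ j → G (suc j) zero) (λ j → sum λ k → G (suc j) (suc k))) ⟩
    (sum λ k → G zero k) + ((sum λ j → G (suc j) zero) + (sum λ j → sum λ k → G (suc j) (suc k)))
      ≈⟨ +-congˡ (trans (+-congˡ (antisymmetric-sum n _ a)) (+-identityʳ _)) ⟩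
    (sum λ k → G zero k) + (sum λ j → G (suc j) zero)
      ≈⟨ ∑-distrib-+ (G zero) (λ j → G (suc j) zero) ⟨
    (sum λ k → G zero k + G (suc k) zero)
      ≈⟨ sum-cong-≋ {suc n} e ⟩
    (sum {suc n} λ k → 0#)
      ≈⟨ sum-replicate-zero (suc n) ⟩
    0# ∎

  -- Deleting column j and then column k, or the same two columns in the other order, leaves the
  -- same columns, but one of the two indices shifts by one, so the signs are opposite. The minor is
  -- abstracted to a function `D` of the surviving columns, which lets the induction remove a column
  -- from consideration.
  minors-antisymmetric : ∀ n (v : Row (suc (suc n))) (D : (Fin n → Fin (suc (suc n))) → Carrier) →
    (∀ g h → (∀ k → g k ≡ h k) → D g ≈ D h) →
    ∀ (G : Fin (suc (suc n)) → Fin (suc n) → Carrier) → (∀ j k → G j k ≈ sgn j * sgn k * (v j * v (punchIn j k) * D (punchIn j ∘ punchIn k))) →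
    Antisymmetric (suc n) G
  minors-antisymmetric n v D D-resp G e = pair , rest n v D D-resp G e
    where
    pair : ∀ k → G zero k + G (suc k) zero ≈ 0#
    pair k = trans (+-cong (e zero k) (e (suc k) zero))
      (solve 4 (λ s a b d → con (+ 1) :* s :* (a :* b :* d) :+ (:- con (+ 1)) :* s :* con (+ 1) :* (b :* a :* d)
                  := con (+ 0)) refl (sgn k) (v zero) (v (suc k)) (D (suc ∘ punchIn k)))
    rest : ∀ n (v : Row (suc (suc n))) (D : (Fin n → Fin (suc (suc n))) → Carrier) →
      (∀ g h → (∀ k → g k ≡ h k) → D g ≈ D h) →
      ∀ (G : Fin (suc (suc n)) → Fin (suc n) → Carrier) → (∀ j k → G j k ≈ sgn j * sgn k * (v j * v (punchIn j k) * D (punchIn j ∘ punchIn k))) →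
      Antisymmetric n (λ j k → G (suc j) (suc k))
    rest zero    v D D-resp G e = _
    -- Both deleted columns lie beyond column 0, which therefore survives; `Fin.lift 1` keeps it in
    -- place.
    rest (suc n) v D D-resp G e = minors-antisymmetric n (v ∘ suc) (D ∘ Fin.lift 1)
      (λ g h g≗h → D-resp _ _ λ { zero → ≡.refl ; (suc k) → ≡.cong suc (g≗h k) }) (λ j k → G (suc j) (suc k))
      λ j k → begin
        G (suc j) (suc k)
          ≈⟨ e (suc j) (suc k) ⟩
        sgn (suc j) * sgn (suc k) * (v (suc j) * v (suc (punchIn j k)) * D (punchIn (suc j) ∘ punchIn (suc k)))
          ≈⟨ *-cong (solve 2 (λ s t → (:- con (+ 1)) :* s :* ((:- con (+ 1)) :* t) := s :* t) refl (sgn j) (sgn k))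
                    (*-congˡ (D-resp _ _ λ { zero → ≡.refl ; (suc _) → ≡.refl })) ⟩
        sgn j * sgn k * (v (suc j) * v (suc (punchIn j k)) * D (Fin.lift 1 (punchIn j ∘ punchIn k)))
          ∎

  detᵛ-resp : ∀ {n} (t : Vec (Row n) n) (x : Fin n → Row n) → (∀ i k → lookup t i k ≈ x i k) →
              detᵛ t ≈ detᵛ (tabulate x)
  detᵛ-resp t x e = begin
    detᵛ t                     ≡⟨ ≡.cong detᵛ (Vec.tabulate∘lookup t) ⟨
    detᵛ (tabulate (lookup t)) ≈⟨ det-tabulate (lookup t) ⟨
    det (lookup t)             ≈⟨ det-cong e ⟩
    det x                      ≈⟨ det-tabulate x ⟩
    detᵛ (tabulate x)          ∎

  -- Expanding along both equal rows gives a double sum over ordered pairs of deleted columns, whose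
  -- terms cancel in pairs.
  detᵛ-equal-head : ∀ {n} (v : Row (suc (suc n))) t → detᵛ (v ∷ v ∷ t) ≈ 0#
  detᵛ-equal-head {n} v t = begin
    (sum λ j → sgn j * (v j * (sum λ k → sgn k * (v (punchIn j k) * minor j k))))
      ≈⟨ sum-cong-≋ {suc (suc n)} (λ j → trans (sym (*-assoc (sgn j) (v j) (sum λ k → sgn k * (v (punchIn j k) * minor j k))))
           (*-distribˡ-sum (sgn j * v j) (λ k → sgn k * (v (punchIn j k) * minor j k)))) ⟩
    (sum λ j → sum λ k → sgn j * v j * (sgn k * (v (punchIn j k) * minor j k)))
      ≈⟨ antisymmetric-sum (suc n) G (minors-antisymmetric n v D D-resp G λ j k →
           trans (*-congˡ (*-congˡ (*-congˡ (minor≈ j k))))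
             (solve 5 (λ s v s′ v′ d → s :* v :* (s′ :* (v′ :* d)) := s :* s′ :* (v :* v′ :* d))
                refl (sgn j) (v j) (sgn k) (v (punchIn j k)) (D (punchIn j ∘ punchIn k)))) ⟩
    0# ∎
    where
    minor : Fin (suc (suc n)) → Fin (suc n) → Carrier
    minor j k = detᵛ (map (λ w → removeAt w k) (map (λ w → removeAt w j) t))
    G : Fin (suc (suc n)) → Fin (suc n) → Carrier
    G j k = sgn j * v j * (sgn k * (v (punchIn j k) * minor j k))
    D : (Fin n → Fin (suc (suc n))) → Carrier
    D g = det (λ i k → lookup t i (g k))
    D-resp : ∀ g h → (∀ k → g k ≡ h k) → D g ≈ D h
    D-resp g h e = det-cong {M = λ i k → lookup t i (g k)} λ i k → reflexive (≡.cong (lookup t i) (e k))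
    minor≈ : ∀ j k → minor j k ≈ D (punchIn j ∘ punchIn k)
    minor≈ j k = let M = λ i l → lookup t i (punchIn j (punchIn k l)) in
     trans (detᵛ-resp (map (λ w → removeAt w k) (map (λ w → removeAt w j) t)) M λ i l → reflexive (≡.trans
        (≡.cong (λ w → w l) (Vec.lookup-map i (λ w → removeAt w k) (map (λ w → removeAt w j) t)))
        (≡.cong (λ w → w (punchIn k l)) (Vec.lookup-map i (λ w → removeAt w j) t))))
      (sym (det-tabulate M))

  detᵛ-multiAlternating : ∀ n → MultiAlternating n (detᵛ {n})
  detᵛ-multiAlternating zero    = _
  detᵛ-multiAlternating (suc n) = lin , head n , λ v →
    ma-cong n (λ t → sum-cong-≋ λ j → *-assoc (sgn j) (v j) (detᵛ (map (λ w → removeAt w j) t)))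
      (ma-sum n (λ j → sgn j * v j) λ j → ma-∘ n (removeAt-linear j) (detᵛ-multiAlternating n))
    where
    head : ∀ n → VanishesOnEqualHead n (detᵛ {suc n})
    head zero    = _
    head (suc n) = detᵛ-equal-head
    lin : ∀ t → Linear (λ v → detᵛ (v ∷ t))
    lin t .resp e = sum-cong-≋ λ j → *-congˡ {sgn j} (*-congʳ {detᵛ (map (λ w → removeAt w j) t)} (e j))
    lin t .comb u a w = begin
      (sum λ j → sgn j * ((u j + a * w j) * d j))
        ≈⟨ sum-cong-≋ (λ j → solve 5 (λ s u a w d → s :* ((u :+ a :* w) :* d)
               := s :* (u :* d) :+ a :* (s :* (w :* d))) refl (sgn j) (u j) a (w j) (d j)) ⟩
      (sum λ j → sgn j * (u j * d j) + a * (sgn j * (w j * d j)))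
        ≈⟨ ∑-distrib-+ (λ j → sgn j * (u j * d j)) (λ j → a * (sgn j * (w j * d j))) ⟩
      detᵛ (u ∷ t) + (sum λ j → a * (sgn j * (w j * d j)))
        ≈⟨ +-congˡ (*-distribˡ-sum a (λ j → sgn j * (w j * d j))) ⟨
      detᵛ (u ∷ t) + a * detᵛ (w ∷ t) ∎
      where d = λ j → detᵛ (map (λ w → removeAt w j) t)

  insertZero-linear : ∀ {m} (j : Fin (suc m)) → LinearMap (λ v → insertAt v j 0#)
  insertZero-linear zero    .φ-resp e zero    = refl
  insertZero-linear zero    .φ-resp e (suc k) = e k
  insertZero-linear {suc m} (suc j) .φ-resp e zero    = e zero
  insertZero-linear {suc m} (suc j) .φ-resp e (suc k) = insertZero-linear j .φ-resp (e ∘ suc) k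
  insertZero-linear zero    .φ-comb u a w zero    = sym (trans (+-identityˡ _) (zeroʳ a))
  insertZero-linear zero    .φ-comb u a w (suc k) = refl
  insertZero-linear {suc m} (suc j) .φ-comb u a w zero    = refl
  insertZero-linear {suc m} (suc j) .φ-comb u a w (suc k) =
    insertZero-linear j .φ-comb (u ∘ suc) a (w ∘ suc) k

  insertZero-removeAt : ∀ {m} (j : Fin (suc m)) w →
                        w ≋ insertAt (removeAt w j) j 0# ⊕ w j ⊙ identity j
  insertZero-removeAt zero    w zero    = sym (trans (+-identityˡ _) (*-identityʳ _))
  insertZero-removeAt zero    w (suc k) = sym (trans (+-congˡ (zeroʳ _)) (+-identityʳ _))
  insertZero-removeAt {suc m} (suc j) w zero    = sym (trans (+-congˡ (zeroʳ _)) (+-identityʳ _))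
  insertZero-removeAt {suc m} (suc j) w (suc k) = insertZero-removeAt j (w ∘ suc) k

  insertZero-identity : ∀ {m} (j : Fin (suc m)) i → insertAt (identity i) j 0# ≋ identity (punchIn j i)
  insertZero-identity zero    i zero    = refl
  insertZero-identity zero    i (suc k) = refl
  insertZero-identity {suc m} (suc j) zero zero    = refl
  insertZero-identity {suc m} (suc j) zero (suc k) = lemma j k
    where
    lemma : ∀ {m} (j : Fin (suc m)) k → insertAt (λ _ → 0#) j 0# k ≈ 0#
    lemma zero    zero    = refl
    lemma zero    (suc k) = refl
    lemma {suc m} (suc j) zero    = refl
    lemma {suc m} (suc j) (suc k) = lemma j k
  insertZero-identity {suc m} (suc j) (suc i) zero    = refl
  insertZero-identity {suc m} (suc j) (suc i) (suc k) = insertZero-identity j i k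

  identity-sum : ∀ {m} (v : Row m) → v ≋ (λ k → sum λ j → v j * identity j k)
  identity-sum {suc m} v zero = sym (trans (+-cong (*-identityʳ _)
      (trans (sum-cong-≋ {m} (λ j → zeroʳ (v (suc j)))) (sum-replicate-zero m))) (+-identityʳ _))
  identity-sum {suc m} v (suc k) = trans (identity-sum (v ∘ suc) k)
    (sym (trans (+-congʳ (zeroʳ _)) (+-identityˡ _)))

  identity-row : ∀ {m} (i : Fin m) (x : Row m) → x i ≈ sum λ j → identity i j * x j
  identity-row {suc m} zero x = sym (trans (+-cong (*-identityˡ _)
      (trans (sum-cong-≋ {m} (λ j → zeroˡ (x (suc j)))) (sum-replicate-zero m))) (+-identityʳ _))
  identity-row {suc m} (suc i) x = trans (identity-row i (x ∘ suc))
    (sym (trans (+-congʳ (zeroˡ _)) (+-identityˡ _)))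

  -- Uniqueness of the determinant up to a scalar. Once the head is the basis vector e_j, the j-th
  -- entries of all other rows may be set to zero; those rows then come from rows shorter by one,
  -- where the induction evaluates the form, and `ma-rotate` puts e_j back in its place with the
  -- sign of the Laplace expansion.
  form-det : ∀ n {F : Form n n} → MultiAlternating n F → ∀ t → F t ≈ detᵛ t * F (tabulate identity)
  form-det zero    ma [] = sym (*-identityˡ _)
  form-det (suc n) {F} ma@(l , h , r) (v ∷ t) = begin
    F (v ∷ t)                                       ≈⟨ resp (l t) (identity-sum v) ⟩
    F ((λ k → sum λ j → v j * identity j k) ∷ t)    ≈⟨ linear-sum (l t) v identity ⟩
    (sum λ j → v j * F (identity j ∷ t))            ≈⟨ sum-cong-≋ (λ j → trans (*-congˡ (step j))
         (solve 4 (λ v d s f → v :* (d :* (s :* f)) := s :* (v :* d) :* f) refl (v j) _ (sgn j) _)) ⟩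
    (sum λ j → sgn j * (v j * d j) * F (tabulate identity))
                                                    ≈⟨ *-distribʳ-sum _ (λ j → sgn j * (v j * d j)) ⟨
    detᵛ (v ∷ t) * F (tabulate identity)            ∎
    where
    d : Fin (suc n) → Carrier
    d j = detᵛ (map (λ w → removeAt w j) t)
    step : ∀ j → F (identity j ∷ t) ≈ d j * (sgn j * F (tabulate identity))
    step j = begin
      F (identity j ∷ t)
        ≈⟨ drop-multiples n (r _) (ma-vanishes n ma (identity j))
             (λ w → insertAt (removeAt w j) j 0#) (λ w → w j) (insertZero-removeAt j) t ⟩
      F (identity j ∷ map (λ w → insertAt (removeAt w j) j 0#) t)
        ≡⟨ ≡.cong (λ t → F (identity j ∷ t)) (Vec.map-∘ _ _ t) ⟩
      F (identity j ∷ map (λ w → insertAt w j 0#) (map (λ w → removeAt w j) t))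
        ≈⟨ form-det n (ma-∘ n (insertZero-linear j) (r (identity j))) (map (λ w → removeAt w j) t) ⟩
      d j * F (identity j ∷ map (λ w → insertAt w j 0#) (tabulate identity))
        ≡⟨ ≡.cong (λ t → d j * F (identity j ∷ t)) (Vec.tabulate-∘ _ identity) ⟨
      d j * F (identity j ∷ tabulate (λ i → insertAt (identity i) j 0#))
        ≈⟨ *-congˡ (ma-resp n (r _) _ _ (insertZero-identity j)) ⟩
      d j * F (identity j ∷ tabulate (identity ∘ punchIn j))
        ≈⟨ *-congˡ (ma-rotate n ma identity j) ⟩
      d j * (sgn j * F (tabulate identity)) ∎

  infixl 7 _·_

  _·_ : ∀ {n} → Matrix n → Matrix n → Matrix n
  (M · N) i k = sum λ j → M i j * N j k

  -- The rows of M · N are the images of the rows of M under v ↦ vN. The determinant composed with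
  -- this linear map is alternating, so by `form-det` it is det M times its value at the identity,
  -- which is det N.
  det-· : ∀ {n} (M N : Matrix n) → det (M · N) ≈ det M * det N
  det-· {n} M N = begin
    det (M · N)                                      ≈⟨ det-tabulate (M · N) ⟩
    detᵛ (tabulate (φ ∘ M))                          ≡⟨ ≡.cong detᵛ (Vec.tabulate-∘ φ M) ⟩
    detᵛ (map φ (tabulate M))                        ≈⟨ form-det n (ma-∘ n φ-linear (detᵛ-multiAlternating n)) (tabulate M) ⟩
    detᵛ (tabulate M) * detᵛ (map φ (tabulate identity))
      ≡⟨ ≡.cong (λ t → detᵛ (tabulate M) * detᵛ t) (Vec.tabulate-∘ φ identity) ⟨
    detᵛ (tabulate M) * detᵛ (tabulate (φ ∘ identity))
      ≈⟨ *-cong (det-tabulate M) (trans (det-cong {M = N} λ i k → identity-row i (λ j → N j k)) (det-tabulate (φ ∘ identity))) ⟨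
    det M * det N ∎
    where
    φ : Row n → Row n
    φ v k = sum λ j → v j * N j k
    φ-linear : LinearMap φ
    φ-linear .φ-resp e k = sum-cong-≋ λ j → *-congʳ (e j)
    φ-linear .φ-comb u a w k = begin
      (sum λ j → (u j + a * w j) * N j k)
        ≈⟨ sum-cong-≋ (λ j → solve 4 (λ u a w x → (u :+ a :* w) :* x := u :* x :+ a :* (w :* x))
             refl (u j) a (w j) (N j k)) ⟩
      (sum λ j → u j * N j k + a * (w j * N j k))
        ≈⟨ ∑-distrib-+ (λ j → u j * N j k) (λ j → a * (w j * N j k)) ⟩
      φ u k + (sum λ j → a * (w j * N j k))
        ≈⟨ +-congˡ (*-distribˡ-sum a (λ j → w j * N j k)) ⟨
      φ u k + a * φ w k ∎

-- The part of field theory that survives constructively for the reals: there are no inverses and no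
-- decidable equality, cancellation asks only that a factor is not zero, and equality is stable
-- under double negation. `char0` is stated as injectivity so that identities can be read back in ℕ.
record IsCharacteristicZeroDomain {c ℓ} (raw : RawRing c ℓ) : Set (c ⊔ ℓ) where
  open RawRing raw using (_≈_; _+_; _*_; -_; 0#; 1#)
  field
    isCommutativeRing : IsCommutativeRing _≈_ _+_ _*_ -_ 0# 1#
  commutativeRing : CommutativeRing c ℓ
  commutativeRing = record { isCommutativeRing = isCommutativeRing }
  open Algebra.Properties.Semiring.Mult (CommutativeRing.semiring commutativeRing) using () renaming (_×_ to _×ₙ_)
  field
    integral : ∀ {x y} → x * y ≈ 0# → ¬ x ≈ 0# → y ≈ 0#
    stable   : ∀ {x y} → ¬ ¬ x ≈ y → x ≈ y
    char0    : ∀ {m n} → m ×ₙ 1# ≈ n ×ₙ 1# → m ≡ n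

-- Polynomial functions over a domain of characteristic zero

module Polynomials {c ℓ} {raw : RawRing c ℓ} (K : IsCharacteristicZeroDomain raw) where

  open IsCharacteristicZeroDomain K using (commutativeRing; integral; char0)
  open CommutativeRing commutativeRing hiding (zero)
  open IntegerSolver commutativeRing
  open Algebra.Properties.Semiring.Mult semiring using () renaming (_×_ to _×ₙ_)
  open import Algebra.Properties.Ring ring
  open import Algebra.Properties.Semiring.Sum semiring
  open import Algebra.Properties.Semiring.Exp semiring using (_^_; ^-homo-*)
  open import Algebra.Properties.Semiring.Mult semiring using (×1-homo-*)
  open import Relation.Binary.Reasoning.Setoid setoid

  -- F agrees with a polynomial function of degree less than d.
  PolyLt : ℕ → (Carrier → Carrier) → Set (c ⊔ ℓ)
  PolyLt zero    F = Level.Lift c (∀ x → F x ≈ 0#)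
  PolyLt (suc d) F = ∃₂ λ a G → PolyLt d G × (∀ x → F x ≈ a + x * G x)

  polyLt-cong : ∀ d {F G} → (∀ x → F x ≈ G x) → PolyLt d F → PolyLt d G
  polyLt-cong zero    e (Level.lift z) = Level.lift λ x → trans (sym (e x)) (z x)
  polyLt-cong (suc d) e (a , H , p , f) = a , H , p , λ x → trans (sym (e x)) (f x)

  polyLt-+ : ∀ d {F G} → PolyLt d F → PolyLt d G → PolyLt d (λ x → F x + G x)
  polyLt-+ zero    (Level.lift f) (Level.lift g) = Level.lift λ x → trans (+-cong (f x) (g x)) (+-identityˡ 0#)
  polyLt-+ (suc d) (a , F′ , p , f) (b , G′ , q , g) = a + b , _ , polyLt-+ d p q , λ x →
    trans (+-cong (f x) (g x)) (solve 5 (λ a b x f g → a :+ x :* f :+ (b :+ x :* g) := a :+ b :+ x :* (f :+ g))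
                                  refl a b x (F′ x) (G′ x))

  polyLt-scale : ∀ d b {F} → PolyLt d F → PolyLt d (λ x → b * F x)
  polyLt-scale zero    b (Level.lift f) = Level.lift λ x → trans (*-congˡ (f x)) (zeroʳ b)
  polyLt-scale (suc d) b (a , F′ , p , f) = b * a , _ , polyLt-scale d b p , λ x →
    trans (*-congˡ (f x)) (solve 4 (λ b a x f → b :* (a :+ x :* f) := b :* a :+ x :* (b :* f)) refl b a x (F′ x))

  polyLt-neg : ∀ d {F} → PolyLt d F → PolyLt d (λ x → - F x)
  polyLt-neg d p = polyLt-cong d (λ x → -1*x≈-x _) (polyLt-scale d (- 1#) p)

  polyLt-0 : ∀ d → PolyLt d (λ _ → 0#)
  polyLt-0 zero    = Level.lift λ _ → refl
  polyLt-0 (suc d) = 0# , _ , polyLt-0 d , λ x → sym (trans (+-identityˡ _) (zeroʳ x))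

  polyLt-x* : ∀ d {F} → PolyLt d F → PolyLt (suc d) (λ x → x * F x)
  polyLt-x* d p = 0# , _ , p , λ x → sym (+-identityˡ _)

  polyLt-const : ∀ d a → PolyLt (suc d) (λ _ → a)
  polyLt-const d a = a , _ , polyLt-0 d , λ x → sym (trans (+-congˡ (zeroʳ x)) (+-identityʳ a))

  polyLt-suc : ∀ d {F} → PolyLt d F → PolyLt (suc d) F
  polyLt-suc zero    (Level.lift f) = polyLt-cong 1 (λ x → sym (f x)) (polyLt-0 1)
  polyLt-suc (suc d) (a , F′ , p , f) = a , F′ , polyLt-suc d p , f

  polyLt-≤ : ∀ {d e} → d ℕ.≤′ e → ∀ {F} → PolyLt d F → PolyLt e F
  polyLt-≤ (ℕ.≤′-reflexive ≡.refl) p = p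
  polyLt-≤ (ℕ.≤′-step d≤e) p = polyLt-suc _ (polyLt-≤ d≤e p)

  -- Degree at most d times degree less than e: the asymmetric bounds keep the estimate exact even
  -- for e = 0, the zero polynomial.
  polyLt-* : ∀ d e {F G} → PolyLt (suc d) F → PolyLt e G → PolyLt (d ℕ.+ e) (λ x → F x * G x)
  polyLt-* zero    e {F} {G} (a , F′ , Level.lift z , f) q = polyLt-cong e
    (λ x → *-congʳ (sym (trans (f x) (trans (+-congˡ (trans (*-congˡ (z x)) (zeroʳ x))) (+-identityʳ a)))))
    (polyLt-scale e a q)
  polyLt-* (suc d) e {F} {G} (a , F′ , p , f) q = polyLt-cong (suc d ℕ.+ e)
    (λ x → trans (solve 4 (λ a x f g → a :* g :+ x :* (f :* g) := (a :+ x :* f) :* g) refl a x (F′ x) (G x))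
                 (*-congʳ (sym (f x))))
    (polyLt-+ (suc d ℕ.+ e) (polyLt-≤ (ℕ.≤⇒≤′ (ℕ.m≤n+m e (suc d))) (polyLt-scale e a q))
                            (polyLt-x* (d ℕ.+ e) (polyLt-* d e p q)))

  polyLt-sum : ∀ d {n} {F : Fin n → Carrier → Carrier} → (∀ j → PolyLt d (F j)) →
               PolyLt d (λ x → sum λ j → F j x)
  polyLt-sum d {zero}  p = polyLt-0 d
  polyLt-sum d {suc n} p = polyLt-+ d (p zero) (polyLt-sum d (p ∘ suc))

  polyLt-pow : ∀ d → PolyLt (suc d) (λ x → x ^ d)
  polyLt-pow zero    = polyLt-const 0 1#
  polyLt-pow (suc d) = polyLt-x* (suc d) (polyLt-pow d)

  polyLt-top : ∀ d {F} → PolyLt (suc d) F → ∃₂ λ a G → PolyLt d G × (∀ x → F x ≈ a * x ^ d + G x)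
  polyLt-top zero (a , F′ , Level.lift z , f) = a , (λ _ → 0#) , Level.lift (λ _ → refl) , λ x →
    trans (f x) (+-cong (sym (*-identityʳ a)) (trans (*-congˡ (z x)) (zeroʳ x)))
  polyLt-top (suc d) (a , F′ , p , f) with polyLt-top d p
  ... | b , G , q , g = b , (λ x → a + x * G x) , (a , G , q , λ _ → refl) , λ x →
    trans (f x) (trans (+-congˡ (*-congˡ (g x)))
      (solve 5 (λ a x b t g → a :+ x :* (b :* t :+ g) := b :* (x :* t) :+ (a :+ x :* g)) refl a x b (x ^ d) (G x)))

  polyLt-factor : ∀ d {F} → PolyLt (suc d) F → ∀ a →
                  ∃ λ G → PolyLt d G × (∀ x → F x ≈ F a + (x - a) * G x)
  polyLt-factor zero {F} (b , F′ , Level.lift z , f) a = (λ _ → 0#) , Level.lift (λ _ → refl) , λ x →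
    trans (const x) (trans (sym (const a)) (sym (trans (+-congˡ (zeroʳ _)) (+-identityʳ _))))
    where
    const : ∀ x → F x ≈ b
    const x = trans (f x) (trans (+-congˡ (trans (*-congˡ (z x)) (zeroʳ x))) (+-identityʳ b))
  polyLt-factor (suc d) {F} (b , F′ , p , f) a with polyLt-factor d p a
  ... | G , q , g = (λ x → F′ a + x * G x) , (F′ a , G , q , λ _ → refl) , λ x → begin
    F x                                          ≈⟨ f x ⟩
    b + x * F′ x                                 ≈⟨ +-congˡ (*-congˡ (g x)) ⟩
    b + x * (F′ a + (x - a) * G x)
      ≈⟨ solve 5 (λ b x f a g → b :+ x :* (f :+ (x :- a) :* g) := b :+ a :* f :+ (x :- a) :* (f :+ x :* g))
           refl b x (F′ a) a (G x) ⟩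
    b + a * F′ a + (x - a) * (F′ a + x * G x)    ≈⟨ +-congʳ (f a) ⟨
    F a + (x - a) * (F′ a + x * G x)             ∎

  -- The root `s 0` is split off; at every later point the linear factor is not zero by injectivity,
  -- so the quotient vanishes on the shifted sequence. An infinite sequence of roots avoids counting
  -- them against the degree.
  polyLt-vanish : ∀ d {F} → PolyLt d F → (s : ℕ → Carrier) → (∀ j k → s j ≈ s k → j ≡ k) →
                  (∀ k → F (s k) ≈ 0#) → ∀ x → F x ≈ 0#
  polyLt-vanish zero    (Level.lift z) s inj v = z
  polyLt-vanish (suc d) {F} p s inj v x with polyLt-factor d p (s 0)
  ... | G , q , g = begin
    F x                              ≈⟨ g x ⟩
    F (s 0) + (x - s 0) * G x        ≈⟨ +-cong (v 0) (*-congˡ (G≈0 x)) ⟩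
    0# + (x - s 0) * 0#              ≈⟨ trans (+-identityˡ _) (zeroʳ _) ⟩
    0#                               ∎
    where
    G≈0 : ∀ x → G x ≈ 0#
    G≈0 = polyLt-vanish d q (s ∘ suc) (λ j k e → ℕ.suc-injective (inj _ _ e)) λ k →
      integral (trans (sym (+-identityˡ _)) (trans (+-congʳ (sym (v 0))) (trans (sym (g (s (suc k)))) (v (suc k)))))
               λ e → contradiction (inj (suc k) 0 (x∙y⁻¹≈ε⇒x≈y _ _ e)) λ ()

  ι : ℕ → Carrier
  ι n = n ×ₙ 1#

  -- The value at 0 shows that the constant term of the lower part is zero, so x divides the whole
  -- expression and the degree drops by one.
  leading-zero : ∀ d {a G} → PolyLt d G → (∀ x → a * x ^ d + G x ≈ 0#) → a ≈ 0#
  leading-zero zero {a} (Level.lift z) e =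
    trans (sym (trans (+-cong (*-identityʳ a) (z 0#)) (+-identityʳ a))) (e 0#)
  leading-zero (suc d) {a} {G} (b , H , p , g) e = leading-zero d p
    (polyLt-vanish (suc d) (polyLt-+ (suc d) (polyLt-scale (suc d) a (polyLt-pow d)) (polyLt-suc d p))
      -- The factor x can be cancelled at the points 1, 2, ...; these are enough to conclude that
      -- the quotient vanishes everywhere, 0 included.
      (ι ∘ suc) (λ j k e → ℕ.suc-injective (char0 e))
      λ k → integral (trans (rest (ι (suc k)))
          (trans (sym (+-identityˡ _)) (trans (+-congʳ (sym b≈0)) (e′ (ι (suc k))))))
        λ z → contradiction (char0 {suc k} {0} z) λ ())
    where
    e′ : ∀ x → b + (a * (x * x ^ d) + x * H x) ≈ 0#
    e′ x = trans (solve 3 (λ b y z → b :+ (y :+ z) := y :+ (b :+ z)) refl b _ _)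
                 (trans (+-congˡ (sym (g x))) (e x))
    rest : ∀ x → x * (a * x ^ d + H x) ≈ a * (x * x ^ d) + x * H x
    rest x = solve 4 (λ x a t h → x :* (a :* t :+ h) := a :* (x :* t) :+ x :* h) refl x a (x ^ d) (H x)
    b≈0 : b ≈ 0#
    b≈0 = trans (solve 4 (λ b a t h → b := b :+ (a :* (con (+ 0) :* t) :+ con (+ 0) :* h))
                   refl b a (0# ^ d) (H 0#)) (e′ 0#)

  Monic : ℕ → (Carrier → Carrier) → Set (c ⊔ ℓ)
  Monic n F = ∃ λ G → PolyLt n G × (∀ x → F x ≈ x ^ n + G x)

  monic-polyLt : ∀ {n F} → Monic n F → PolyLt (suc n) F
  monic-polyLt {n} (G , p , f) =
    polyLt-cong (suc n) (λ x → sym (f x)) (polyLt-+ (suc n) (polyLt-pow n) (polyLt-suc n p))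

  1≉0 : ¬ 1# ≈ 0#
  1≉0 e = contradiction (char0 {1} {0} (trans (+-identityʳ 1#) e)) λ ()

  monic-≮ : ∀ {m n F} → Monic m F → Monic n F → ¬ m ℕ.< n
  monic-≮ {m} {n} {F} M (G , p , f) m<n = 1≉0 (leading-zero n
    (polyLt-+ n p (polyLt-neg n (polyLt-≤ (ℕ.≤⇒≤′ m<n) (monic-polyLt M))))
    λ x → begin
      1# * x ^ n + (G x + - F x)          ≈⟨ solve 3 (λ t g f → con (+ 1) :* t :+ (g :+ :- f) := t :+ g :+ :- f) refl (x ^ n) (G x) (F x) ⟩
      x ^ n + G x + - F x                 ≈⟨ +-congʳ (f x) ⟨
      F x + - F x                         ≈⟨ -‿inverseʳ (F x) ⟩
      0# ∎)

  monic-degree : ∀ {m n F} → Monic m F → Monic n F → m ≡ n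
  monic-degree {m} {n} M N with ℕ.<-cmp m n
  ... | tri< m<n _ _ = contradiction m<n (monic-≮ M N)
  ... | tri≈ _ m≡n _ = m≡n
  ... | tri> _ _ n<m = contradiction n<m (monic-≮ N M)

  -- Pointwise cancellation fails at the roots of F, and these cannot be told apart from other
  -- points. Instead the top coefficient of G is the coefficient of degree n + d in the product,
  -- hence zero, and the degree bound on G decreases.
  monic-cancel : ∀ {n F} → Monic n F → ∀ d {G} → PolyLt d G → (∀ x → F x * G x ≈ 0#) → ∀ x → G x ≈ 0#
  monic-cancel M zero (Level.lift z) e = z
  monic-cancel {n} {F} M@(P , p , f) (suc d) {G} q e with polyLt-top d q
  ... | a , H , r , g = monic-cancel M d (polyLt-cong d G≈H r) e
    where
    expand : ∀ x → a * x ^ (n ℕ.+ d) + (x ^ n * H x + G x * P x) ≈ 0#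
    expand x = begin
      a * x ^ (n ℕ.+ d) + (x ^ n * H x + G x * P x)
        ≈⟨ +-congʳ (*-congˡ (^-homo-* x n d)) ⟩
      a * (x ^ n * x ^ d) + (x ^ n * H x + G x * P x)
        ≈⟨ solve 6 (λ a s t h g p → a :* (s :* t) :+ (s :* h :+ g :* p) := s :* (a :* t :+ h) :+ p :* g)
             refl a (x ^ n) (x ^ d) (H x) (G x) (P x) ⟩
      x ^ n * (a * x ^ d + H x) + P x * G x    ≈⟨ +-congʳ (*-congˡ (g x)) ⟨
      x ^ n * G x + P x * G x                  ≈⟨ distribʳ _ _ _ ⟨
      (x ^ n + P x) * G x                      ≈⟨ *-congʳ (f x) ⟨
      F x * G x                                ≈⟨ e x ⟩
      0# ∎
    a≈0 : a ≈ 0#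
    a≈0 = leading-zero (n ℕ.+ d) (polyLt-+ (n ℕ.+ d) (polyLt-* n d (polyLt-pow n) r)
            (≡.subst (λ k → PolyLt k (λ x → G x * P x)) (ℕ.+-comm d n) (polyLt-* d n q p))) expand
    G≈H : ∀ x → H x ≈ G x
    G≈H x = sym (trans (g x) (trans (+-congʳ (trans (*-congʳ a≈0) (zeroˡ _))) (+-identityˡ _)))

  -- F is x^n - t x^(n-1) + ..., multiplied by x so that n = 0 needs no special treatment.
  TopCoefficients : ℕ → Carrier → (Carrier → Carrier) → Set (c ⊔ ℓ)
  TopCoefficients n t F = ∃ λ G → PolyLt n G × (∀ x → x * F x ≈ x ^ suc n + (- t * x ^ n + G x))

  top-monic : ∀ {n t F} → TopCoefficients n t F → Monic (suc n) (λ x → x * F x)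
  top-monic {n} {t} (G , p , f) = (λ x → - t * x ^ n + G x) ,
    polyLt-+ (suc n) (polyLt-scale (suc n) (- t) (polyLt-pow n)) (polyLt-suc n p) , f

  top-cong : ∀ {n t F G} → (∀ x → F x ≈ G x) → TopCoefficients n t F → TopCoefficients n t G
  top-cong e (H , p , f) = H , p , λ x → trans (*-congˡ (sym (e x))) (f x)

  top-unique : ∀ {n t u F} → TopCoefficients n t F → TopCoefficients n u F → t ≈ u
  top-unique {n} {t} {u} {F} (G , p , f) (H , q , h) = sym (x∙y⁻¹≈ε⇒x≈y _ _
    (leading-zero n (polyLt-+ n p (polyLt-neg n q)) λ x → begin
      (u - t) * x ^ n + (G x + - H x)
        ≈⟨ solve 6 (λ u t y z g h → (u :- t) :* y :+ (g :+ :- h)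
             := (z :+ (:- t :* y :+ g)) :- (z :+ (:- u :* y :+ h))) refl u t (x ^ n) (x ^ suc n) (G x) (H x) ⟩
      (x ^ suc n + (- t * x ^ n + G x)) - (x ^ suc n + (- u * x ^ n + H x))
        ≈⟨ +-cong (f x) (-‿cong (h x)) ⟨
      x * F x - x * F x    ≈⟨ -‿inverseʳ _ ⟩
      0# ∎))

  top-1 : TopCoefficients 0 0# (λ _ → 1#)
  top-1 = (λ _ → 0#) , Level.lift (λ _ → refl) , λ x →
    solve 1 (λ x → x :* con (+ 1) := x :* con (+ 1) :+ (:- con (+ 0) :* con (+ 1) :+ con (+ 0))) refl x

  top-linear* : ∀ {n t F} a → TopCoefficients n t F → TopCoefficients (suc n) (a + t) (λ x → (x - a) * F x)
  top-linear* {n} {t} {F} a (G , p , f) =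
    (λ x → a * t * x ^ n + (x * G x + - a * G x)) ,
    polyLt-+ (suc n) (polyLt-scale (suc n) (a * t) (polyLt-pow n))
      (polyLt-+ (suc n) (polyLt-x* n p) (polyLt-suc n (polyLt-scale n (- a) p))) ,
    λ x → begin
      x * ((x - a) * F x)      ≈⟨ solve 3 (λ x a f → x :* ((x :- a) :* f) := (x :- a) :* (x :* f)) refl x a (F x) ⟩
      (x - a) * (x * F x)      ≈⟨ *-congˡ (f x) ⟩
      (x - a) * (x * x ^ n + (- t * x ^ n + G x))
        ≈⟨ solve 5 (λ x a t y g → (x :- a) :* (x :* y :+ (:- t :* y :+ g))
             := x :* (x :* y) :+ (:- (a :+ t) :* (x :* y) :+ (a :* t :* y :+ (x :* g :+ :- a :* g))))
             refl x a t (x ^ n) (G x) ⟩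
      x ^ suc (suc n) + (- (a + t) * x ^ suc n + (a * t * x ^ n + (x * G x + - a * G x))) ∎

  top-+ : ∀ {n t F} {E : Carrier → Carrier} → TopCoefficients n t F → PolyLt n (λ x → x * E x) → TopCoefficients n t (λ x → F x + E x)
  top-+ {n} {F = F} {E} (G , p , f) q = _ , polyLt-+ n p q , λ x →
    trans (distribˡ x (F x) (E x)) (trans (+-congʳ (f x)) (trans (+-assoc _ _ _) (+-congˡ (+-assoc _ _ _))))

  IsPolynomial : (Carrier → Carrier) → Set (c ⊔ ℓ)
  IsPolynomial F = ∃ λ d → PolyLt d F

  polynomial-* : ∀ {F G} → IsPolynomial F → IsPolynomial G → IsPolynomial (λ x → F x * G x)
  polynomial-* (d , p) (e , q) = d ℕ.+ e , polyLt-* d e (polyLt-suc d p) q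

  polynomial-minus : ∀ {F G} → IsPolynomial F → IsPolynomial G → IsPolynomial (λ x → F x - G x)
  polynomial-minus (d , p) (e , q) = d ℕ.⊔ e ,
    polyLt-+ (d ℕ.⊔ e) (polyLt-≤ (ℕ.≤⇒≤′ (ℕ.m≤m⊔n d e)) p)
                       (polyLt-neg (d ℕ.⊔ e) (polyLt-≤ (ℕ.≤⇒≤′ (ℕ.m≤n⊔m d e)) q))

  -- The squares of the natural numbers are already infinitely many distinct points.
  equal-on-squares : ∀ {F G} → IsPolynomial F → IsPolynomial G →
                     (∀ x → F (x * x) ≈ G (x * x)) → ∀ x → F x ≈ G x
  equal-on-squares p q e x = x∙y⁻¹≈ε⇒x≈y _ _
    (polyLt-vanish _ (proj₂ (polynomial-minus p q)) (λ k → ι k * ι k)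
      (λ j k e → square-injective (char0 (trans (×1-homo-* j j) (trans e (sym (×1-homo-* k k))))))
      (λ k → trans (+-congʳ (e (ι k))) (-‿inverseʳ _)) x)
    where
    square-injective : ∀ {j k} → j ℕ.* j ≡ k ℕ.* k → j ≡ k
    square-injective {j} {k} e with ℕ.<-cmp j k
    ... | tri< j<k _ _ = contradiction e (ℕ.<⇒≢ (ℕ.*-mono-< j<k j<k))
    ... | tri≈ _ j≡k _ = j≡k
    ... | tri> _ _ k<j = contradiction (≡.sym e) (ℕ.<⇒≢ (ℕ.*-mono-< k<j k<j))

-- Characteristic polynomials, multisets of roots and traces

module Spectrum {c ℓ} {raw : RawRing c ℓ} (K : IsCharacteristicZeroDomain raw) where

  open IsCharacteristicZeroDomain K using (commutativeRing; integral; stable; char0)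
  open CommutativeRing commutativeRing hiding (zero; refl; trans)
  open LinearAlgebra rawRing
  open IntegerSolver commutativeRing
  open Determinant commutativeRing using (_·_; det-·; det-cong; identity-row; identity-sum; sgn)
  open Polynomials K
  open import Algebra.Properties.Ring ring
  open import Algebra.Properties.Semiring.Sum semiring
  open import Algebra.Properties.Semiring.Exp semiring using (_^_; ^-homo-*)
  open import Relation.Binary.Reasoning.Setoid setoid
  open Data.List.Membership.Setoid setoid using (_∈_)
  open Data.List.Relation.Binary.Permutation.Setoid setoid using (_↭_; refl; prep; swap; trans)

  private
    infixr 2 _⨾_
    _⨾_ : ∀ {x y z} → x ≈ y → y ≈ z → x ≈ z
    _⨾_ = CommutativeRing.trans commutativeRing

    rfl : ∀ {x} → x ≈ x
    rfl = CommutativeRing.refl commutativeRing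

  trace : ∀ {n} → Matrix n → Carrier
  trace M = sum λ i → M i i

  det-degree : ∀ n (P : Fin n → Fin n → Carrier → Carrier) → (∀ i k → PolyLt 2 (P i k)) →
               PolyLt (suc n) (λ x → det λ i k → P i k x)
  det-degree zero    P p = polyLt-const 0 1#
  det-degree (suc n) P p = polyLt-sum (suc (suc n)) λ j → polyLt-scale (suc (suc n)) (sgn j)
    (polyLt-* 1 (suc n) (p zero j) (det-degree n _ λ i k → p (suc i) (punchIn j k)))

  -- A column free of x lowers the degree bound by one. This is applied to the minors of the
  -- off-diagonal terms of a characteristic polynomial.
  det-degree-constantColumn : ∀ n (P : Fin (suc n) → Fin (suc n) → Carrier → Carrier) → (∀ i k → PolyLt 2 (P i k)) →
    (∀ i → PolyLt 1 (P i zero)) → PolyLt (suc n) (λ x → det λ i k → P i k x)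
  det-degree-constantColumn n P p q = polyLt-sum (suc n) λ j → polyLt-scale (suc n) (sgn j) (term n P p q j)
    where
    term : ∀ n (P : Fin (suc n) → Fin (suc n) → Carrier → Carrier) → (∀ i k → PolyLt 2 (P i k)) →
           (∀ i → PolyLt 1 (P i zero)) → ∀ j →
           PolyLt (suc n) (λ x → P zero j x * det (λ i k → P (suc i) (punchIn j k) x))
    term n       P p q zero    = polyLt-* 0 (suc n) (q zero) (det-degree n _ λ i k → p (suc i) (suc k))
    term (suc n) P p q (suc j) = polyLt-* 1 (suc n) (p zero (suc j))
      (det-degree-constantColumn n _ (λ i k → p (suc i) (punchIn (suc j) k)) λ i → q (suc i))

  entry-degree : ∀ {n} (M : Matrix n) i k → PolyLt 2 (λ x → x * identity i k + - M i k)
  entry-degree M i k = polyLt-+ 2 (polyLt-x* 1 (polyLt-const 0 _)) (polyLt-const 1 _)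

  charpoly-polynomial : ∀ {n} (M : Matrix n) → IsPolynomial (charpoly M)
  charpoly-polynomial {n} M = suc n , det-degree n _ (entry-degree M)

  -- In the expansion along the first row, a term with column j > 0 misses two diagonal entries,
  -- those of row 0 and of column j, so it cannot reach the two leading degrees. These come from the
  -- diagonal term alone, where the induction applies.
  charpoly-top : ∀ {n} (M : Matrix n) → TopCoefficients n (trace M) (charpoly M)
  charpoly-top {zero}  M = top-1
  charpoly-top {suc n} M = top-cong
    (λ x → +-congʳ (solve 3 (λ x m d → (x :- m) :* d := con (+ 1) :* ((x :* con (+ 1) :+ :- m) :* d)) rfl
                      x (M zero zero) _))
    (top-+ (top-linear* (M zero zero) (charpoly-top (λ i k → M (suc i) (suc k))))
           (polyLt-x* n (polyLt-sum n λ j → polyLt-scale n (sgn (suc j)) (off-diagonal M j))))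
    where
    off-diagonal : ∀ {n} (M : Matrix (suc n)) j → PolyLt n (λ x → (x * identity zero (suc j) + - M zero (suc j)) *
      det (λ i k → x * identity (suc i) (punchIn (suc j) k) + - M (suc i) (punchIn (suc j) k)))
    off-diagonal {suc n} M j = polyLt-* 0 (suc n) (constant (M zero (suc j)))
      (det-degree-constantColumn n _ (λ i k → entry-degree M (suc i) (punchIn (suc j) k))
                                     λ i → constant (M (suc i) zero))
      where
      constant : ∀ m → PolyLt 1 (λ x → x * 0# + - m)
      constant m = polyLt-cong 1 (λ x → sym (+-congʳ (zeroʳ x) ⨾ +-identityˡ _)) (polyLt-const 0 (- m))

  rootpoly : List Carrier → Carrier → Carrier
  rootpoly L x = List.foldr (λ t p → (x + (- t)) * p) 1# L

  total : List Carrier → Carrier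
  total = List.foldr _+_ 0#

  rootpoly-top : ∀ L → TopCoefficients (length L) (total L) (rootpoly L)
  rootpoly-top []      = top-1
  rootpoly-top (t ∷ L) = top-linear* t (rootpoly-top L)

  rootpoly-polynomial : ∀ L → IsPolynomial (rootpoly L)
  rootpoly-polynomial []      = 1 , polyLt-const 0 1#
  rootpoly-polynomial (t ∷ L) = polynomial-*
    (2 , polyLt-+ 2 (polyLt-cong 2 (λ x → *-identityʳ x) (polyLt-pow 1)) (polyLt-const 1 (- t))) (rootpoly-polynomial L)

  rootpoly-++ : ∀ L D x → rootpoly (L ++ D) x ≈ rootpoly L x * rootpoly D x
  rootpoly-++ []      D x = sym (*-identityˡ _)
  rootpoly-++ (t ∷ L) D x = *-congˡ (rootpoly-++ L D x) ⨾ sym (*-assoc _ _ _)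

  rootpoly-↭ : ∀ {L M} → L ↭ M → ∀ x → rootpoly L x ≈ rootpoly M x
  rootpoly-↭ (refl e) x = go e
    where
    go : ∀ {L M} → Pointwise _≈_ L M → rootpoly L x ≈ rootpoly M x
    go []       = rfl
    go (e ∷ es) = *-cong (+-congˡ (-‿cong e)) (go es)
  rootpoly-↭ (prep e p) x = *-cong (+-congˡ (-‿cong e)) (rootpoly-↭ p x)
  rootpoly-↭ (swap e e′ p) x =
    *-cong (+-congˡ (-‿cong e)) (*-cong (+-congˡ (-‿cong e′)) (rootpoly-↭ p x)) ⨾
    solve 3 (λ a b c → a :* (b :* c) := b :* (a :* c)) rfl _ _ _
  rootpoly-↭ (trans p q) x = rootpoly-↭ p x ⨾ rootpoly-↭ q x

  rootpoly-root : ∀ {θ D} → θ ∈ D → rootpoly D θ ≈ 0#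
  rootpoly-root {θ} (here e)  = *-congʳ (+-congˡ (-‿cong (sym e)) ⨾ -‿inverseʳ θ) ⨾ zeroˡ _
  rootpoly-root (there p) = *-congˡ (rootpoly-root p) ⨾ zeroʳ _

  det-scale : ∀ {n} a (M : Matrix n) → det (λ i k → a * M i k) ≈ a ^ n * det M
  det-scale {zero}  a M = sym (*-identityˡ 1#)
  det-scale {suc n} a M = begin
    (sum λ j → sgn j * (a * M zero j * det (λ i k → a * M (suc i) (punchIn j k))))
      ≈⟨ sum-cong-≋ (λ j → *-congˡ {sgn j} (*-congˡ (det-scale a (λ i k → M (suc i) (punchIn j k)))) ⨾
           solve 5 (λ s a m t d → s :* (a :* m :* (t :* d)) := a :* t :* (s :* (m :* d))) rfl (sgn j) a (M zero j) (a ^ n) _) ⟩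
    (sum λ j → a ^ suc n * (sgn j * (M zero j * det (λ i k → M (suc i) (punchIn j k)))))
      ≈⟨ *-distribˡ-sum (a ^ suc n) (λ j → sgn j * (M zero j * det (λ i k → M (suc i) (punchIn j k)))) ⟨
    a ^ suc n * det M ∎

  det-identity : ∀ n → det (identity {n}) ≈ 1#
  det-identity zero    = rfl
  det-identity (suc n) = +-cong (*-identityˡ _ ⨾ *-identityˡ _ ⨾ det-identity n)
    (sum-cong-≋ (λ j → *-congˡ {sgn (suc j)} (zeroˡ (det (λ i k → identity {suc n} (suc i) (punchIn (suc j) k)))) ⨾ zeroʳ _) ⨾ sum-replicate-zero n) ⨾ +-identityʳ _

  det-plus : ∀ {n} (M : Matrix n) x →
             det (λ i k → x * identity i k + M i k) ≈ (- 1#) ^ n * charpoly M (- x)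
  det-plus M x = det-cong {M = λ i k → x * identity i k + M i k} (λ i k → solve 3 (λ x e m → x :* e :+ m := (:- con (+ 1)) :* (:- x :* e :+ :- m))
                              rfl x (identity i k) (M i k)) ⨾ det-scale (- 1#) (λ i k → - x * identity i k + - M i k)

  -- (xI - M)(xI + M) = x²I - M², and det(xI + M) is the characteristic polynomial at -x up to the
  -- sign (-1)^n.
  charpoly-square : ∀ {n} (M : Matrix n) x →
                    charpoly (M · M) (x * x) ≈ charpoly M x * ((- 1#) ^ n * charpoly M (- x))
  charpoly-square {n} M x = begin
    charpoly (M · M) (x * x)        ≈⟨ det-cong entry ⟨
    det (P · Q)                     ≈⟨ det-· P Q ⟩
    det P * det Q                   ≈⟨ *-congˡ (det-plus M x) ⟩
    charpoly M x * ((- 1#) ^ n * charpoly M (- x)) ∎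
    where
    P Q : Matrix n
    P i k = x * identity i k + - M i k
    Q i k = x * identity i k + M i k
    entry : ∀ i k → (P · Q) i k ≈ x * x * identity i k + - (M · M) i k
    entry i k = begin
      (sum λ j → (x * identity i j + - M i j) * (x * identity j k + M j k))
        ≈⟨ sum-cong-≋ (λ j → solve 5 (λ x e m f m′ → (x :* e :+ :- m) :* (x :* f :+ m′)
             := x :* x :* (e :* f) :+ (x :* (e :* m′) :+ (:- x :* (m :* f) :+ (:- con (+ 1)) :* (m :* m′))))
             rfl x (identity i j) (M i j) (identity j k) (M j k)) ⟩
      (sum λ j → x * x * (identity i j * identity j k) + (x * (identity i j * M j k) +
                 (- x * (M i j * identity j k) + - 1# * (M i j * M j k))))
        ≈⟨ ∑-distrib-+ f₁ (λ j → f₂ j + (f₃ j + f₄ j)) ⨾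
           +-congˡ (∑-distrib-+ f₂ (λ j → f₃ j + f₄ j) ⨾ +-congˡ (∑-distrib-+ f₃ f₄)) ⟩
      (sum λ j → x * x * (identity i j * identity j k)) + ((sum λ j → x * (identity i j * M j k)) +
        ((sum λ j → - x * (M i j * identity j k)) + (sum λ j → - 1# * (M i j * M j k))))
        ≈⟨ +-cong (pull (x * x) (λ j → identity i j * identity j k) (sym (identity-row i (λ j → identity j k))))
          (+-cong (pull x (λ j → identity i j * M j k) (sym (identity-row i (λ j → M j k))))
          (+-cong (pull (- x) (λ j → M i j * identity j k) (sym (identity-sum (M i) k)))
                  (pull (- 1#) (λ j → M i j * M j k) rfl))) ⟩
      x * x * identity i k + (x * M i k + (- x * M i k + - 1# * (M · M) i k))
        ≈⟨ solve 4 (λ x e m q → x :* x :* e :+ (x :* m :+ (:- x :* m :+ (:- con (+ 1)) :* q))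
             := x :* x :* e :+ :- q) rfl x (identity i k) (M i k) ((M · M) i k) ⟩
      x * x * identity i k + - (M · M) i k ∎
      where
      f₁ f₂ f₃ f₄ : Fin n → Carrier
      f₁ j = x * x * (identity i j * identity j k)
      f₂ j = x * (identity i j * M j k)
      f₃ j = - x * (M i j * identity j k)
      f₄ j = - 1# * (M i j * M j k)
      pull : ∀ {n} a (f : Fin n → Carrier) {s} → sum f ≈ s → (sum λ j → a * f j) ≈ a * s
      pull a f e = sym (*-distribˡ-sum a f) ⨾ *-congˡ e

  squares : List Carrier → List Carrier
  squares = List.map (λ t → t * t)

  rootpoly-squares : ∀ D x → rootpoly (squares D) (x * x) ≈ rootpoly D x * ((- 1#) ^ length D * rootpoly D (- x))
  rootpoly-squares []      x = sym (*-identityˡ _ ⨾ *-identityˡ _)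
  rootpoly-squares (t ∷ D) x = *-congˡ (rootpoly-squares D x) ⨾
    solve 5 (λ x t q s q′ → (x :* x :+ :- (t :* t)) :* (q :* (s :* q′))
      := (x :+ :- t) :* q :* ((:- con (+ 1)) :* s :* ((:- x :+ :- t) :* q′)))
      rfl x t (rootpoly D x) ((- 1#) ^ length D) (rootpoly D (- x))

  infix 4 _⊢_∖_
  -- The spectrum of B is the multiset union of D and that of A.
  _⊢_∖_ : ∀ {m n} → List Carrier → Matrix n → Matrix m → Set _
  D ⊢ B ∖ A = ∀ x → charpoly B x ≈ charpoly A x * rootpoly D x

  module _ {m} {A : Matrix m} where

    -- A monic polynomial function determines its degree, so the orders of the matrices are the
    -- lengths of the lists of roots.
    spectrum-size : ∀ {n} {B : Matrix n} {L M D} → IsSpectrum A L → IsSpectrum B M → M ↭ L ++ D →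
                    (n ≡ m ℕ.+ length D) × (D ⊢ B ∖ A)
    spectrum-size {B = B} {L} {M} {D} specA specB p =
      ≡.trans n≡ (≡.trans (List.length-++ L) (≡.cong (ℕ._+ length D) (≡.sym m≡))) , λ x →
      specB x ⨾ rootpoly-↭ p x ⨾ rootpoly-++ L D x ⨾ *-congʳ (sym (specA x))
      where
      degree : ∀ {n} (B : Matrix n) L → (∀ x → charpoly B x ≈ rootpoly L x) → n ≡ length L
      degree B L e = ℕ.suc-injective (monic-degree (top-monic (charpoly-top B))
        (top-monic (top-cong (λ x → sym (e x)) (rootpoly-top L))))
      m≡ = degree A L specA
      n≡ = degree B (L ++ D) λ x → specB x ⨾ rootpoly-↭ p x

    top-++ : ∀ {k t F} D → TopCoefficients k t F → TopCoefficients (length D ℕ.+ k) (total D + t) (λ x → F x * rootpoly D x)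
    top-++ []      p = let (G , q , f) = top-cong (λ x → sym (*-identityʳ _)) p
      in G , q , λ x → f x ⨾ +-congˡ (+-congʳ (*-congʳ (-‿cong (sym (+-identityˡ _)))))
    top-++ (a ∷ D) p = let (G , q , f) = top-cong (λ x → solve 3 (λ a b c → a :* (b :* c) := b :* (a :* c)) rfl _ _ _) (top-linear* a (top-++ D p))
      in G , q , λ x → f x ⨾ +-congˡ (+-congʳ (*-congʳ (-‿cong (sym (+-assoc _ _ _)))))

    spectrum-trace : ∀ {n D} {B : Matrix n} → n ≡ m ℕ.+ length D → D ⊢ B ∖ A → trace B ≈ trace A + total D
    spectrum-trace {D = D} {B} n≡ e = top-unique (charpoly-top B)
      (≡.subst (λ k → TopCoefficients k (trace A + total D) (charpoly B)) (≡.trans (ℕ.+-comm (length D) m) (≡.sym n≡))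
        (let (G , q , f) = top-cong (λ x → sym (e x)) (top-++ D (charpoly-top A)) in
         G , q , λ x → f x ⨾ +-congˡ (+-congʳ (*-congʳ (-‿cong (+-comm _ _))))))

    -- Multiplying the relation at x by the relation at -x gives the relation for the squares at x²;
    -- the signs match because the orders differ by |D|. The conclusion has the form of the
    -- hypothesis, so it can be applied again to reach fourth powers.
    spectrum-squares : ∀ {n D} {B : Matrix n} → n ≡ m ℕ.+ length D → D ⊢ B ∖ A → squares D ⊢ B · B ∖ A · A
    spectrum-squares {n} {D} {B} n≡ e = equal-on-squares (charpoly-polynomial (B · B))
      (polynomial-* (charpoly-polynomial (A · A)) (rootpoly-polynomial (squares D))) λ x → begin
        charpoly (B · B) (x * x)
          ≈⟨ charpoly-square B x ⟩
        charpoly B x * ((- 1#) ^ n * charpoly B (- x))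
          ≡⟨ ≡.cong (λ k → charpoly B x * ((- 1#) ^ k * charpoly B (- x))) n≡ ⟩
        charpoly B x * ((- 1#) ^ (m ℕ.+ length D) * charpoly B (- x))
          ≈⟨ *-cong (e x) (*-cong (^-homo-* (- 1#) m (length D)) (e (- x))) ⟩
        charpoly A x * rootpoly D x * ((- 1#) ^ m * (- 1#) ^ length D * (charpoly A (- x) * rootpoly D (- x)))
          ≈⟨ solve 6 (λ a q s t b r → a :* q :* (s :* t :* (b :* r)) := a :* (s :* b) :* (q :* (t :* r))) rfl
               (charpoly A x) (rootpoly D x) ((- 1#) ^ m) ((- 1#) ^ length D) (charpoly A (- x)) (rootpoly D (- x)) ⟩
        charpoly A x * ((- 1#) ^ m * charpoly A (- x)) * (rootpoly D x * ((- 1#) ^ length D * rootpoly D (- x)))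
          ≈⟨ *-cong (charpoly-square A x) (rootpoly-squares D x) ⟨
        charpoly (A · A) (x * x) * rootpoly (squares D) (x * x) ∎

  -- Conjugation by a diagonal sign matrix negates the matrix; for the adjacency matrix of a
  -- bipartite graph the signs distinguish the two sides.
  SignSymmetric : ∀ {n} → Matrix n → Set _
  SignSymmetric {n} M = ∃ λ (s : Fin n → Carrier) → (∀ i → s i * s i ≈ 1#) × (∀ i k → s i * M i k * s k ≈ - M i k)

  -- For the diagonal sign matrix S, S(xI - M)S = xI + M, while S² = I gives (det S)² = 1.
  signSymmetric-charpoly : ∀ {n} {M : Matrix n} → SignSymmetric M → ∀ x →
                           charpoly M x ≈ (- 1#) ^ n * charpoly M (- x)
  signSymmetric-charpoly {n} {M} (s , s² , e) x = begin
    det P                        ≈⟨ *-identityʳ _ ⟨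
    det P * 1#                   ≈⟨ *-congˡ (sym detS²) ⟩
    det P * (det S * det S)      ≈⟨ solve 2 (λ p s → p :* (s :* s) := s :* p :* s) rfl (det P) (det S) ⟩
    det S * det P * det S        ≈⟨ *-congʳ (det-· S P) ⟨
    det (S · P) * det S          ≈⟨ det-· (S · P) S ⟨
    det (S · P · S)              ≈⟨ det-cong conj ⟩
    det (λ i k → x * identity i k + M i k) ≈⟨ det-plus M x ⟩
    (- 1#) ^ n * charpoly M (- x) ∎
    where
    P S : Matrix n
    P i k = x * identity i k + - M i k
    S i k = s i * identity i k
    S·-entry : ∀ (N : Matrix n) i k → (S · N) i k ≈ s i * N i k
    S·-entry N i k = sum-cong-≋ (λ j → *-assoc (s i) (identity i j) (N j k)) ⨾
      sym (*-distribˡ-sum (s i) (λ j → identity i j * N j k)) ⨾ *-congˡ (sym (identity-row i (λ j → N j k)))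
    sδs : ∀ i k → s i * identity i k * s k ≈ identity i k
    sδs i k with i Fin.≟ k
    ... | yes ≡.refl = *-congʳ (*-identityʳ _) ⨾ s² i
    ... | no _ = *-congʳ (zeroʳ _) ⨾ zeroˡ _
    detS² : det S * det S ≈ 1#
    detS² = sym (det-· S S) ⨾ det-cong (λ i k → S·-entry S i k ⨾ lemma i k) ⨾ det-identity n
      where
      lemma : ∀ i k → s i * (s i * identity i k) ≈ identity i k
      lemma i k = sym (*-assoc _ _ _) ⨾ *-congʳ (s² i) ⨾ *-identityˡ _
    conj : ∀ i k → (S · P · S) i k ≈ x * identity i k + M i k
    conj i k = begin
      (sum λ j → (S · P) i j * (s j * identity j k))
        ≈⟨ sum-cong-≋ (λ j → *-congʳ (S·-entry P i j) ⨾ sym (*-assoc (s i * P i j) (s j) (identity j k))) ⟩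
      (sum λ j → s i * P i j * s j * identity j k)
        ≈⟨ identity-sum (λ j → s i * P i j * s j) k ⟨
      s i * (x * identity i k + - M i k) * s k
        ≈⟨ solve 5 (λ a x e m b → a :* (x :* e :+ :- m) :* b := x :* (a :* e :* b) :+ :- (a :* m :* b)) rfl
             (s i) x (identity i k) (M i k) (s k) ⟩
      x * (s i * identity i k * s k) + - (s i * M i k * s k)
        ≈⟨ +-cong (*-congˡ (sδs i k)) (-‿cong (e i k) ⨾ -‿involutive _) ⟩
      x * identity i k + M i k ∎

  ±1-unit : ∀ n → (- 1#) ^ n * (- 1#) ^ n ≈ 1#
  ±1-unit zero    = *-identityˡ 1#
  ±1-unit (suc n) = solve 1 (λ s → (:- con (+ 1)) :* s :* ((:- con (+ 1)) :* s) := s :* s) rfl ((- 1#) ^ n) ⨾ ±1-unit n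

  module _ {m n D} {A : Matrix m} {B : Matrix n} (n≡ : n ≡ m ℕ.+ length D) (e : D ⊢ B ∖ A)
           (symA : SignSymmetric A) (symB : SignSymmetric B) where

    -- The characteristic polynomials of A and of B both have this symmetry; it passes to their
    -- quotient by cancelling that of A.
    rootpoly-symmetric : ∀ x → rootpoly D x ≈ (- 1#) ^ length D * rootpoly D (- x)
    -- `top-monic` makes x times the characteristic polynomial monic, whence the extra factor x in
    -- `vanish`.
    rootpoly-symmetric x = x∙y⁻¹≈ε⇒x≈y _ _ (monic-cancel (top-monic (charpoly-top A)) _
      (proj₂ (polynomial-minus (rootpoly-polynomial D) (polynomial-* (1 , polyLt-const 0 _) reflected))) vanish x)
      where
      reflected-factor : ∀ D → IsPolynomial (λ x → rootpoly D (- x))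
      reflected-factor []      = 1 , polyLt-const 0 1#
      reflected-factor (t ∷ D) = polynomial-* (2 , polyLt-+ 2
        (polyLt-cong 2 (λ x → solve 1 (λ x → (:- con (+ 1)) :* (x :* con (+ 1)) := :- x) rfl x) (polyLt-scale 2 (- 1#) (polyLt-pow 1)))
        (polyLt-const 1 (- t))) (reflected-factor D)
      reflected = reflected-factor D
      vanish : ∀ x → x * charpoly A x * (rootpoly D x - (- 1#) ^ length D * rootpoly D (- x)) ≈ 0#
      vanish x = begin
        x * charpoly A x * (rootpoly D x - (- 1#) ^ length D * rootpoly D (- x))
          ≈⟨ solve 5 (λ x a q t r → x :* a :* (q :- t :* r) := x :* (a :* q :- a :* (t :* r))) rfl
               x (charpoly A x) (rootpoly D x) ((- 1#) ^ length D) (rootpoly D (- x)) ⟩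
        x * (charpoly A x * rootpoly D x - charpoly A x * ((- 1#) ^ length D * rootpoly D (- x)))
          ≈⟨ *-congˡ (+-congʳ equal ⨾ -‿inverseʳ _) ⨾ zeroʳ x ⟩
        0# ∎
        where
        equal : charpoly A x * rootpoly D x ≈ charpoly A x * ((- 1#) ^ length D * rootpoly D (- x))
        equal = begin
          charpoly A x * rootpoly D x       ≈⟨ e x ⟨
          charpoly B x                      ≈⟨ signSymmetric-charpoly symB x ⟩
          (- 1#) ^ n * charpoly B (- x)
            ≡⟨ ≡.cong (λ k → (- 1#) ^ k * charpoly B (- x)) n≡ ⟩
          (- 1#) ^ (m ℕ.+ length D) * charpoly B (- x)
            ≈⟨ *-cong (^-homo-* (- 1#) m (length D)) (e (- x)) ⟩
          (- 1#) ^ m * (- 1#) ^ length D * (charpoly A (- x) * rootpoly D (- x))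
            ≈⟨ solve 4 (λ s t b r → s :* t :* (b :* r) := s :* b :* (t :* r)) rfl
                 ((- 1#) ^ m) ((- 1#) ^ length D) (charpoly A (- x)) (rootpoly D (- x)) ⟩
          (- 1#) ^ m * charpoly A (- x) * ((- 1#) ^ length D * rootpoly D (- x))
            ≈⟨ *-congʳ (signSymmetric-charpoly symA x) ⟨
          charpoly A x * ((- 1#) ^ length D * rootpoly D (- x)) ∎

    opposite-root : ∀ {θ} → θ ∈ D → rootpoly D (- θ) ≈ 0#
    opposite-root {θ} θ∈D = begin
      rootpoly D (- θ)                        ≈⟨ *-identityˡ _ ⟨
      1# * rootpoly D (- θ)                   ≈⟨ *-congʳ (±1-unit (length D)) ⟨
      s * s * rootpoly D (- θ)                ≈⟨ *-assoc _ _ _ ⟩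
      s * (s * rootpoly D (- θ))              ≈⟨ *-congˡ (rootpoly-symmetric θ) ⟨
      s * rootpoly D θ                        ≈⟨ *-congˡ (rootpoly-root θ∈D) ⟩
      s * 0#                                  ≈⟨ zeroʳ s ⟩
      0# ∎
      where s = (- 1#) ^ length D

    module _ {θ τ} (θ≉τ : ¬ θ ≈ τ) (θ∈D : θ ∈ D) (τ∈D : τ ∈ D) (all : All (λ t → t ≈ θ ⊎ t ≈ τ) D) where

      rootpoly-nonzero : ∀ {x} D → All (λ t → t ≈ θ ⊎ t ≈ τ) D → ¬ x - θ ≈ 0# → ¬ x - τ ≈ 0# → ¬ rootpoly D x ≈ 0#
      rootpoly-nonzero []      []       _ _ z = 1≉0 z
      rootpoly-nonzero (t ∷ D) (inj₁ t≈θ ∷ a) p q z = rootpoly-nonzero D a p q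
        (integral z λ w → p (+-congˡ (-‿cong (sym t≈θ)) ⨾ w))
      rootpoly-nonzero (t ∷ D) (inj₂ t≈τ ∷ a) p q z = rootpoly-nonzero D a p q
        (integral z λ w → q (+-congˡ (-‿cong (sym t≈τ)) ⨾ w))

      -- If -θ is not τ, then the root -θ can only be θ itself, so θ = 0. Likewise -τ is neither θ
      -- nor anything but τ, so τ = 0, against θ ≉ τ. Each "can only be" is a double negation,
      -- harmless because the goal is absurd.
      opposite : - θ ≈ τ
      opposite = stable λ -θ≉τ →
        let θ-zero : ¬ ¬ - θ - θ ≈ 0#
            θ-zero n = rootpoly-nonzero D all n (λ w → -θ≉τ (x∙y⁻¹≈ε⇒x≈y _ _ w)) (opposite-root θ∈D)
            τ-zero : ¬ ¬ - τ - τ ≈ 0#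
            τ-zero n = rootpoly-nonzero D all
              (λ w → -θ≉τ (sym (solve 2 (λ θ τ → τ := (:- θ) :- (:- τ :- θ)) rfl θ τ ⨾ +-congˡ (-‿cong w ⨾ -0#≈0#) ⨾ +-identityʳ _)))
              n (opposite-root τ∈D)
        in θ-zero λ u → τ-zero λ w → θ≉τ (halve u ⨾ sym (halve w))
        where
        halve : ∀ {x} → - x - x ≈ 0# → x ≈ 0#
        halve {x} u = integral {ι 2}
          (solve 1 (λ x → (con (+ 1) :+ (con (+ 1) :+ con (+ 0))) :* x := :- (:- x :- x)) rfl x ⨾ -‿cong u ⨾ -0#≈0#)
          λ w → contradiction (char0 {2} {0} w) λ ()

      total-constant : ∀ {a} D → All (_≈ a) D → total D ≈ ι (length D) * a
      total-constant []      []      = sym (zeroˡ _)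
      total-constant (t ∷ D) (e ∷ a) = +-cong e (total-constant D a) ⨾ sym (distribʳ _ _ _ ⨾ +-congʳ (*-identityˡ _))

      private
        all² : All (_≈ θ * θ) (squares D)
        all² = go all
          where
          go : ∀ {D} → All (λ t → t ≈ θ ⊎ t ≈ τ) D → All (_≈ θ * θ) (squares D)
          go []             = []
          go (inj₁ e ∷ a) = *-cong e e ∷ go a
          go (inj₂ e ∷ a) = (*-cong e′ e′ ⨾ solve 1 (λ x → (:- x) :* (:- x) := x :* x) rfl θ) ∷ go a
            where e′ = e ⨾ sym opposite
        all-squares : ∀ {a D} → All (_≈ a) D → All (_≈ a * a) (squares D)
        all-squares []      = []
        all-squares (e ∷ a) = *-cong e e ∷ all-squares a
        n≡² : n ≡ m ℕ.+ length (squares D)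
        n≡² = ≡.trans n≡ (≡.cong (m ℕ.+_) (≡.sym (List.length-map _ D)))
        n≡⁴ : n ≡ m ℕ.+ length (squares (squares D))
        n≡⁴ = ≡.trans n≡² (≡.cong (m ℕ.+_) (≡.sym (List.length-map _ (squares D))))
        e² = spectrum-squares {A = A} {D = D} {B} n≡ e
        e⁴ = spectrum-squares {A = A · A} {D = squares D} {B · B} n≡² e²

      trace² : trace (B · B) ≈ trace (A · A) + ι (length D) * (θ * θ)
      trace² = spectrum-trace {A = A · A} {D = squares D} {B · B} n≡² e² ⨾ +-congˡ (total-constant (squares D) all² ⨾
        reflexive (≡.cong (λ k → ι k * (θ * θ)) (List.length-map _ D)))

      trace⁴ : trace (B · B · (B · B)) ≈ trace (A · A · (A · A)) + ι (length D) * (θ * θ * (θ * θ))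
      trace⁴ = spectrum-trace {A = A · A · (A · A)} {D = squares (squares D)} {B · B · (B · B)} n≡⁴ e⁴ ⨾ +-congˡ (total-constant (squares (squares D)) (all-squares all²) ⨾
        reflexive (≡.cong (λ k → ι k * (θ * θ * (θ * θ))) (≡.trans (List.length-map _ (squares D)) (List.length-map _ D))))

-- Closed walk counts and the trace identity in ℕ

private
  module ℕ-Sum = Algebra.Properties.Semiring.Sum ℕ.+-*-semiring

bit : Bool → ℕ
bit b = if b then 1 else 0

walks : ∀ {n} → (Fin n → Fin n → Bool) → Fin n → Fin n → ℕ
walks b i k = ℕ-Sum.sum λ j → bit (b i j) ℕ.* bit (b j k)

-- The traces of A² and of A²A² for a 0-1 matrix A; bracketing the fourth power in this way
-- expresses it by numbers of two-step walks, that is, of common neighbours.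
closedWalks₂ closedWalks₄ : ∀ {n} → (Fin n → Fin n → Bool) → ℕ
closedWalks₂ b = ℕ-Sum.sum λ i → walks b i i
closedWalks₄ b = ℕ-Sum.sum λ i → ℕ-Sum.sum λ k → walks b i k ℕ.* walks b k i

module TwoEigenvalues {c ℓ} {raw : RawRing c ℓ} (K : IsCharacteristicZeroDomain raw) where

  open IsCharacteristicZeroDomain K using (commutativeRing; char0)
  open CommutativeRing commutativeRing hiding (zero; 0#; 1#)
  open RawRing raw using (0#; 1#)
  -- Not the raw ring projected from commutativeRing: identifying the two at ℝ unfolds the Cauchy moduli.
  open LinearAlgebra raw
  open IntegerSolver commutativeRing
  open Determinant commutativeRing using (_·_)
  open Polynomials K using (ι)
  open Spectrum K
  open import Algebra.Properties.Ring ring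
  open import Algebra.Properties.Semiring.Sum semiring
  open import Algebra.Properties.Semiring.Mult semiring using (×-homo-+; ×1-homo-*)
  open import Relation.Binary.Reasoning.Setoid setoid
  open Data.List.Membership.Setoid setoid using (_∈_)
  open Data.List.Relation.Binary.Permutation.Setoid setoid using (_↭_)

  booleanMatrix : ∀ {n} → (Fin n → Fin n → Bool) → Matrix n
  booleanMatrix b i j = if b i j then 1# else 0#

  ι-+ : ∀ m n → ι (m ℕ.+ n) ≈ ι m + ι n
  ι-+ = ×-homo-+ 1#

  ι-* : ∀ m n → ι (m ℕ.* n) ≈ ι m * ι n
  ι-* = ×1-homo-*

  ι-sum : ∀ {n} (f : Fin n → ℕ) → ι (ℕ-Sum.sum f) ≈ sum (ι ∘ f)
  ι-sum {zero}  f = refl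
  ι-sum {suc n} f = trans (ι-+ (f zero) _) (+-congˡ (ι-sum (f ∘ suc)))

  ι-bit : ∀ b → ι (bit b) ≈ (if b then 1# else 0#)
  ι-bit true  = +-identityʳ 1#
  ι-bit false = refl

  ι-walks : ∀ {n} (b : Fin n → Fin n → Bool) i k → ι (walks b i k) ≈ (booleanMatrix b · booleanMatrix b) i k
  ι-walks b i k = trans (ι-sum λ j → bit (b i j) ℕ.* bit (b j k)) (sum-cong-≋ λ j →
    trans (ι-* (bit (b i j)) (bit (b j k))) (*-cong (ι-bit (b i j)) (ι-bit (b j k))))

  ι-closedWalks₂ : ∀ {n} (b : Fin n → Fin n → Bool) → let A = booleanMatrix b in ι (closedWalks₂ b) ≈ trace (A · A)
  ι-closedWalks₂ b = trans (ι-sum λ i → walks b i i) (sum-cong-≋ λ i → ι-walks b i i)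

  ι-closedWalks₄ : ∀ {n} (b : Fin n → Fin n → Bool) → let A = booleanMatrix b in
                   ι (closedWalks₄ b) ≈ trace (A · A · (A · A))
  ι-closedWalks₄ b = trans (ι-sum λ i → ℕ-Sum.sum λ k → walks b i k ℕ.* walks b k i) (sum-cong-≋ λ i →
    trans (ι-sum λ k → walks b i k ℕ.* walks b k i) (sum-cong-≋ λ k →
      trans (ι-* (walks b i k) (walks b k i)) (*-cong (ι-walks b i k) (ι-walks b k i))))

  signSymmetric : ∀ {n} (b : Fin n → Fin n → Bool) (side : Fin n → Bool) →
                  (∀ i j → b i j ≡ true → side i ≢ side j) → SignSymmetric (booleanMatrix b)
  signSymmetric b side opposite = (λ i → sign (side i)) , (λ i → sign² (side i)) , entry
    where
    sign : Bool → Carrier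
    sign true  = 1#
    sign false = - 1#
    sign² : ∀ s → sign s * sign s ≈ 1#
    sign² true  = *-identityˡ 1#
    sign² false = solve 0 ((:- con (+ 1)) :* (:- con (+ 1)) := con (+ 1)) refl
    sign-opposite : ∀ s t → s ≢ t → sign s * 1# * sign t ≈ - 1#
    sign-opposite true  true  s≢t = contradiction ≡.refl s≢t
    sign-opposite true  false s≢t = solve 0 (con (+ 1) :* con (+ 1) :* (:- con (+ 1)) := :- con (+ 1)) refl
    sign-opposite false true  s≢t = solve 0 ((:- con (+ 1)) :* con (+ 1) :* con (+ 1) := :- con (+ 1)) refl
    sign-opposite false false s≢t = contradiction ≡.refl s≢t
    entry : ∀ i k → sign (side i) * booleanMatrix b i k * sign (side k) ≈ - booleanMatrix b i k
    entry i k with b i k in eq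
    ... | true  = sign-opposite (side i) (side k) (opposite i k eq)
    ... | false = solve 2 (λ s t → s :* con (+ 0) :* t := :- con (+ 0)) refl (sign (side i)) (sign (side k))

  module TwoEigenvalueExtension {p q} (b : Fin p → Fin p → Bool) (b′ : Fin q → Fin q → Bool)
           (side : Fin p → Bool) (side′ : Fin q → Bool)
           (opposite : ∀ i j → b i j ≡ true → side i ≢ side j)
           (opposite′ : ∀ i j → b′ i j ≡ true → side′ i ≢ side′ j)
           {A₀ B₀} (A≡ : A₀ ≡ booleanMatrix b) (B≡ : B₀ ≡ booleanMatrix b′)
           {L M D} (spec : IsSpectrum A₀ L) (spec′ : IsSpectrum B₀ M) (M↭L++D : M ↭ L ++ D)
           {θ τ} (θ≉τ : ¬ θ ≈ τ) (θ∈D : θ ∈ D) (τ∈D : τ ∈ D) (all : All (λ t → t ≈ θ ⊎ t ≈ τ) D) where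

    private
      A = booleanMatrix b
      B = booleanMatrix b′
      k = length D
      size = spectrum-size {A = A} {B = B} {L} {M} {D} (≡.subst (λ A → IsSpectrum A L) A≡ spec) (≡.subst (λ B → IsSpectrum B M) B≡ spec′) M↭L++D
      symA = signSymmetric b side opposite
      symB = signSymmetric b′ side′ opposite′

    order-difference : q ≡ p ℕ.+ length D
    order-difference = proj₁ size

    length-positive : 1 ℕ.≤ length D
    length-positive = go θ∈D
      where
      go : ∀ {D} → θ ∈ D → 1 ℕ.≤ length D
      go (here _)  = ℕ.s≤s ℕ.z≤n
      go (there _) = ℕ.s≤s ℕ.z≤n

    -- The second-order trace gives e = |D| θ², so multiplying the fourth-order trace by |D| turns
    -- |D|² θ⁴ into e² and eliminates θ. What remains is an equation between naturals.
    closedWalks-identity : ∀ e → closedWalks₂ b′ ≡ closedWalks₂ b ℕ.+ e →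
      length D ℕ.* closedWalks₄ b′ ≡ length D ℕ.* closedWalks₄ b ℕ.+ e ℕ.* e
    closedWalks-identity e eq = char0 (begin
      ι (k ℕ.* closedWalks₄ b′)                  ≈⟨ ι-* k (closedWalks₄ b′) ⟩
      ι k * ι (closedWalks₄ b′)                  ≈⟨ *-congˡ (trans (ι-closedWalks₄ b′)
                                                      (trace⁴ (proj₁ size) (proj₂ size) symA symB θ≉τ θ∈D τ∈D all)) ⟩
      ι k * (trace (A · A · (A · A)) + ι k * (θ * θ * (θ * θ)))
        ≈⟨ solve 3 (λ k t c → k :* (t :+ k :* (c :* c)) := k :* t :+ k :* c :* (k :* c)) refl (ι k) _ (θ * θ) ⟩
      ι k * trace (A · A · (A · A)) + ι k * (θ * θ) * (ι k * (θ * θ))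
        ≈⟨ +-cong (*-congˡ (ι-closedWalks₄ b)) (*-cong e≈ e≈) ⟨
      ι k * ι (closedWalks₄ b) + ι e * ι e       ≈⟨ +-cong (ι-* k (closedWalks₄ b)) (ι-* e e) ⟨
      ι (k ℕ.* closedWalks₄ b) + ι (e ℕ.* e)     ≈⟨ ι-+ (k ℕ.* closedWalks₄ b) (e ℕ.* e) ⟨
      ι (k ℕ.* closedWalks₄ b ℕ.+ e ℕ.* e)       ∎)
      where
      e≈ : ι e ≈ ι k * (θ * θ)
      e≈ = +-cancelˡ (trace (A · A)) _ _ (begin
        trace (A · A) + ι e                      ≈⟨ +-congʳ (ι-closedWalks₂ b) ⟨
        ι (closedWalks₂ b) + ι e                 ≈⟨ ι-+ (closedWalks₂ b) e ⟨
        ι (closedWalks₂ b ℕ.+ e)                 ≡⟨ ≡.cong ι eq ⟨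
        ι (closedWalks₂ b′)                      ≈⟨ ι-closedWalks₂ b′ ⟩
        trace (B · B)                            ≈⟨ trace² (proj₁ size) (proj₂ size) symA symB θ≉τ θ∈D τ∈D all ⟩
        trace (A · A) + ι k * (θ * θ) ∎)

open import Defs
open import Data.Nat.Base using (_+_; _*_; _≤_; z≤n; s≤s; _∸_; ∣_-_∣)
open ≡ using (refl; sym; trans; cong; cong₂; subst; subst₂)
open ℝ

-- The reals form a domain of characteristic zero

abstract

  scaled-< : ∀ {ε B} → 0ℚ ℚ.< ε → 0ℚ ℚ.< B → ∃ λ δ → 0ℚ ℚ.< δ × B ℚ.* δ ≡ ε
  scaled-< {ε} {B} 0<ε 0<B = ε ℚ.* 1/B ,
    subst (ℚ._< ε ℚ.* 1/B) (ℚ.*-zeroˡ 1/B) (ℚ.*-monoˡ-<-pos 1/B {{ℚ.1/pos⇒pos B {{ℚ.positive 0<B}}}} 0<ε) ,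
    ≡.trans (solve 3 (λ b e i → b :* (e :* i) := e :* (b :* i)) ≡.refl B ε 1/B)
      (≡.trans (cong (ε ℚ.*_) (ℚ.*-inverseʳ B {{B≢0}})) (ℚ.*-identityʳ ε))
    where
    open ℚ-Solver.+-*-Solver
    B≢0 : ℚ.NonZero B
    B≢0 = ℚ.pos⇒nonZero B {{ℚ.positive 0<B}}
    1/B : ℚ
    1/B = ℚ.1/_ B {{B≢0}}

  halve : ∀ {ε} → 0ℚ ℚ.< ε → ∃ λ δ → 0ℚ ℚ.< δ × δ ℚ.+ δ ≡ ε
  halve {ε} 0<ε = ε ℚ.* ℚ.½ ,
    subst (ℚ._< ε ℚ.* ℚ.½) (ℚ.*-zeroˡ ℚ.½) (ℚ.*-monoˡ-<-pos ℚ.½ 0<ε) ,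
    ≡.trans (≡.sym (ℚ.*-distribˡ-+ ε ℚ.½ ℚ.½)) (ℚ.*-identityʳ ε)

  bounded : ∀ x → ∃₂ λ N B → 0ℚ ℚ.< B × (∀ n → N ℕ.≤ n → ℚ.∣ seq x n ∣ ℚ.≤ B)
  bounded x with cauchy x 1ℚ (ℚ.positive⁻¹ 1ℚ)
  ... | N , p = N , 1ℚ ℚ.+ ℚ.∣ seq x N ∣ , ℚ.+-mono-<-≤ (ℚ.positive⁻¹ 1ℚ) (ℚ.0≤∣p∣ (seq x N)) , λ n le → begin
      ℚ.∣ seq x n ∣
        ≡⟨ cong ℚ.∣_∣ (solve 2 (λ a b → a := (a :- b) :+ b) ≡.refl (seq x n) (seq x N)) ⟩
      ℚ.∣ (seq x n ℚ.- seq x N) ℚ.+ seq x N ∣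
        ≤⟨ ℚ.∣p+q∣≤∣p∣+∣q∣ (seq x n ℚ.- seq x N) (seq x N) ⟩
      ℚ.∣ seq x n ℚ.- seq x N ∣ ℚ.+ ℚ.∣ seq x N ∣
        ≤⟨ ℚ.+-monoˡ-≤ ℚ.∣ seq x N ∣ (ℚ.<⇒≤ (p n N le ℕ.≤-refl)) ⟩
      1ℚ ℚ.+ ℚ.∣ seq x N ∣ ∎
    where open ℚ-Solver.+-*-Solver
          open ℚ.≤-Reasoning

≗⇒≈ℝ : ∀ x y → (∀ n → seq x n ≡ seq y n) → x ≈ℝ y
≗⇒≈ℝ x y e ε 0<ε = 0 , λ n _ → subst (ℚ._< ε)
  (≡.sym (cong ℚ.∣_∣ (≡.trans (cong (ℚ._- seq y n) (e n)) (ℚ.+-inverseʳ (seq y n))))) 0<ε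

-- `x ≈ℝ y` unfolds to `Null` of the difference of the two sequences, so congruence laws reduce to
-- estimates for null sequences.
Null : (ℕ → ℚ) → Set
Null s = ∀ ε → 0ℚ ℚ.< ε → ∃ λ N → ∀ n → N ℕ.≤ n → ℚ.∣ s n ∣ ℚ.< ε

null-+ : ∀ {s t} → Null s → Null t → Null (λ n → s n ℚ.+ t n)
null-+ {s} {t} p q ε 0<ε with halve 0<ε
... | δ , 0<δ , δ+δ≡ε with p δ 0<δ | q δ 0<δ
... | M , f | N , g = M ℕ.⊔ N , λ n le → ℚ.≤-<-trans (ℚ.∣p+q∣≤∣p∣+∣q∣ (s n) (t n))
  (subst (_ ℚ.<_) δ+δ≡ε (ℚ.+-mono-< (f n (ℕ.m⊔n≤o⇒m≤o M N le)) (g n (ℕ.m⊔n≤o⇒n≤o M N le))))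

null-neg : ∀ {s} → Null s → Null (λ n → ℚ.- s n)
null-neg {s} p ε 0<ε = map₂ (λ f n le → subst (ℚ._< ε) (≡.sym (ℚ.∣-p∣≡∣p∣ (s n))) (f n le)) (p ε 0<ε)

null-* : ∀ x {t} → Null t → Null (λ n → seq x n ℚ.* t n)
null-* x {t} q ε 0<ε with bounded x
... | M , B , 0<B , x≤B with scaled-< 0<ε 0<B
... | δ , 0<δ , Bδ≡ε with q δ 0<δ
... | N , g = M ℕ.⊔ N , λ n le → begin-strict
    ℚ.∣ seq x n ℚ.* t n ∣           ≡⟨ ℚ.∣p*q∣≡∣p∣*∣q∣ (seq x n) (t n) ⟩
    ℚ.∣ seq x n ∣ ℚ.* ℚ.∣ t n ∣     ≤⟨ ℚ.*-monoʳ-≤-nonNeg ℚ.∣ t n ∣ {{ℚ.nonNegative (ℚ.0≤∣p∣ (t n))}}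
                                         (x≤B n (ℕ.m⊔n≤o⇒m≤o M N le)) ⟩
    B ℚ.* ℚ.∣ t n ∣                 <⟨ ℚ.*-monoʳ-<-pos B {{ℚ.positive 0<B}} (g n (ℕ.m⊔n≤o⇒n≤o M N le)) ⟩
    B ℚ.* δ                         ≡⟨ Bδ≡ε ⟩
    ε                               ∎
  where open ℚ.≤-Reasoning

null-cong : ∀ {s t} → (∀ n → s n ≡ t n) → Null s → Null t
null-cong e p ε 0<ε = map₂ (λ f n le → subst (λ q → ℚ.∣ q ∣ ℚ.< ε) (e n) (f n le)) (p ε 0<ε)

ℝ-commutativeRing : CommutativeRing 0ℓ 0ℓ
ℝ-commutativeRing = record
  { Carrier = ℝ
  ; _≈_ = _≈ℝ_
  ; _+_ = _+ℝ_
  ; _*_ = _*ℝ_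
  ; -_ = -ℝ_
  ; 0# = fromℚ 0ℚ
  ; 1# = fromℚ 1ℚ
  ; isCommutativeRing = record
    { isRing = record
      { +-isAbelianGroup = record
        { isGroup = record
          { isMonoid = record
            { isSemigroup = record
              { isMagma = record
                { isEquivalence = ≈ℝ-isEquivalence
                ; ∙-cong = λ {x} {y} {u} {v} p q → null-cong
                    (λ n → solve 4 (λ a b c d → (a :- b) :+ (c :- d) := (a :+ c) :- (b :+ d)) ≡.refl
                             (seq x n) (seq y n) (seq u n) (seq v n)) (null-+ p q)
                }
              ; assoc = λ x y z → ≗⇒≈ℝ (x +ℝ y +ℝ z) (x +ℝ (y +ℝ z)) λ n → ℚ.+-assoc (seq x n) (seq y n) (seq z n)
              }
            ; identity = (λ x → ≗⇒≈ℝ (fromℚ 0ℚ +ℝ x) x λ n → ℚ.+-identityˡ (seq x n))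
                       , (λ x → ≗⇒≈ℝ (x +ℝ fromℚ 0ℚ) x λ n → ℚ.+-identityʳ (seq x n))
            }
          ; inverse = (λ x → ≗⇒≈ℝ (-ℝ x +ℝ x) (fromℚ 0ℚ) λ n → ℚ.+-inverseˡ (seq x n))
                    , (λ x → ≗⇒≈ℝ (x +ℝ -ℝ x) (fromℚ 0ℚ) λ n → ℚ.+-inverseʳ (seq x n))
          ; ⁻¹-cong = λ {x} {y} p → null-cong
              (λ n → ℚ.neg-distrib-+ (seq x n) (ℚ.- seq y n)) (null-neg p)
          }
        ; comm = λ x y → ≗⇒≈ℝ (x +ℝ y) (y +ℝ x) λ n → ℚ.+-comm (seq x n) (seq y n)
        }
      ; *-cong = λ {x} {y} {u} {v} p q → null-cong
          (λ n → solve 4 (λ a b c d → a :* (c :- d) :+ d :* (a :- b) := a :* c :- b :* d) ≡.refl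
                   (seq x n) (seq y n) (seq u n) (seq v n)) (null-+ (null-* x q) (null-* v p))
      ; *-assoc = λ x y z → ≗⇒≈ℝ (x *ℝ y *ℝ z) (x *ℝ (y *ℝ z)) λ n → ℚ.*-assoc (seq x n) (seq y n) (seq z n)
      ; *-identity = (λ x → ≗⇒≈ℝ (fromℚ 1ℚ *ℝ x) x λ n → ℚ.*-identityˡ (seq x n))
                   , (λ x → ≗⇒≈ℝ (x *ℝ fromℚ 1ℚ) x λ n → ℚ.*-identityʳ (seq x n))
      ; distrib = (λ x y z → ≗⇒≈ℝ (x *ℝ (y +ℝ z)) (x *ℝ y +ℝ x *ℝ z) λ n → ℚ.*-distribˡ-+ (seq x n) (seq y n) (seq z n))
                , (λ x y z → ≗⇒≈ℝ ((y +ℝ z) *ℝ x) (y *ℝ x +ℝ z *ℝ x) λ n → ℚ.*-distribʳ-+ (seq x n) (seq y n) (seq z n))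
      }
    ; *-comm = λ x y → ≗⇒≈ℝ (x *ℝ y) (y *ℝ x) λ n → ℚ.*-comm (seq x n) (seq y n)
    }
  }
  where open ℚ-Solver.+-*-Solver

-- The constructive substitute for deciding x = 0. With δ = ε/2 and η = ε/4, a single rational term
-- x_N is compared with δ, where N is a modulus for η: later terms differ from x_N by less than η,
-- so they stay below ε, or at least η in absolute value.
eventually-small-or-large : ∀ x ε → 0ℚ ℚ.< ε →
  (∃ λ N → ∀ n → N ℕ.≤ n → ℚ.∣ seq x n ∣ ℚ.< ε) ⊎
  (∃₂ λ N η → 0ℚ ℚ.< η × (∀ n → N ℕ.≤ n → η ℚ.≤ ℚ.∣ seq x n ∣))
eventually-small-or-large x ε 0<ε with halve 0<ε
... | δ , 0<δ , δ+δ≡ε with halve 0<δ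
... | η , 0<η , η+η≡δ with cauchy x η 0<η
... | N , p with ℚ.∣ seq x N ∣ ℚ.<? δ
... | yes small = inj₁ (N , λ n le → begin-strict
    ℚ.∣ seq x n ∣                                       ≡⟨ cong ℚ.∣_∣ (a≡ (seq x n) (seq x N)) ⟩
    ℚ.∣ (seq x n ℚ.- seq x N) ℚ.+ seq x N ∣             ≤⟨ ℚ.∣p+q∣≤∣p∣+∣q∣ (seq x n ℚ.- seq x N) (seq x N) ⟩
    ℚ.∣ seq x n ℚ.- seq x N ∣ ℚ.+ ℚ.∣ seq x N ∣         <⟨ ℚ.+-mono-< (p n N le ℕ.≤-refl) small ⟩
    η ℚ.+ δ                                             <⟨ ℚ.+-monoˡ-< δ η<δ ⟩
    δ ℚ.+ δ                                             ≡⟨ δ+δ≡ε ⟩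
    ε                                                   ∎)
  where
  open ℚ.≤-Reasoning
  open ℚ-Solver.+-*-Solver
  a≡ : ∀ a b → a ≡ (a ℚ.- b) ℚ.+ b
  a≡ = solve 2 (λ a b → a := (a :- b) :+ b) ≡.refl
  η<δ : η ℚ.< δ
  η<δ = subst (η ℚ.<_) η+η≡δ (subst (ℚ._< η ℚ.+ η) (ℚ.+-identityʳ η) (ℚ.+-monoʳ-< η 0<η))
... | no large = inj₂ (N , η , 0<η , λ n le → ℚ.≮⇒≥ λ x<η → large (begin-strict
    ℚ.∣ seq x N ∣                                       ≡⟨ cong ℚ.∣_∣ (a≡ (seq x N) (seq x n)) ⟩
    ℚ.∣ (seq x N ℚ.- seq x n) ℚ.+ seq x n ∣             ≤⟨ ℚ.∣p+q∣≤∣p∣+∣q∣ (seq x N ℚ.- seq x n) (seq x n) ⟩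
    ℚ.∣ seq x N ℚ.- seq x n ∣ ℚ.+ ℚ.∣ seq x n ∣         <⟨ ℚ.+-mono-< (p N n ℕ.≤-refl le) x<η ⟩
    η ℚ.+ η                                             ≡⟨ η+η≡δ ⟩
    δ                                                   ∎))
  where
  open ℚ.≤-Reasoning
  open ℚ-Solver.+-*-Solver
  a≡ : ∀ a b → a ≡ (a ℚ.- b) ℚ.+ b
  a≡ = solve 2 (λ a b → a := (a :- b) :+ b) ≡.refl

≈0⇒null : ∀ x → x ≈ℝ fromℚ 0ℚ → Null (seq x)
≈0⇒null x = null-cong λ n → ℚ.+-identityʳ (seq x n)

null⇒≈0 : ∀ x → Null (seq x) → x ≈ℝ fromℚ 0ℚ
null⇒≈0 x = null-cong λ n → ≡.sym (ℚ.+-identityʳ (seq x n))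

-- At each ε, the alternative of being bounded away from zero contradicts even a doubly negated
-- nullity, so the sequence is eventually small.
null-stable : ∀ x → ¬ ¬ Null (seq x) → Null (seq x)
null-stable x nn ε 0<ε with eventually-small-or-large x ε 0<ε
... | inj₁ small = small
... | inj₂ (M , η , 0<η , large) = contradiction not-null nn
  where
  not-null : ¬ Null (seq x)
  not-null p with p η 0<η
  ... | N , f = ℚ.<-irrefl ≡.refl
    (ℚ.≤-<-trans (large (M ℕ.⊔ N) (ℕ.m≤m⊔n M N)) (f (M ℕ.⊔ N) (ℕ.m≤n⊔m M N)))

ℝ-stable : ∀ {x y} → ¬ ¬ x ≈ℝ y → x ≈ℝ y
ℝ-stable {x} {y} = null-stable (x +ℝ -ℝ y)

-- If |y| eventually stays above η, then |x| is at most |xy|/η and x is null, which is excluded;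
-- hence y is eventually below every ε.
ℝ-integral : ∀ {x y} → x *ℝ y ≈ℝ fromℚ 0ℚ → ¬ x ≈ℝ fromℚ 0ℚ → y ≈ℝ fromℚ 0ℚ
ℝ-integral {x} {y} xy≈0 x≉0 = null⇒≈0 y λ ε 0<ε → [ id , (λ large → contradiction (x≈0 large) x≉0) ]′
  (eventually-small-or-large y ε 0<ε)
  where
  x≈0 : (∃₂ λ N η → 0ℚ ℚ.< η × (∀ n → N ℕ.≤ n → η ℚ.≤ ℚ.∣ seq y n ∣)) → x ≈ℝ fromℚ 0ℚ
  x≈0 (M , η , 0<η , large) = null⇒≈0 x λ ε 0<ε →
    let N , f = ≈0⇒null (x *ℝ y) xy≈0 (ε ℚ.* η)
                  (subst (ℚ._< ε ℚ.* η) (ℚ.*-zeroˡ η) (ℚ.*-monoˡ-<-pos η {{ℚ.positive 0<η}} 0<ε))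
    in M ℕ.⊔ N , λ n le → ℚ.*-cancelʳ-<-nonNeg η {{ℚ.nonNegative (ℚ.<⇒≤ 0<η)}} (begin-strict
         ℚ.∣ seq x n ∣ ℚ.* η                ≤⟨ ℚ.*-monoˡ-≤-nonNeg ℚ.∣ seq x n ∣ {{ℚ.nonNegative (ℚ.0≤∣p∣ (seq x n))}}
                                                 (large n (ℕ.m⊔n≤o⇒m≤o M N le)) ⟩
         ℚ.∣ seq x n ∣ ℚ.* ℚ.∣ seq y n ∣    ≡⟨ ℚ.∣p*q∣≡∣p∣*∣q∣ (seq x n) (seq y n) ⟨
         ℚ.∣ seq x n ℚ.* seq y n ∣          <⟨ f n (ℕ.m⊔n≤o⇒n≤o M N le) ⟩
         ε ℚ.* η                            ∎)
    where open ℚ.≤-Reasoning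

open CommutativeRing ℝ-commutativeRing using (semiring)
open Algebra.Properties.Semiring.Mult semiring using () renaming (_×_ to _×ₙ_)

fromℕ-≥1 : ∀ n k → 1ℚ ℚ.≤ seq (suc n ×ₙ fromℚ 1ℚ) k
fromℕ-≥1 zero    k = ℚ.≤-reflexive (≡.sym (ℚ.+-identityʳ 1ℚ))
fromℕ-≥1 (suc n) k = ℚ.≤-trans (fromℕ-≥1 n k)
  (subst (ℚ._≤ 1ℚ ℚ.+ seq (suc n ×ₙ fromℚ 1ℚ) k) (ℚ.+-identityˡ _) (ℚ.+-monoˡ-≤ (seq (suc n ×ₙ fromℚ 1ℚ) k) (ℚ.<⇒≤ (ℚ.positive⁻¹ 1ℚ))))

fromℕ-nonzero : ∀ n → ¬ suc n ×ₙ fromℚ 1ℚ ≈ℝ fromℚ 0ℚ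
fromℕ-nonzero n e with ≈0⇒null (suc n ×ₙ fromℚ 1ℚ) e 1ℚ (ℚ.positive⁻¹ 1ℚ)
... | N , f = ℚ.<-irrefl ≡.refl (ℚ.≤-<-trans (fromℕ-≥1 n N)
  (subst (ℚ._< 1ℚ) (ℚ.0≤p⇒∣p∣≡p (ℚ.≤-trans (ℚ.<⇒≤ (ℚ.positive⁻¹ 1ℚ)) (fromℕ-≥1 n N))) (f N ℕ.≤-refl)))

ℝ-char0 : ∀ {m n} → m ×ₙ fromℚ 1ℚ ≈ℝ n ×ₙ fromℚ 1ℚ → m ≡ n
ℝ-char0 {zero}  {zero}  _ = ≡.refl
ℝ-char0 {zero}  {suc n} e =
  contradiction (CommutativeRing.sym ℝ-commutativeRing {fromℚ 0ℚ} {suc n ×ₙ fromℚ 1ℚ} e) (fromℕ-nonzero n)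
ℝ-char0 {suc m} {zero}  e = contradiction e (fromℕ-nonzero m)
ℝ-char0 {suc m} {suc n} e = cong suc (ℝ-char0 (null-cong
  (λ k → solve 3 (λ o a b → (o :+ a) :- (o :+ b) := a :- b) ≡.refl 1ℚ (seq (m ×ₙ fromℚ 1ℚ) k) (seq (n ×ₙ fromℚ 1ℚ) k)) e))
  where open ℚ-Solver.+-*-Solver

ℝ-characteristicZeroDomain : IsCharacteristicZeroDomain ℝ-rawRing
ℝ-characteristicZeroDomain = record
  { isCommutativeRing = CommutativeRing.isCommutativeRing ℝ-commutativeRing
  ; integral          = λ {x} {y} → ℝ-integral {x} {y}
  ; stable            = λ {x} {y} → ℝ-stable {x} {y}
  ; char0             = ℝ-char0
  }

-- Finite sums, Cauchy-Schwarz and common neighbours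

open ℕ-Sum
open ℕ-Solver.+-*-Solver using (solve; _:=_; _:+_; _:*_; con)
open Inverse using (to; from)

sumOver : ∀ {A : Set} {n} → A ↔ Fin n → (A → ℕ) → ℕ
sumOver e F = sum (F ∘ from e)

sumOver-≗ : ∀ {A : Set} {n} (e : A ↔ Fin n) {F G : A → ℕ} → (∀ x → F x ≡ G x) → sumOver e F ≡ sumOver e G
sumOver-≗ e F≗G = sum-cong-≗ λ i → F≗G (from e i)

-- A graph carries an arbitrary enumeration of its vertices; this permits evaluating sums in one
-- adapted to sides and fibres.
sumOver-unique : ∀ {A : Set} {m n} (e : A ↔ Fin m) (e′ : A ↔ Fin n) F → sumOver e F ≡ sumOver e′ F
sumOver-unique e e′ F = trans (sum-permute (F ∘ from e) (e ↔-∘ ↔-sym e′))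
  (sum-cong-≗ λ i → cong F (Inverse.strictlyInverseʳ e (from e′ i)))

sum-splitAt : ∀ m {n} (F : Fin m ⊎ Fin n → ℕ) → sum (F ∘ splitAt m) ≡ sum (F ∘ inj₁) + sum (F ∘ inj₂)
sum-splitAt zero    F = refl
sum-splitAt (suc m) F = trans (cong (F (inj₁ zero) +_) (sum-splitAt m (F ∘ Sum.map₁ suc))) (sym (ℕ.+-assoc (F (inj₁ zero)) _ _))

sum-quotRem : ∀ m n (F : Fin n × Fin m → ℕ) → sum (F ∘ quotRem {m} n) ≡ sum λ i → sum λ j → F (j , i)
sum-quotRem zero    n F = refl
sum-quotRem (suc m) n F =
  trans (sum-splitAt n (λ s → F ([ (_, zero) , map₂ suc ∘ quotRem {m} n ]′ s)))
        (cong ((sum λ j → F (j , zero)) +_) (sum-quotRem m n (F ∘ map₂ suc)))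

sumOver-⊎ : ∀ {W I J : Set} {w m n} (e : W ↔ Fin w) (eᴵ : I ↔ Fin m) (eᴶ : J ↔ Fin n) (ψ : W ↔ (I ⊎ J)) F →
            sumOver e F ≡ sumOver eᴵ (F ∘ from ψ ∘ inj₁) + sumOver eᴶ (F ∘ from ψ ∘ inj₂)
sumOver-⊎ {m = m} e eᴵ eᴶ ψ F = trans (sumOver-unique e (↔-sym Fin.+↔⊎ ↔-∘ ((eᴵ ⊎-↔ eᴶ) ↔-∘ ψ)) F)
  (sum-splitAt m (λ s → F (from ψ (from (eᴵ ⊎-↔ eᴶ) s))))

sumOver-× : ∀ {m n} (F : Fin m × Fin n → ℕ) → sumOver (↔-sym (Fin.*↔× {m} {n})) F ≡ sum λ i → sum λ j → F (i , j)
sumOver-× {m} {n} F = sum-quotRem m n (F ∘ swap)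

sum-const : ∀ n x → (sum {n} λ _ → x) ≡ n * x
sum-const zero    x = refl
sum-const (suc n) x = cong (x +_) (sum-const n x)

δ : ∀ {n} → Fin n → Fin n → ℕ
δ i j = if does (i Fin.≟ j) then 1 else 0

δ-refl : ∀ {n} (i : Fin n) → δ i i ≡ 1
δ-refl i = cong (if_then 1 else 0) (dec-true (i Fin.≟ i) refl)

δ-≢ : ∀ {n} {i j : Fin n} → i ≢ j → δ i j ≡ 0
δ-≢ {i = i} {j} i≢j = cong (if_then 1 else 0) (dec-false (i Fin.≟ j) i≢j)

δ-sym : ∀ {n} (i j : Fin n) → δ i j ≡ δ j i
δ-sym i j with i Fin.≟ j
... | yes refl = sym (δ-refl i)
... | no i≢j   = sym (δ-≢ (i≢j ∘ sym))

δ-injective : ∀ {n} (g : Fin n → Fin n) → (∀ {i j} → g i ≡ g j → i ≡ j) → ∀ i j → δ (g i) (g j) ≡ δ i j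
δ-injective g inj i j with i Fin.≟ j
... | yes refl = δ-refl (g i)
... | no i≢j   = δ-≢ (i≢j ∘ inj)

sum-δ : ∀ {n} (i : Fin n) (f : Fin n → ℕ) → (sum λ j → δ i j * f j) ≡ f i
sum-δ {suc n} zero f = trans (cong₂ _+_ (ℕ.*-identityˡ (f zero)) (trans (sum-const n 0) (ℕ.*-zeroʳ n))) (ℕ.+-identityʳ (f zero))
sum-δ {suc n} (suc i) f = sum-δ i (f ∘ suc)

sum-δ-1 : ∀ {n} (i : Fin n) → (sum λ j → δ i j) ≡ 1
sum-δ-1 i = trans (sum-cong-≗ {x = δ i} λ j → sym (ℕ.*-identityʳ (δ i j))) (sum-δ i (λ _ → 1))

-- The expansion of (a - b)² in ℕ, with the absolute difference in place of subtraction.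
square-sum : ∀ a b → a * a + b * b ≡ 2 * (a * b) + ∣ a - b ∣ * ∣ a - b ∣
square-sum zero    b       = refl
square-sum (suc a) zero    = trans (ℕ.+-identityʳ _) (cong (_+ suc a * suc a) (sym (cong (2 *_) (ℕ.*-zeroʳ a))))
square-sum (suc a) (suc b) = trans (solve 2 (λ a b → (con 1 :+ a) :* (con 1 :+ a) :+ (con 1 :+ b) :* (con 1 :+ b)
                                 := con 2 :* (con 1 :+ a :+ b) :+ (a :* a :+ b :* b)) refl a b)
  (trans (cong (2 * (1 + a + b) +_) (square-sum a b))
         (solve 3 (λ a b d → con 2 :* (con 1 :+ a :+ b) :+ (con 2 :* (a :* b) :+ d)
                       := con 2 :* ((con 1 :+ a) :* (con 1 :+ b)) :+ d) refl a b (∣ a - b ∣ * ∣ a - b ∣)))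

sum-scale : ∀ {n} c (f : Fin n → ℕ) → (sum λ i → c * f i) ≡ c * sum f
sum-scale c f = sym (*-distribˡ-sum c f)

-- The variance identity for r numbers with sum n, cleared of denominators: r times the mean is n.
-- The explicit remainder, a sum of squares, later yields the equality case, in which every number
-- is n/r.
cauchy-schwarz : ∀ {r} n (x : Fin r → ℕ) → sum x ≡ n →
  r * r * (sum λ k → x k * x k) ≡ r * (n * n) + (sum λ k → ∣ r * x k - n ∣ * ∣ r * x k - n ∣)
cauchy-schwarz {r} n x Σx≡n = ℕ.+-cancelʳ-≡ (r * (n * n)) _ _ (begin
  r * r * (sum λ k → x k * x k) + r * (n * n)
    ≡⟨ cong₂ _+_ (sym (sum-scale (r * r) (λ k → x k * x k))) (sym (sum-const r (n * n))) ⟩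
  (sum λ k → r * r * (x k * x k)) + (sum {r} λ k → n * n)
    ≡⟨ ∑-distrib-+ (λ k → r * r * (x k * x k)) (λ _ → n * n) ⟨
  (sum λ k → r * r * (x k * x k) + n * n)
    ≡⟨ sum-cong-≗ (λ k → trans (cong (_+ n * n) (solve 2 (λ r x → r :* r :* (x :* x) := r :* x :* (r :* x)) refl r (x k)))
                    (trans (square-sum (r * x k) n) (cong (_+ e k) (solve 3 (λ r x n → con 2 :* (r :* x :* n) := con 2 :* (r :* n) :* x) refl r (x k) n)))) ⟩
  (sum λ k → 2 * (r * n) * x k + e k)
    ≡⟨ ∑-distrib-+ (λ k → 2 * (r * n) * x k) e ⟩
  (sum λ k → 2 * (r * n) * x k) + sum e
    ≡⟨ cong (_+ sum e) (trans (sum-scale (2 * (r * n)) x) (cong (2 * (r * n) *_) Σx≡n)) ⟩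
  2 * (r * n) * n + sum e
    ≡⟨ solve 3 (λ r n e → con 2 :* (r :* n) :* n :+ e := r :* (n :* n) :+ e :+ r :* (n :* n)) refl r n (sum e) ⟩
  r * (n * n) + sum e + r * (n * n) ∎)
  where
  open ≡.≡-Reasoning
  e : Fin r → ℕ
  e k = ∣ r * x k - n ∣ * ∣ r * x k - n ∣

sum≡0 : ∀ {n} (f : Fin n → ℕ) → sum f ≡ 0 → ∀ i → f i ≡ 0
sum≡0 f e zero    = ℕ.m+n≡0⇒m≡0 (f zero) e
sum≡0 f e (suc i) = sum≡0 (f ∘ suc) (ℕ.m+n≡0⇒n≡0 (f zero) e) i

square≡0 : ∀ a b → ∣ a - b ∣ * ∣ a - b ∣ ≡ 0 → a ≡ b
square≡0 a b e with ℕ.m*n≡0⇒m≡0∨n≡0 ∣ a - b ∣ e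
... | inj₁ z = ℕ.∣m-n∣≡0⇒m≡n z
... | inj₂ z = ℕ.∣m-n∣≡0⇒m≡n z

-- Fibres over m vertices and over n vertices, all of size r, are matched by permutations g a b.
module CommonNeighbours {m n r} (g : Fin (suc m) → Fin n → Fin r → Fin r)
  (g⁻¹ : Fin (suc m) → Fin n → Fin r → Fin r)
  (g⁻¹-g : ∀ a b j → g⁻¹ a b (g a b j) ≡ j) (g-g⁻¹ : ∀ a b j → g a b (g⁻¹ a b j) ≡ j) where

  open ≡.≡-Reasoning

  common : Fin (suc m) → Fin r → Fin (suc m) → Fin r → ℕ
  common a j a′ k = sum λ b → δ (g a b j) (g a′ b k)

  g-injective : ∀ a b {j k} → g a b j ≡ g a b k → j ≡ k
  g-injective a b {j} {k} e = trans (sym (g⁻¹-g a b j)) (trans (cong (g⁻¹ a b) e) (g⁻¹-g a b k))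

  common-sym : ∀ a j a′ k → common a j a′ k ≡ common a′ k a j
  common-sym a j a′ k = sum-cong-≗ λ b → δ-sym (g a b j) (g a′ b k)

  -- Each of the n neighbours of (a , j), one in every fibre b, has exactly one neighbour in the
  -- fibre over a′.
  common-sum : ∀ a j a′ → (sum λ k → common a j a′ k) ≡ n
  common-sum a j a′ = begin
    (sum λ k → sum λ b → δ (g a b j) (g a′ b k))   ≡⟨ ∑-comm (λ k b → δ (g a b j) (g a′ b k)) ⟩
    (sum λ b → sum λ k → δ (g a b j) (g a′ b k))   ≡⟨ sum-cong-≗ (λ b → trans (sum-cong-≗ λ k →
        trans (cong (λ x → δ x (g a′ b k)) (sym (g-g⁻¹ a′ b (g a b j)))) (δ-injective (g a′ b) (g-injective a′ b) (g⁻¹ a′ b (g a b j)) k)) (sum-δ-1 (g⁻¹ a′ b (g a b j)))) ⟩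
    (sum {n} λ b → 1)                              ≡⟨ trans (sum-const n 1) (ℕ.*-identityʳ n) ⟩
    n ∎

  common-diagonal : ∀ a j k → common a j a k ≡ δ j k * n
  common-diagonal a j k = begin
    (sum λ b → δ (g a b j) (g a b k))   ≡⟨ sum-cong-≗ (λ b → δ-injective (g a b) (g-injective a b) j k) ⟩
    (sum {n} λ b → δ j k)               ≡⟨ sum-const n (δ j k) ⟩
    n * δ j k                           ≡⟨ ℕ.*-comm n (δ j k) ⟩
    δ j k * n ∎

  squares : Fin (suc m) → Fin (suc m) → ℕ
  squares a a′ = sum λ j → sum λ k → common a j a′ k * common a j a′ k

  defect : Fin (suc m) → Fin (suc m) → ℕ
  defect a a′ = sum λ j → sum λ k → ∣ r * common a j a′ k - n ∣ * ∣ r * common a j a′ k - n ∣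

  squares-defect : ∀ a a′ → r * r * squares a a′ ≡ r * r * (n * n) + defect a a′
  squares-defect a a′ = begin
    r * r * squares a a′                              ≡⟨ sum-scale (r * r) (λ j → sum λ k → common a j a′ k * common a j a′ k) ⟨
    (sum λ j → r * r * sum λ k → common a j a′ k * common a j a′ k)
      ≡⟨ sum-cong-≗ (λ j → cauchy-schwarz n (common a j a′) (common-sum a j a′)) ⟩
    (sum λ j → r * (n * n) + e j)                     ≡⟨ ∑-distrib-+ (λ _ → r * (n * n)) e ⟩
    (sum {r} λ j → r * (n * n)) + sum e               ≡⟨ cong (_+ sum e) (trans (sum-const r (r * (n * n))) (sym (ℕ.*-assoc r r (n * n)))) ⟩
    r * r * (n * n) + defect a a′ ∎
    where
    e : Fin r → ℕ
    e j = sum λ k → ∣ r * common a j a′ k - n ∣ * ∣ r * common a j a′ k - n ∣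

  squares-diagonal : ∀ a → squares a a ≡ r * (n * n)
  squares-diagonal a = begin
    (sum λ j → sum λ k → common a j a k * common a j a k)
      ≡⟨ sum-cong-≗ {r} (λ j → trans (sum-cong-≗ {r} λ k → trans (cong₂ _*_ (common-diagonal a j k) (common-diagonal a j k))
                                  (ℕ.*-assoc (δ j k) n (δ j k * n))) (trans (sum-δ j (λ k → n * (δ j k * n)))
                                    (cong (n *_) (trans (cong (_* n) (δ-refl j)) (ℕ.*-identityˡ n))))) ⟩
    (sum {r} λ j → n * n) ≡⟨ sum-const r (n * n) ⟩
    r * (n * n) ∎

  totalSquares : ℕ
  totalSquares = sum λ a → sum λ a′ → squares a a′

  totalDefect : ℕ
  totalDefect = sum λ a → sum λ k → defect a (punchIn a k)

  -- For each a, the block of a with itself gives r n², since a point shares all n neighbours with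
  -- itself and none with the rest of its fibre. Each of the other m blocks gives n² plus its defect
  -- divided by r²; hence the factor m + r.
  totalSquares-defect : r * r * totalSquares ≡ r * r * (suc m * (n * n) * (m + r)) + totalDefect
  totalSquares-defect = begin
    r * r * totalSquares
      ≡⟨ sum-scale (r * r) (λ a → sum λ a′ → squares a a′) ⟨
    (sum λ a → r * r * sum λ a′ → squares a a′)
      ≡⟨ sum-cong-≗ row ⟩
    (sum λ a → r * r * ((n * n) * (m + r)) + d a)
      ≡⟨ ∑-distrib-+ (λ _ → r * r * ((n * n) * (m + r))) d ⟩
    (sum {suc m} λ a → r * r * ((n * n) * (m + r))) + totalDefect
      ≡⟨ cong (_+ totalDefect) (trans (sum-const (suc m) (r * r * ((n * n) * (m + r))))
           (solve 4 (λ sm r n k → sm :* (r :* r :* (n :* n :* k)) := r :* r :* (sm :* (n :* n) :* k)) refl (suc m) r n (m + r))) ⟩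
    r * r * (suc m * (n * n) * (m + r)) + totalDefect ∎
    where
    d : Fin (suc m) → ℕ
    d a = sum λ k → defect a (punchIn a k)
    row : ∀ a → r * r * (sum λ a′ → squares a a′) ≡ r * r * ((n * n) * (m + r)) + d a
    row a = begin
      r * r * (sum λ a′ → squares a a′)
        ≡⟨ cong (r * r *_) (sum-remove {i = a} (squares a)) ⟩
      r * r * (squares a a + sum λ k → squares a (punchIn a k))
        ≡⟨ ℕ.*-distribˡ-+ (r * r) (squares a a) _ ⟩
      r * r * squares a a + r * r * (sum λ k → squares a (punchIn a k))
        ≡⟨ cong₂ _+_ (cong (r * r *_) (squares-diagonal a)) (trans (sym (sum-scale (r * r) (λ k → squares a (punchIn a k))))
             (trans (sum-cong-≗ λ k → squares-defect a (punchIn a k))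
               (trans (∑-distrib-+ (λ _ → r * r * (n * n)) (λ k → defect a (punchIn a k))) (cong (_+ d a) (sum-const m (r * r * (n * n))))))) ⟩
      r * r * (r * (n * n)) + (m * (r * r * (n * n)) + d a)
        ≡⟨ solve 4 (λ m r n d → r :* r :* (r :* (n :* n)) :+ (m :* (r :* r :* (n :* n)) :+ d)
               := r :* r :* (n :* n :* (m :+ r)) :+ d) refl m r n (d a) ⟩
      r * r * ((n * n) * (m + r)) + d a ∎

  -- A vanishing sum of naturals vanishes termwise; `punchOut` finds a′ among the indices other than
  -- a.
  common-constant : totalDefect ≡ 0 → ∀ {a a′} → a ≢ a′ → ∀ j k → r * common a j a′ k ≡ n
  common-constant z {a} {a′} a≢a′ j k = square≡0 _ n (sum≡0 (λ k → ∣ r * common a j a′ k - n ∣ * ∣ r * common a j a′ k - n ∣)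
    (sum≡0 (λ j → sum λ k → ∣ r * common a j a′ k - n ∣ * ∣ r * common a j a′ k - n ∣)
      (subst (λ b → defect a b ≡ 0) (Fin.punchIn-punchOut a≢a′)
        (sum≡0 (λ k → defect a (punchIn a k)) (sum≡0 (λ a → sum λ k → defect a (punchIn a k)) z a) (punchOut a≢a′))) j) k)

-- Closed walks in a bipartite graph

-- B is the biadjacency matrix of the bipartite graph with adjacency matrix a.
module ClosedWalks {W I J : Set} {w m n} (e : W ↔ Fin w) (eᴵ : I ↔ Fin m) (eᴶ : J ↔ Fin n) (ψ : W ↔ (I ⊎ J))
  (a : W → W → ℕ) (B : I → J → ℕ)
  (a₁₁ : ∀ i i′ → a (from ψ (inj₁ i)) (from ψ (inj₁ i′)) ≡ 0)
  (a₁₂ : ∀ i j → a (from ψ (inj₁ i)) (from ψ (inj₂ j)) ≡ B i j)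
  (a₂₁ : ∀ j i → a (from ψ (inj₂ j)) (from ψ (inj₁ i)) ≡ B i j)
  (a₂₂ : ∀ j j′ → a (from ψ (inj₂ j)) (from ψ (inj₂ j′)) ≡ 0) where

  ∑ᴵ : (I → ℕ) → ℕ
  ∑ᴵ = sumOver eᴵ

  ∑ᴶ : (J → ℕ) → ℕ
  ∑ᴶ = sumOver eᴶ

  split : ∀ F G H → (∀ i → F (from ψ (inj₁ i)) ≡ G i) → (∀ j → F (from ψ (inj₂ j)) ≡ H j) →
          sumOver e F ≡ ∑ᴵ G + ∑ᴶ H
  split F G H p q = trans (sumOver-⊎ e eᴵ eᴶ ψ F) (cong₂ _+_ (sumOver-≗ eᴵ p) (sumOver-≗ eᴶ q))

  sumOver-0 : ∀ {A : Set} {n} (e : A ↔ Fin n) → sumOver e (λ _ → 0) ≡ 0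
  sumOver-0 {n = n} e = trans (sum-const n 0) (ℕ.*-zeroʳ n)

  onJ : ∀ F H → (∀ i → F (from ψ (inj₁ i)) ≡ 0) → (∀ j → F (from ψ (inj₂ j)) ≡ H j) → sumOver e F ≡ ∑ᴶ H
  onJ F H p q = trans (split F (λ _ → 0) H p q) (cong (_+ ∑ᴶ H) (sumOver-0 eᴵ))

  onI : ∀ F G → (∀ i → F (from ψ (inj₁ i)) ≡ G i) → (∀ j → F (from ψ (inj₂ j)) ≡ 0) → sumOver e F ≡ ∑ᴵ G
  onI F G p q = trans (split F G (λ _ → 0) p q) (trans (cong (∑ᴵ G +_) (sumOver-0 eᴶ)) (ℕ.+-identityʳ (∑ᴵ G)))

  walks₂ : W → W → ℕ
  walks₂ x y = sumOver e λ z → a x z * a z y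

  commonᴵ : I → I → ℕ
  commonᴵ i i′ = ∑ᴶ λ j → B i j * B i′ j

  commonᴶ : J → J → ℕ
  commonᴶ j j′ = ∑ᴵ λ i → B i j * B i j′

  private
    w₁ : I → W
    w₁ i = from ψ (inj₁ i)
    w₂ : J → W
    w₂ j = from ψ (inj₂ j)

    0* : ∀ {x} y → x ≡ 0 → x * y ≡ 0
    0* y e = cong (_* y) e
    *0 : ∀ x {y} → y ≡ 0 → x * y ≡ 0
    *0 x e = trans (cong (x *_) e) (ℕ.*-zeroʳ x)

  walks₂-11 : ∀ i i′ → walks₂ (w₁ i) (w₁ i′) ≡ commonᴵ i i′
  walks₂-11 i i′ = onJ (λ z → a (w₁ i) z * a z (w₁ i′)) (λ j → B i j * B i′ j)
    (λ i″ → 0* (a (w₁ i″) (w₁ i′)) (a₁₁ i i″)) λ j → cong₂ _*_ (a₁₂ i j) (a₂₁ j i′)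

  walks₂-12 : ∀ i j → walks₂ (w₁ i) (w₂ j) ≡ 0
  walks₂-12 i j = trans (onI (λ z → a (w₁ i) z * a z (w₂ j)) (λ _ → 0)
    (λ i″ → 0* (a (w₁ i″) (w₂ j)) (a₁₁ i i″)) (λ j′ → *0 (a (w₁ i) (w₂ j′)) (a₂₂ j′ j))) (sumOver-0 eᴵ)

  walks₂-21 : ∀ j i → walks₂ (w₂ j) (w₁ i) ≡ 0
  walks₂-21 j i = trans (onI (λ z → a (w₂ j) z * a z (w₁ i)) (λ _ → 0)
    (λ i″ → *0 (a (w₂ j) (w₁ i″)) (a₁₁ i″ i)) (λ j′ → 0* (a (w₂ j′) (w₁ i)) (a₂₂ j j′))) (sumOver-0 eᴵ)

  walks₂-22 : ∀ j j′ → walks₂ (w₂ j) (w₂ j′) ≡ commonᴶ j j′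
  walks₂-22 j j′ = onI (λ z → a (w₂ j) z * a z (w₂ j′)) (λ i → B i j * B i j′)
    (λ i → cong₂ _*_ (a₂₁ j i) (a₁₂ i j′)) λ j″ → 0* (a (w₂ j″) (w₂ j′)) (a₂₂ j j″)

  closed₂-split : (sumOver e λ x → walks₂ x x) ≡ (∑ᴵ λ i → commonᴵ i i) + (∑ᴶ λ j → commonᴶ j j)
  closed₂-split = split (λ x → walks₂ x x) (λ i → commonᴵ i i) (λ j → commonᴶ j j)
    (λ i → walks₂-11 i i) (λ j → walks₂-22 j j)

  -- A two-step walk returns to the side where it started, so the squared adjacency matrix is block
  -- diagonal and mixed pairs contribute nothing.
  closed₄-split : (sumOver e λ x → sumOver e λ y → walks₂ x y * walks₂ y x) ≡
    (∑ᴵ λ i → ∑ᴵ λ i′ → commonᴵ i i′ * commonᴵ i′ i) + (∑ᴶ λ j → ∑ᴶ λ j′ → commonᴶ j j′ * commonᴶ j′ j)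
  closed₄-split = split (λ x → sumOver e λ y → walks₂ x y * walks₂ y x) (λ i → ∑ᴵ λ i′ → commonᴵ i i′ * commonᴵ i′ i)
    (λ j → ∑ᴶ λ j′ → commonᴶ j j′ * commonᴶ j′ j)
    (λ i → onI (λ y → walks₂ (w₁ i) y * walks₂ y (w₁ i)) (λ i′ → commonᴵ i i′ * commonᴵ i′ i)
      (λ i′ → cong₂ _*_ (walks₂-11 i i′) (walks₂-11 i′ i)) λ j → 0* (walks₂ (w₂ j) (w₁ i)) (walks₂-12 i j))
    (λ j → onJ (λ y → walks₂ (w₂ j) y * walks₂ y (w₂ j)) (λ j′ → commonᴶ j j′ * commonᴶ j′ j)
      (λ i → 0* (walks₂ (w₁ i) (w₂ j)) (walks₂-21 j i)) λ j′ → cong₂ _*_ (walks₂-22 j j′) (walks₂-22 j′ j))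

-- Isomorphism invariance of diameter and distance-regularity

module _ {V W : Set} {Y : Graph V} {Z : Graph W} where

  map-walk : (f : V → W) → (∀ {u v} → Adj Y u v → Adj Z (f u) (f v)) →
             ∀ {u v n} → Walk Y u v n → Walk Z (f u) (f v) n
  map-walk f h nil        = nil
  map-walk f h (cons a p) = cons (h a) (map-walk f h p)

  hasCardinality-transport : (φ : V ↔ W) {P : Pred V 0ℓ} {Q : Pred W 0ℓ} → (∀ v → P v ⇔ Q (to φ v)) →
                             ∀ {k} → HasCardinality Q k → HasCardinality P k
  hasCardinality-transport φ {P} {Q} e (xs , uniq , mem , refl) =
    List.map (from φ) xs , Unique.map⁺ (λ {x} {y} q → trans (sym (Inverse.strictlyInverseˡ φ x))
        (trans (cong (to φ) q) (Inverse.strictlyInverseˡ φ y))) uniq ,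
    (λ v → mk⇔
      (λ i → let (w , w∈ , v≡) = ∈-map⁻ (from φ) i in
             Equivalence.from (e v) (subst Q (trans (sym (Inverse.strictlyInverseˡ φ w)) (cong (to φ) (sym v≡)))
               (Equivalence.to (mem w) w∈)))
      (λ p → subst (_∈ₗ List.map (from φ) xs) (Inverse.strictlyInverseʳ φ v)
               (∈-map⁺ (from φ) (Equivalence.from (mem (to φ v)) (Equivalence.to (e v) p))))) ,
    List.length-map (from φ) xs

≅-sym : ∀ {V W} {Y : Graph V} {Z : Graph W} → Y ≅ Z → Z ≅ Y
≅-sym {Y = Y} {Z} (φ , e) = record
  { to = from φ ; from = to φ ; to-cong = cong (from φ) ; from-cong = cong (to φ)
  ; inverse = (λ { refl → Inverse.strictlyInverseʳ φ _ }) , (λ { refl → Inverse.strictlyInverseˡ φ _ }) } ,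
  λ u v → mk⇔
    (λ a → Equivalence.from (e _ _) (subst₂ (Adj Z) (sym (Inverse.strictlyInverseˡ φ u)) (sym (Inverse.strictlyInverseˡ φ v)) a))
    (λ a → subst₂ (Adj Z) (Inverse.strictlyInverseˡ φ u) (Inverse.strictlyInverseˡ φ v) (Equivalence.to (e _ _) a))

module Transport {V W : Set} {Y : Graph V} {Z : Graph W} (iso : Y ≅ Z) where

  private
    φ = proj₁ iso
    e = proj₂ iso

  walk⁺ : ∀ {u v n} → Walk Y u v n → Walk Z (to φ u) (to φ v) n
  walk⁺ = map-walk (to φ) (Equivalence.to (e _ _))

  walk⁻ : ∀ {u v n} → Walk Z (to φ u) (to φ v) n → Walk Y u v n
  walk⁻ p = subst₂ (λ u v → Walk Y u v _) (Inverse.strictlyInverseʳ φ _) (Inverse.strictlyInverseʳ φ _)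
    (map-walk (from φ) (Equivalence.to (proj₂ (≅-sym {Y = Y} {Z} iso) _ _)) p)

  distance⇔ : ∀ {u v d} → Distance Y u v d ⇔ Distance Z (to φ u) (to φ v) d
  distance⇔ = mk⇔ (λ (p , m) → walk⁺ p , λ q → m (walk⁻ q)) (λ (p , m) → walk⁻ p , λ q → m (walk⁺ q))

  distanceRegular : DistanceRegular Z → DistanceRegular Y
  distanceRegular (conn , b , c , h) =
    (λ u v → let (n , p) = conn (to φ u) (to φ v) in n , walk⁻ p) , b , c , λ i v w d →
      let (hb , hc) = h i (to φ v) (to φ w) (Equivalence.to distance⇔ d) in
      hasCardinality-transport {Y = Y} {Z} φ (λ x → mk⇔
        (λ (a , q) → Equivalence.to (e w x) a , Equivalence.to distance⇔ q)
        (λ (a , q) → Equivalence.from (e w x) a , Equivalence.from distance⇔ q)) hb ,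
      hasCardinality-transport {Y = Y} {Z} φ (λ x → mk⇔
        (λ (a , j , j≡ , q) → Equivalence.to (e w x) a , j , j≡ , Equivalence.to distance⇔ q)
        (λ (a , j , j≡ , q) → Equivalence.from (e w x) a , j , j≡ , Equivalence.from distance⇔ q)) hc

  hasDiameter : ∀ {d} → HasDiameter Z d → HasDiameter Y d
  hasDiameter {d} (h , w , w′ , p) =
    (λ u v → let (i , q , i≤d) = h (to φ u) (to φ v) in i , Equivalence.from distance⇔ q , i≤d) ,
    from φ w , from φ w′ , Equivalence.from distance⇔
      (subst₂ (λ w w′ → Distance Z w w′ d) (sym (Inverse.strictlyInverseˡ φ w)) (sym (Inverse.strictlyInverseˡ φ w′)) p)

-- Distances and intersection numbers of the balanced cover

length-filter-tabulate : ∀ {A : Set} {P : Pred A 0ℓ} (P? : Decidable P) {n} (f : Fin n → A) →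
                         length (filter P? (List.tabulate f)) ≡ sum λ i → if does (P? (f i)) then 1 else 0
length-filter-tabulate P? {zero}  f = refl
length-filter-tabulate P? {suc n} f with does (P? (f zero))
... | true  = cong suc (length-filter-tabulate P? (f ∘ suc))
... | false = length-filter-tabulate P? (f ∘ suc)

sum-positive : ∀ {n} {P : Fin n → Set} (P? : ∀ i → Dec (P i)) → 1 ≤ (sum λ i → if does (P? i) then 1 else 0) → ∃ P
sum-positive {suc n} P? 1≤ with P? zero
... | yes p = zero , p
... | no _  = let (i , p) = sum-positive (P? ∘ suc) 1≤ in suc i , p

-- An r-fold cover of K_{n,n} in which vertices of different fibres on the same side always have
-- μ common neighbours; σ s a b matches the fibre a on side s with the fibre b on the other side.
module SymmetricCover {n r μ} (another : ∀ (a : Fin n) → ∃ (a ≢_)) (origin : Fin n)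
  {j₀ j₁ : Fin r} (j₀≢j₁ : j₀ ≢ j₁)
  (σ : Bool → Fin n → Fin n → Fin r → Fin r)
  (σ-inverse : ∀ s a b j → σ (not s) b a (σ s a b j) ≡ j)
  (1≤μ : 1 ≤ μ)
  (common≡μ : ∀ s {a a′} → a ≢ a′ → ∀ j k → (sum λ b → δ (σ s a b j) (σ s a′ b k)) ≡ μ)
  (Z : Graph (Bool × Fin n × Fin r))
  (adj⇔ : ∀ s a j t b k → Adj Z (s , a , j) (t , b , k) ⇔ (t ≡ not s × σ s a b j ≡ k))
  where

  X : Set
  X = Bool × Fin n × Fin r

  -- The five distance classes in coordinates, indexed by the distance that `rel-distance`
  -- establishes. `anti` consists of the antipodal pairs: different points of one fibre.
  data Rel : X → X → ℕ → Set where
    same : ∀ {s a j t b k} → t ≡ s → a ≡ b → j ≡ k → Rel (s , a , j) (t , b , k) 0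
    adj  : ∀ {s a j t b k} → t ≡ not s → σ s a b j ≡ k → Rel (s , a , j) (t , b , k) 1
    side : ∀ {s a j t b k} → t ≡ s → a ≢ b → Rel (s , a , j) (t , b , k) 2
    far  : ∀ {s a j t b k} → t ≡ not s → σ s a b j ≢ k → Rel (s , a , j) (t , b , k) 3
    anti : ∀ {s a j t b k} → t ≡ s → a ≡ b → j ≢ k → Rel (s , a , j) (t , b , k) 4

  rel : ∀ x y → ∃ (Rel x y)
  rel (s , a , j) (t , b , k) with t Bool.≟ s
  ... | no t≢s with σ s a b j Fin.≟ k
  ...   | yes e = 1 , adj (Bool.¬-not t≢s) e
  ...   | no ≢k = 3 , far (Bool.¬-not t≢s) ≢k
  rel (s , a , j) (t , b , k) | yes t≡s with a Fin.≟ b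
  ... | no a≢b = 2 , side t≡s a≢b
  ... | yes a≡b with j Fin.≟ k
  ...   | yes j≡k = 0 , same t≡s a≡b j≡k
  ...   | no j≢k  = 4 , anti t≡s a≡b j≢k

  σ-inverse′ : ∀ {s t} → t ≡ not s → ∀ {a b j k} → σ s a b j ≡ k → σ t b a k ≡ j
  σ-inverse′ refl refl = σ-inverse _ _ _ _

  flip-side : ∀ {s t} → t ≡ not s → s ≡ not t
  flip-side {s} refl = sym (Bool.not-involutive s)

  rel-sym : ∀ {x y d} → Rel x y d → Rel y x d
  rel-sym (same t≡s e f) = same (sym t≡s) (sym e) (sym f)
  rel-sym (adj t≡ e)     = adj (flip-side t≡) (σ-inverse′ t≡ e)
  rel-sym (side t≡s ≢)   = side (sym t≡s) (≢ ∘ sym)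
  rel-sym (far t≡ ≢)     = far (flip-side t≡) (≢ ∘ σ-inverse′ (flip-side t≡))
  rel-sym (anti t≡s e ≢) = anti (sym t≡s) (sym e) (≢ ∘ sym)

  rel-≤4 : ∀ {x y d} → Rel x y d → d ≤ 4
  rel-≤4 (same _ _ _) = z≤n
  rel-≤4 (adj _ _)    = s≤s z≤n
  rel-≤4 (side _ _)   = s≤s (s≤s z≤n)
  rel-≤4 (far _ _)    = s≤s (s≤s (s≤s z≤n))
  rel-≤4 (anti _ _ _) = s≤s (s≤s (s≤s (s≤s z≤n)))

  parity : ∀ {s a j t b k d} → Rel (s , a , j) (t , b , k) d → t ≡ fold s not d
  parity (same t≡s _ _)       = t≡s
  parity (adj t≡ _)           = t≡
  parity {s} (side t≡s _)     = trans t≡s (sym (Bool.not-involutive s))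
  parity {s} (far t≡ _)       = trans t≡ (cong not (sym (Bool.not-involutive s)))
  parity {s} (anti t≡s _ _)   = trans t≡s (sym (trans (cong (not ∘ not) (Bool.not-involutive s)) (Bool.not-involutive s)))

  Adjacent : X → X → Set
  Adjacent (s , a , j) (t , b , k) = t ≡ not s × σ s a b j ≡ k

  adjacent : ∀ {x y} → Adj Z x y → Adjacent x y
  adjacent = Equivalence.to (adj⇔ _ _ _ _ _ _)

  adjacent⁻ : ∀ {x y} → Adjacent x y → Adj Z x y
  adjacent⁻ = Equivalence.from (adj⇔ _ _ _ _ _ _)

  -- Together with `rel-refl` this bounds the length of every walk from below. Where the numbers
  -- alone do not decide, the case contradicts either the sides or the fact that σ matches fibres
  -- bijectively.
  lipschitz : ∀ {x y z d e} → Adjacent x y → Rel y z d → Rel x z e → e ≤ suc d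
  lipschitz _ _ (same _ _ _) = z≤n
  lipschitz _ _ (adj _ _)    = s≤s z≤n
  lipschitz _ (adj _ _) (side _ _)  = s≤s (s≤s z≤n)
  lipschitz _ (side _ _) (side _ _) = s≤s (s≤s z≤n)
  lipschitz _ (far _ _) (side _ _)  = s≤s (s≤s z≤n)
  lipschitz _ (anti _ _ _) (side _ _) = s≤s (s≤s z≤n)
  lipschitz (y≡ , _) (same z≡y _ _) (side z≡x _) = contradiction (trans (sym z≡x) (trans z≡y y≡)) (Bool.not-¬ refl)
  lipschitz _ (side _ _) (far _ _)  = s≤s (s≤s (s≤s z≤n))
  lipschitz _ (far _ _) (far _ _)   = s≤s (s≤s (s≤s z≤n))
  lipschitz _ (anti _ _ _) (far _ _) = s≤s (s≤s (s≤s z≤n))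
  lipschitz (_ , e) (same _ refl refl) (far _ ≢k) = contradiction e ≢k
  lipschitz (y≡ , _) (adj z≡ _) (far z≡x _) =
    contradiction (trans (sym z≡x) (trans z≡ (cong not y≡))) (Bool.not-¬ refl)
  lipschitz _ (far _ _) (anti _ _ _) = s≤s (s≤s (s≤s (s≤s z≤n)))
  lipschitz _ (anti _ _ _) (anti _ _ _) = s≤s (s≤s (s≤s (s≤s z≤n)))
  lipschitz (y≡ , _) (same z≡y _ _) (anti z≡x _ _) = contradiction (trans (sym z≡x) (trans z≡y y≡)) (Bool.not-¬ refl)
  lipschitz (y≡ , e) (adj z≡ f) (anti _ refl j≢k) = contradiction (trans (sym (σ-inverse′ y≡ e)) f) j≢k
  lipschitz (y≡ , _) (side z≡y _) (anti z≡x _ _) = contradiction (trans (sym z≡x) (trans z≡y y≡)) (Bool.not-¬ refl)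

  rel-refl : ∀ x {d} → Rel x x d → d ≤ 0
  rel-refl x (same _ _ _)   = z≤n
  rel-refl x (adj t≡ _)     = contradiction t≡ (Bool.not-¬ refl)
  rel-refl x (side _ ≢)     = contradiction refl ≢
  rel-refl x (far t≡ _)     = contradiction t≡ (Bool.not-¬ refl)
  rel-refl x (anti _ _ ≢)   = contradiction refl ≢

  rel≤walk : ∀ {x y d n} → Rel x y d → Walk Z x y n → d ≤ n
  rel≤walk r nil = rel-refl _ r
  rel≤walk r (cons {v = y} a p) = ℕ.≤-trans (lipschitz (adjacent a) (proj₂ (rel y _)) r) (s≤s (rel≤walk (proj₂ (rel y _)) p))

  walk-side : ∀ {x y} → Rel x y 2 → Walk Z x y 2
  walk-side {s , a , j} {t , a′ , k} (side t≡s a≢a′)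
    with sum-positive (λ b → σ s a b j Fin.≟ σ s a′ b k) (subst (1 ≤_) (sym (common≡μ s a≢a′ j k)) 1≤μ)
  ... | b , e = cons {v = not s , b , σ s a b j} (adjacent⁻ (refl , refl))
    (cons (adjacent⁻ (trans t≡s (sym (Bool.not-involutive s)) , σ-inverse′ refl (sym e))) nil)

  -- A first step into a fibre other than that of y lands on the side of y, from where two more
  -- steps suffice.
  walk-far : ∀ {x y} → Rel x y 3 → Walk Z x y 3
  walk-far {s , a , j} {t , b , k} (far t≡ _) with another b
  ... | b′ , b≢b′ = cons {v = not s , b′ , σ s a b′ j} (adjacent⁻ (refl , refl)) (walk-side (side t≡ (b≢b′ ∘ sym)))

  walk : ∀ {x y d} → Rel x y d → Walk Z x y d
  walk (same refl refl refl) = nil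
  walk (adj t≡ e)    = cons (adjacent⁻ (t≡ , e)) nil
  walk r@(side _ _)  = walk-side r
  walk r@(far _ _)   = walk-far r
  -- The first step goes to the neighbour of x in a fibre of the opposite side. That fibre's index
  -- is immaterial, so a is reused; the neighbour is not adjacent to y because j ≢ k.
  walk {s , a , j} {t , _ , k} (anti t≡s refl j≢k) =
    cons {v = not s , a , σ s a a j} (adjacent⁻ (refl , refl))
      (walk-far (far (trans t≡s (sym (Bool.not-involutive s))) (j≢k ∘ trans (sym (σ-inverse s a a j)))))

  rel-distance : ∀ {x y d} → Rel x y d → Distance Z x y d
  rel-distance r = walk r , rel≤walk r

  distance-rel : ∀ {x y d} → Distance Z x y d → Rel x y d
  distance-rel {x} {y} (p , m) with rel x y
  ... | e , r = subst (Rel x y) (ℕ.≤-antisym (rel≤walk r p) (m (walk r))) r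

  rel-unique : ∀ {x y d e} → Rel x y d → Rel x y e → d ≡ e
  rel-unique r r′ = ℕ.≤-antisym (rel≤walk r (walk r′)) (rel≤walk r′ (walk r))

  rel? : ∀ x y d → Dec (Rel x y d)
  rel? x y d with rel x y
  ... | e , r with e ℕ.≟ d
  ...   | yes refl = yes r
  ...   | no e≢d   = no λ r′ → e≢d (rel-unique r r′)

  adjacent-sym : ∀ {x y} → Adjacent x y → Adjacent y x
  adjacent-sym (t≡ , e) = flip-side t≡ , σ-inverse′ t≡ e

  -- Bipartiteness: adjacent vertices have distances of different parity from v, so the distance
  -- never stays the same.
  step : ∀ {v w x i d} → Adjacent w x → Rel v w i → Rel v x d → d ≡ suc i ⊎ suc d ≡ i
  step {v} {w} {x} {i} {d} a r r′ with ℕ.<-cmp d i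
  ... | tri< d<i _ _ = inj₂ (ℕ.≤-antisym d<i (lipschitz a (rel-sym r′) (rel-sym r)))
  ... | tri≈ _ refl _ = contradiction (trans (sym (proj₁ a)) (trans (parity r′) (sym (parity r)))) λ e → Bool.not-¬ refl (sym e)
  ... | tri> _ _ i<d = inj₁ (ℕ.≤-antisym (lipschitz (adjacent-sym a) (rel-sym r) (rel-sym r′)) i<d)

  neighbour : X → Fin n → X
  neighbour (s , a , j) b = not s , b , σ s a b j

  neighbours : X → List X
  neighbours w = List.tabulate (neighbour w)

  ∈-neighbours : ∀ w x → x ∈ₗ neighbours w ⇔ Adj Z w x
  ∈-neighbours w@(s , a , j) x@(t , b , k) = mk⇔
    (λ i → let (b , x≡) = ∈-tabulate⁻ {f = neighbour w} i in subst (Adj Z w) (sym x≡) (adjacent⁻ {w} {neighbour w b} (refl , refl)))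
    (λ h → go (adjacent h))
    where
    go : Adjacent w x → x ∈ₗ neighbours w
    go (refl , refl) = ∈-tabulate⁺ {f = neighbour w} b

  count : {P : Pred X 0ℓ} → Decidable P → X → ℕ
  count P? w = sum λ b → if does (P? (neighbour w b)) then 1 else 0

  cardinality : {P : Pred X 0ℓ} (P? : Decidable P) {Q : Pred X 0ℓ} → (∀ x → P x ⇔ Q x) → ∀ w {k} → count P? w ≡ k →
                HasCardinality (λ x → Adj Z w x × Q x) k
  cardinality P? {Q} e w refl = filter P? (neighbours w) ,
    Unique.filter⁺ P? (Unique.tabulate⁺ {f = neighbour w} (cong (proj₁ ∘ proj₂))) ,
    (λ x → mk⇔
      (λ i → let (i , p) = ∈-filter⁻ P? {xs = neighbours w} i in Equivalence.to (∈-neighbours w x) i , Equivalence.to (e x) p)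
      (λ (h , q) → ∈-filter⁺ P? (Equivalence.from (∈-neighbours w x) h) (Equivalence.from (e x) q))) ,
    length-filter-tabulate P? (neighbour w)

  up? : ∀ v i → Decidable (λ x → Rel v x (suc i))
  up? v i x = rel? v x (suc i)

  Below : X → ℕ → X → Set
  Below v i x = ∃ λ j → suc j ≡ i × Rel v x j

  below? : ∀ v i → Decidable (Below v i)
  below? v zero    x = no λ ()
  below? v (suc i) x with rel? v x i
  ... | yes r = yes (i , refl , r)
  ... | no ¬r = no λ { (_ , refl , r) → ¬r r }

  neighbour-adjacent : ∀ w b → Adjacent w (neighbour w b)
  neighbour-adjacent w b = refl , refl

  -- Every one of the n neighbours of w is one step further from v or one step closer, so in each
  -- class a single intersection number has to be counted.
  up+below : ∀ {v w i} → Rel v w i → count (up? v i) w + count (below? v i) w ≡ n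
  up+below {v} {w} {i} r = trans (sym (∑-distrib-+ up below)) (trans (sum-cong-≗ {n} {λ b → up b + below b} one) (trans (sum-const n 1) (ℕ.*-identityʳ n)))
    where
    up below : Fin n → ℕ
    up b = if does (up? v i (neighbour w b)) then 1 else 0
    below b = if does (below? v i (neighbour w b)) then 1 else 0
    one : ∀ b → up b + below b ≡ 1
    one b with up? v i (neighbour w b) | below? v i (neighbour w b)
    ... | yes _ | no _  = refl
    ... | no _  | yes _ = refl
    ... | yes r′ | yes (j , refl , r″) = contradiction (rel-unique r′ r″) (ℕ.>⇒≢ (ℕ.n≤1+n (suc j)))
    ... | no ¬r | no ¬b with rel v (neighbour w b)
    ...   | d , r′ with step (neighbour-adjacent w b) r r′
    ...     | inj₁ refl = contradiction r′ ¬r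
    ...     | inj₂ e    = contradiction (d , e , r′) ¬b

  count-⇔ : ∀ {P : Pred X 0ℓ} (P? : Decidable P) w {Q : Fin n → Set} (Q? : ∀ b → Dec (Q b)) → (∀ b → P (neighbour w b) ⇔ Q b) →
            count P? w ≡ sum λ b → if does (Q? b) then 1 else 0
  count-⇔ P? w Q? e = sum-cong-≗ {n} λ b → cong (if_then 1 else 0) (does-⇔ (e b) (P? (neighbour w b)) (Q? b))

  c : ℕ → ℕ
  c 1 = 1
  c 2 = μ
  c 3 = n ∸ 1
  c 4 = n
  -- Index 0, with nothing below it, is the case that occurs; distances beyond 4 do not exist.
  c _ = 0

  b : ℕ → ℕ
  b 0 = n
  b 1 = n ∸ 1
  b 2 = n ∸ μ
  b 3 = 1
  b _ = 0

  from-below : ∀ {v w i k} → Rel v w i → count (below? v i) w ≡ k → count (up? v i) w ≡ n ∸ k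
  from-below {v} {w} {i} r refl = trans (sym (ℕ.m+n∸n≡m _ (count (below? v i) w))) (cong (_∸ count (below? v i) w) (up+below r))

  from-up : ∀ {v w i k} → Rel v w i → count (up? v i) w ≡ k → count (below? v i) w ≡ n ∸ k
  from-up {v} {w} {i} r refl = trans (sym (ℕ.m+n∸m≡n (count (up? v i) w) _)) (cong (_∸ count (up? v i) w) (up+below r))

  count-none : ∀ {P : Pred X 0ℓ} (P? : Decidable P) w → (∀ b → ¬ P (neighbour w b)) → count P? w ≡ 0
  count-none P? w ¬p = trans (sum-cong-≗ {n} λ b → cong (if_then 1 else 0) (dec-false (P? (neighbour w b)) (¬p b)))
    (trans (sum-const n 0) (ℕ.*-zeroʳ n))

  -- Each class has one easy count. Nothing lies below distance 0; at distance 1 only v does; at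
  -- distance 2 the vertices below are the common neighbours. At distance 3 the one vertex above is
  -- the neighbour of w in the fibre of v; above distance 4 there is nothing.
  counts : ∀ {v w i} → Rel v w i → count (up? v i) w ≡ b i × count (below? v i) w ≡ c i
  counts {v} {w} r@(same _ _ _) = from-below r none , none
    where none = count-none (below? v 0) w λ _ ()
  counts {v@(s , a , j)} {w@(t , _ , k)} r@(adj t≡ e) = from-below r one , one
    where
    one : count (below? v 1) w ≡ 1
    one = trans (count-⇔ (below? v 1) w (a Fin.≟_) λ a′ → mk⇔ (λ { (_ , refl , same _ a≡ _) → a≡ })
      λ { refl → 0 , refl , same (sym (flip-side t≡)) refl (sym (σ-inverse′ t≡ e)) }) (sum-δ-1 a)
  counts {v@(s , a , j)} {w@(t , a′ , k)} r@(side refl a≢a′) = from-below r common , common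
    where
    common : count (below? v 2) w ≡ μ
    common = trans (count-⇔ (below? v 2) w (λ b → σ s a b j Fin.≟ σ s a′ b k) λ b → mk⇔
      (λ { (_ , refl , adj _ e) → e }) λ e → 1 , refl , adj refl e) (common≡μ s a≢a′ j k)
  counts {v@(s , a , j)} {w@(t , b′ , k)} r@(far t≡ ≢k) = one , from-up r one
    where
    one : count (up? v 3) w ≡ 1
    one = trans (count-⇔ (up? v 3) w (a Fin.≟_) λ a′ → mk⇔ (λ { (anti _ a≡ _) → a≡ })
      λ { refl → anti (sym (flip-side t≡)) refl λ e → ≢k (σ-inverse′ (flip-side t≡) (sym e)) }) (sum-δ-1 a)
  counts {v} {w} r@(anti _ _ _) = none , from-up r none
    where none = count-none (up? v 4) w λ _ ()

  distanceRegular : DistanceRegular Z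
  distanceRegular = (λ x y → let (d , r) = rel x y in d , walk r) , b , c , λ i v w d →
    let r = distance-rel d in
    cardinality (up? v i) (λ x → mk⇔ (rel-distance {v} {x}) distance-rel) w (proj₁ (counts r)) ,
    cardinality (below? v i) (λ x → mk⇔ (λ (j , e , r) → j , e , rel-distance r) (λ (j , e , d) → j , e , distance-rel d))
      w (proj₂ (counts r))

  hasDiameter : HasDiameter Z 4
  hasDiameter = (λ x y → let (d , r) = rel x y in d , rel-distance r , rel-≤4 r) ,
    (true , origin , j₀) , (true , origin , j₁) , rel-distance (anti refl refl j₀≢j₁)

-- S and S′ are the sums of squared common-neighbour counts on the two sides, D and D′ the total
-- defects, k the number of new eigenvalues and e the growth of the second-order trace. Writing r as
-- `suc (suc r″)` makes the factor r - 1 positive.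
defects-vanish : ∀ {m′ n′ r″ S S′ D D′} →
  let m = suc m′; n = suc n′; r′ = suc r″; r = suc r′; k = (m + n) * r′; e = 2 * (m * n) * r′ in
  r * r * S ≡ r * r * (m * (n * n) * (m′ + r)) + D →
  r * r * S′ ≡ r * r * (n * (m * m) * (n′ + r)) + D′ →
  k * (S + S′) ≡ k * (m * (m * (n * n)) + n * (n * (m * m))) + e * e →
  m ≡ n × D ≡ 0 × D′ ≡ 0
defects-vanish {m′} {n′} {r″} {S} {S′} {D} {D′} eqS eqS′ eq =
  m≡n , ℕ.m+n≡0⇒m≡0 D D+D′≡0 , ℕ.m+n≡0⇒n≡0 D D+D′≡0
  where
  open ≡.≡-Reasoning
  m = suc m′
  n = suc n′
  p = suc r″
  r = suc p
  k = (m + n) * p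
  e = 2 * (m * n) * p
  d = ∣ m - n ∣
  T = m * (m * (n * n)) + n * (n * (m * m))
  -- Here p = r - 1. Substituting the formulas for S and S′ into r² times the trace identity leaves
  -- k (D + D′) = r² m n p² (4mn - (m + n)²). Moving the right side over, with (m + n)² - 4mn = (m -
  -- n)², gives `excess` = 0.
  excess = k * (D + D′) + r * r * (m * n) * (p * p) * (d * d)

  excess≡0 : excess ≡ 0
  excess≡0 = ℕ.+-cancelʳ-≡ (r * r * (k * T + e * e)) excess 0 (begin
    excess + r * r * (k * T + e * e)
      ≡⟨ solve 7 (λ m n r p D D′ x →
           let k = (m :+ n) :* p ; e = con 2 :* (m :* n) :* p
               T = m :* (m :* (n :* n)) :+ n :* (n :* (m :* m)) in
           k :* (D :+ D′) :+ r :* r :* (m :* n) :* (p :* p) :* x :+ r :* r :* (k :* T :+ e :* e)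
           := k :* (D :+ D′) :+ r :* r :* (k :* T) :+ r :* r :* (m :* n) :* (p :* p) :* (con 2 :* (m :* n) :+ x :+ con 2 :* (m :* n)))
           refl m n r p D D′ (d * d) ⟩
    k * (D + D′) + r * r * (k * T) + r * r * (m * n) * (p * p) * (2 * (m * n) + d * d + 2 * (m * n))
      ≡⟨ cong (λ x → k * (D + D′) + r * r * (k * T) + r * r * (m * n) * (p * p) * (x + 2 * (m * n))) (square-sum m n) ⟨
    k * (D + D′) + r * r * (k * T) + r * r * (m * n) * (p * p) * (m * m + n * n + 2 * (m * n))
      ≡⟨ solve 6 (λ m n r p D D′ →
           let k = (m :+ n) :* p
               T = m :* (m :* (n :* n)) :+ n :* (n :* (m :* m)) in
           k :* (D :+ D′) :+ r :* r :* (k :* T) :+ r :* r :* (m :* n) :* (p :* p) :* (m :* m :+ n :* n :+ con 2 :* (m :* n))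
           := k :* (r :* r :* (m :* (n :* n) :* (m :+ p)) :+ D :+ (r :* r :* (n :* (m :* m) :* (n :+ p)) :+ D′)))
           refl m n r p D D′ ⟩
    k * (r * r * (m * (n * n) * (m + p)) + D + (r * r * (n * (m * m) * (n + p)) + D′))
      ≡⟨ cong₂ (λ x y → k * (r * r * (m * (n * n) * x) + D + (r * r * (n * (m * m) * y) + D′))) (ℕ.+-suc m′ p) (ℕ.+-suc n′ p) ⟨
    k * (r * r * (m * (n * n) * (m′ + r)) + D + (r * r * (n * (m * m) * (n′ + r)) + D′))
      ≡⟨ cong (k *_) (cong₂ _+_ eqS eqS′) ⟨
    k * (r * r * S + r * r * S′)
      ≡⟨ solve 4 (λ k r S S′ → k :* (r :* r :* S :+ r :* r :* S′) := r :* r :* (k :* (S :+ S′))) refl k r S S′ ⟩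
    r * r * (k * (S + S′))
      ≡⟨ cong (r * r *_) eq ⟩
    r * r * (k * T + e * e) ∎)

  D+D′≡0 : D + D′ ≡ 0
  D+D′≡0 = [ (λ ()) , id ]′ (ℕ.m*n≡0⇒m≡0∨n≡0 k {D + D′} (ℕ.m+n≡0⇒m≡0 (k * (D + D′)) excess≡0))

  m≡n : m ≡ n
  m≡n = square≡0 m n ([ (λ ()) , id ]′
    (ℕ.m*n≡0⇒m≡0∨n≡0 (r * r * (m * n) * (p * p)) (ℕ.m+n≡0⇒n≡0 (k * (D + D′)) excess≡0)))

-- Covers of complete bipartite graphs in coordinates

relabel : ∀ {V W} → Graph V → V ↔ W → Graph W
relabel Y φ = record
  { order       = order
  ; enumeration = enumeration ↔-∘ ↔-sym φ
  ; Adj         = λ u v → Graph.Adj Y (from φ u) (from φ v)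
  ; adj?        = λ u v → adj? (from φ u) (from φ v)
  ; symmetric   = symmetric
  ; irreflexive = λ { refl → irreflexive refl }
  }
  where open Graph Y using (order; enumeration; adj?; symmetric; irreflexive)

relabel-≅ : ∀ {V W} (Y : Graph V) (φ : V ↔ W) → Y ≅ relabel Y φ
relabel-≅ Y φ = φ , λ u v → mk⇔
  (≡.subst₂ (Adj Y) (sym (Inverse.strictlyInverseʳ φ u)) (sym (Inverse.strictlyInverseʳ φ v)))
  (≡.subst₂ (Adj Y) (Inverse.strictlyInverseʳ φ u) (Inverse.strictlyInverseʳ φ v))

K-bipartite : ∀ {m n} (x y : Fin m ⊎ Fin n) → Adj (K m n) x y → [ (λ _ → true) , (λ _ → false) ]′ x ≢ [ (λ _ → true) , (λ _ → false) ]′ y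
K-bipartite (inj₁ _) (inj₂ _) _ ()
K-bipartite (inj₂ _) (inj₁ _) _ ()

×-distribʳ-⊎-↔ : ∀ {V A B : Set} {r} → V ↔ (A ⊎ B) → (V × Fin r) ↔ ((A × Fin r) ⊎ (B × Fin r))
×-distribʳ-⊎-↔ {V} {A} {B} {r} φ = mk↔ₛ′ f g f-g g-f
  where
  h : A ⊎ B → Fin r → (A × Fin r) ⊎ (B × Fin r)
  h (inj₁ a) j = inj₁ (a , j)
  h (inj₂ b) j = inj₂ (b , j)
  f : V × Fin r → (A × Fin r) ⊎ (B × Fin r)
  f (v , j) = h (to φ v) j
  g : (A × Fin r) ⊎ (B × Fin r) → V × Fin r
  g (inj₁ (a , j)) = from φ (inj₁ a) , j
  g (inj₂ (b , j)) = from φ (inj₂ b) , j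
  f-g : ∀ x → f (g x) ≡ x
  f-g (inj₁ (a , j)) = cong (λ x → h x j) (Inverse.strictlyInverseˡ φ (inj₁ a))
  f-g (inj₂ (b , j)) = cong (λ x → h x j) (Inverse.strictlyInverseˡ φ (inj₂ b))
  g-h : ∀ x j → g (h x j) ≡ (from φ x , j)
  g-h (inj₁ a) j = refl
  g-h (inj₂ b) j = refl
  g-f : ∀ x → g (f x) ≡ x
  g-f (v , j) = trans (g-h (to φ v) j) (cong (_, j) (Inverse.strictlyInverseʳ φ v))

adjacency : ∀ {V} (Y : Graph V) → Fin (Graph.order Y) → Fin (Graph.order Y) → Bool
adjacency Y i j = does (Graph.adj? Y (from (Graph.enumeration Y) i) (from (Graph.enumeration Y) j))

adjacency-opposite : ∀ {V} (Y : Graph V) ((side , _) : Bipartite Y) i j → adjacency Y i j ≡ true →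
  side (from (Graph.enumeration Y) i) ≢ side (from (Graph.enumeration Y) j)
adjacency-opposite Y (side , opposite) i j e with Graph.adj? Y (from (Graph.enumeration Y) i) (from (Graph.enumeration Y) j)
... | yes a = opposite a
... | no _  = contradiction e λ ()

module CompleteBipartiteCover {V : Set} {Y : Graph V} {r} {G : PermutationGroup r} (f : ArcFunction Y G)
  {m n} (iso : Y ≅ K m n) where

  open ArcFunction f
  private
    φ = proj₁ iso

  left : Fin m → V
  left a = from φ (inj₁ a)

  right : Fin n → V
  right b = from φ (inj₂ b)

  adj-from : ∀ {x y} → Adj (K m n) x y → Adj Y (from φ x) (from φ y)
  adj-from {x} {y} = Equivalence.to (proj₂ (≅-sym {Y = Y} {K m n} iso) x y)

  adj-to : ∀ {x y} → Adj Y (from φ x) (from φ y) → Adj (K m n) x y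
  adj-to {x} {y} = Equivalence.from (proj₂ (≅-sym {Y = Y} {K m n} iso) x y)

  arc : ∀ {u v} → Adj Y u v → ∃ λ g → value u v ≡ just g
  arc {u} {v} a with value u v in eq
  ... | just g  = g , refl
  ... | nothing = contradiction a (Equivalence.to (zero⇔ u v) eq)

  -- `CoverAdj` reads the label of the arc from target to source, so this value carries the fibre
  -- over `left a` to the fibre over `right b`.
  permutation : ∀ a b → ∃ λ g → value (right b) (left a) ≡ just g
  permutation a b = arc (adj-from {inj₂ b} {inj₁ a} tt)

  g g⁻¹ : Fin m → Fin n → Fin r → Fin r
  g a b j   = proj₁ (permutation a b) ⟨$⟩ʳ j
  g⁻¹ a b j = proj₁ (permutation a b) ⟨$⟩ˡ j

  g⁻¹-g : ∀ a b j → g⁻¹ a b (g a b j) ≡ j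
  g⁻¹-g a b j = Perm.inverseˡ (proj₁ (permutation a b))

  g-g⁻¹ : ∀ a b j → g a b (g⁻¹ a b j) ≡ j
  g-g⁻¹ a b j = Perm.inverseʳ (proj₁ (permutation a b))

  coverAdj-lr : ∀ a j b k → Adj (cover f) (left a , j) (right b , k) ⇔ g a b j ≡ k
  coverAdj-lr a j b k = mk⇔
    (λ { (_ , h , eq , e) → trans (cong (_⟨$⟩ʳ j) (just-injective (trans (sym (proj₂ (permutation a b))) eq))) e })
    (λ e → adj-from {inj₁ a} {inj₂ b} tt , _ , proj₂ (permutation a b) , e)

  coverAdj-rl : ∀ b k a j → Adj (cover f) (right b , k) (left a , j) ⇔ g a b j ≡ k
  coverAdj-rl b k a j = mk⇔
    (λ h → Equivalence.to (coverAdj-lr a j b k) (Graph.symmetric (cover f) {right b , k} {left a , j} h))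
    (λ e → Graph.symmetric (cover f) {left a , j} {right b , k} (Equivalence.from (coverAdj-lr a j b k) e))

  coverAdj-ll : ∀ a j a′ k → ¬ Adj (cover f) (left a , j) (left a′ , k)
  coverAdj-ll a j a′ k (h , _) = adj-to {inj₁ a} {inj₁ a′} h

  coverAdj-rr : ∀ b j b′ k → ¬ Adj (cover f) (right b , j) (right b′ , k)
  coverAdj-rr b j b′ k (h , _) = adj-to {inj₂ b} {inj₂ b′} h

  bipartite : Bipartite Y
  bipartite = (λ v → [ (λ _ → true) , (λ _ → false) ]′ (to φ v)) , λ {u} {v} a →
    K-bipartite (to φ u) (to φ v) (Equivalence.to (proj₂ iso u v) a)

  cover-bipartite : Bipartite (cover f)
  cover-bipartite = proj₁ bipartite ∘ proj₁ , λ { {u , _} {v , _} (a , _) → proj₂ bipartite {u} {v} a }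

  order≡ : Graph.order Y ≡ m + n
  order≡ = Perm.↔⇒≡ (↔-sym Fin.+↔⊎ ↔-∘ (φ ↔-∘ ↔-sym (Graph.enumeration Y)))

  private
    module WalksY = ClosedWalks (Graph.enumeration Y) (↔-id (Fin m)) (↔-id (Fin n)) φ
      (λ x y → bit (does (Graph.adj? Y x y))) (λ _ _ → 1)
      (λ i i′ → cong bit (dec-false (Graph.adj? Y _ _) (adj-to {inj₁ i} {inj₁ i′})))
      (λ i j → cong bit (dec-true (Graph.adj? Y _ _) (adj-from {inj₁ i} {inj₂ j} tt)))
      (λ j i → cong bit (dec-true (Graph.adj? Y _ _) (adj-from {inj₂ j} {inj₁ i} tt)))
      (λ j j′ → cong bit (dec-false (Graph.adj? Y _ _) (adj-to {inj₂ j} {inj₂ j′})))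

    module WalksC = ClosedWalks (Graph.enumeration (cover f)) (↔-sym (Fin.*↔× {m} {r})) (↔-sym (Fin.*↔× {n} {r}))
      (×-distribʳ-⊎-↔ φ)
      (λ x y → bit (does (Graph.adj? (cover f) x y))) (λ (a , j) (b , k) → δ (g a b j) k)
      (λ (a , j) (a′ , k) → cong bit (dec-false (Graph.adj? (cover f) _ _) (coverAdj-ll a j a′ k)))
      (λ (a , j) (b , k) → cong bit (does-⇔ (coverAdj-lr a j b k) (Graph.adj? (cover f) _ _) (g a b j Fin.≟ k)))
      (λ (b , k) (a , j) → cong bit (does-⇔ (coverAdj-rl b k a j) (Graph.adj? (cover f) _ _) (g a b j Fin.≟ k)))
      (λ (b , k) (b′ , k′) → cong bit (dec-false (Graph.adj? (cover f) _ _) (coverAdj-rr b k b′ k′)))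

  closedWalks₂-Y : closedWalks₂ (adjacency Y) ≡ m * n + n * m
  closedWalks₂-Y = trans WalksY.closed₂-split (cong₂ _+_
    (trans (sum-const m (sum {n} λ _ → 1)) (cong (m *_) (trans (sum-const n 1) (ℕ.*-identityʳ n))))
    (trans (sum-const n (sum {m} λ _ → 1)) (cong (n *_) (trans (sum-const m 1) (ℕ.*-identityʳ m)))))

  closedWalks₄-Y : closedWalks₄ (adjacency Y) ≡ m * (m * (n * n)) + n * (n * (m * m))
  closedWalks₄-Y = trans WalksY.closed₄-split (cong₂ _+_ (block m n) (block n m))
    where
    block : ∀ m n → (sum {m} λ _ → sum {m} λ _ → (sum {n} λ _ → 1) * (sum {n} λ _ → 1)) ≡ m * (m * (n * n))
    block m n = trans (sum-const m (sum {m} λ _ → (sum {n} λ _ → 1) * (sum {n} λ _ → 1)))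
      (cong (m *_) (trans (sum-const m ((sum {n} λ _ → 1) * (sum {n} λ _ → 1)))
        (cong (m *_) (cong₂ _*_ one one))))
      where one = trans (sum-const n 1) (ℕ.*-identityʳ n)

  commonLeft : Fin m → Fin r → Fin m → Fin r → ℕ
  commonLeft a j a′ k = sum λ b → δ (g a b j) (g a′ b k)

  commonRight : Fin n → Fin r → Fin n → Fin r → ℕ
  commonRight b j b′ k = sum λ a → δ (g⁻¹ a b j) (g⁻¹ a b′ k)

  commonᴵ≡ : ∀ a j a′ k → WalksC.commonᴵ (a , j) (a′ , k) ≡ commonLeft a j a′ k
  commonᴵ≡ a j a′ k = trans (sumOver-× (λ (b , l) → δ (g a b j) l * δ (g a′ b k) l))
    (sum-cong-≗ {n} λ b → trans (sum-δ (g a b j) (δ (g a′ b k))) (δ-sym (g a′ b k) (g a b j)))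

  commonᴶ≡ : ∀ b k b′ k′ → WalksC.commonᴶ (b , k) (b′ , k′) ≡ commonRight b k b′ k′
  commonᴶ≡ b k b′ k′ = trans (sumOver-× (λ (a , j) → δ (g a b j) k * δ (g a b′ j) k′))
    (sum-cong-≗ {m} λ a → trans (sum-cong-≗ {r} λ j → cong₂ _*_ (move a b j k) (move a b′ j k′))
      (trans (sum-δ (g⁻¹ a b k) (δ (g⁻¹ a b′ k′))) (δ-sym (g⁻¹ a b′ k′) (g⁻¹ a b k))))
    where
    move : ∀ a b j k → δ (g a b j) k ≡ δ (g⁻¹ a b k) j
    move a b j k = trans (cong (δ (g a b j)) (sym (g-g⁻¹ a b k)))
      (trans (δ-injective (g a b) (λ {i} {l} e → trans (sym (g⁻¹-g a b i)) (trans (cong (g⁻¹ a b) e) (g⁻¹-g a b l))) j (g⁻¹ a b k))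
             (δ-sym j (g⁻¹ a b k)))

  closedWalks₂-cover : closedWalks₂ (adjacency (cover f)) ≡
    (sum λ a → sum λ j → commonLeft a j a j) + (sum λ b → sum λ j → commonRight b j b j)
  closedWalks₂-cover = trans WalksC.closed₂-split (cong₂ _+_
    (trans (sumOver-× (λ i → WalksC.commonᴵ i i)) (sum-cong-≗ {m} λ a → sum-cong-≗ {r} λ j → commonᴵ≡ a j a j))
    (trans (sumOver-× (λ i → WalksC.commonᴶ i i)) (sum-cong-≗ {n} λ b → sum-cong-≗ {r} λ j → commonᴶ≡ b j b j)))

  closedWalks₄-cover : closedWalks₄ (adjacency (cover f)) ≡
    (sum λ a → sum λ j → sum λ a′ → sum λ k → commonLeft a j a′ k * commonLeft a′ k a j) +
    (sum λ b → sum λ j → sum λ b′ → sum λ k → commonRight b j b′ k * commonRight b′ k b j)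
  closedWalks₄-cover = trans WalksC.closed₄-split (cong₂ _+_
    (trans (sumOver-× (λ i → WalksC.∑ᴵ λ i′ → WalksC.commonᴵ i i′ * WalksC.commonᴵ i′ i)) (sum-cong-≗ {m} λ a → sum-cong-≗ {r} λ j →
      trans (sumOver-× (λ i′ → WalksC.commonᴵ (a , j) i′ * WalksC.commonᴵ i′ (a , j))) (sum-cong-≗ {m} λ a′ → sum-cong-≗ {r} λ k →
        cong₂ _*_ (commonᴵ≡ a j a′ k) (commonᴵ≡ a′ k a j))))
    (trans (sumOver-× (λ i → WalksC.∑ᴶ λ i′ → WalksC.commonᴶ i i′ * WalksC.commonᴶ i′ i)) (sum-cong-≗ {n} λ a → sum-cong-≗ {r} λ j →
      trans (sumOver-× (λ i′ → WalksC.commonᴶ (a , j) i′ * WalksC.commonᴶ i′ (a , j))) (sum-cong-≗ {n} λ a′ → sum-cong-≗ {r} λ k →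
        cong₂ _*_ (commonᴶ≡ a j a′ k) (commonᴶ≡ a′ k a j)))))

private
  module ℝ-Spectra = TwoEigenvalues ℝ-characteristicZeroDomain

module IndexBound {V : Set} {Y : Graph V} {r} {G : PermutationGroup r} (f : ArcFunction Y G)
  (bip : Bipartite Y) (bip′ : Bipartite (cover f)) = ℝ-Spectra.TwoEigenvalueExtension
    (adjacency Y) (adjacency (cover f))
    (proj₁ bip ∘ from (Graph.enumeration Y)) (proj₁ bip′ ∘ from (Graph.enumeration (cover f)))
    (adjacency-opposite Y bip) (adjacency-opposite (cover f) bip′) {adjacencyMatrix Y} {adjacencyMatrix (cover f)} refl refl

-- K_{1,1} is its own spanning tree, so its normalized covers are trivial.
module _ {V : Set} {Y : Graph V} {r} {G : PermutationGroup r} (f : ArcFunction Y G) (iso : Y ≅ K 1 1) where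

  open ArcFunction f
  private
    φ = proj₁ iso

  neighbour-unique : ∀ {u v w} → Adj Y u v → Adj Y u w → v ≡ w
  neighbour-unique {u} {v} {w} a b = trans (sym (Inverse.strictlyInverseʳ φ v)) (trans (cong (from φ)
    (go (to φ u) (to φ v) (to φ w) (Equivalence.to (proj₂ iso u v) a) (Equivalence.to (proj₂ iso u w) b)))
    (Inverse.strictlyInverseʳ φ w))
    where
    go : ∀ x y z → Adj (K 1 1) x y → Adj (K 1 1) x z → y ≡ z
    go (inj₁ _) (inj₂ zero) (inj₂ zero) _ _ = refl
    go (inj₂ _) (inj₁ zero) (inj₁ zero) _ _ = refl

  -- The spanning tree has an edge at u whenever u has a neighbour in Y, and this neighbour is
  -- unique; so every edge of Y is a tree edge with trivial label, and trivial labels generate a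
  -- trivial group.
  generated-trivial : Normalized f → ∀ {g} → Mem (⟨f⟩ f) g → g Perm.≈ Perm.id
  generated-trivial (T , (T⊆Y , connected , _) , normal) = go
    where
    value-trivial : ∀ {u v g} → value u v ≡ just g → g Perm.≈ Perm.id
    value-trivial {u} {v} {g} eq j with Graph.adj? Y u v
    ... | no ¬a = contradiction (trans (sym eq) (Equivalence.from (zero⇔ u v) ¬a)) λ ()
    ... | yes a with connected u v
    ...   | _ , nil = contradiction a (Graph.irreflexive Y refl)
    -- The first edge of the tree walk must already be the given edge.
    ...   | _ , cons {v = w} t _ with normal (subst (Adj T u) (neighbour-unique (T⊆Y t) a) t)
    ...     | h , eq′ , h≈id = trans (cong (_⟨$⟩ʳ j) (just-injective (trans (sym eq) eq′))) (h≈id j)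
    go : ∀ {g} → Mem (⟨f⟩ f) g → g Perm.≈ Perm.id
    go (generator (_ , _ , eq)) j = value-trivial eq j
    go identityᵍ                j = refl
    go (compose {g} {h} p q)    j = trans (cong (h ⟨$⟩ʳ_) (go p j)) (go q j)
    go (inverse {g} p)          j = trans (cong (g ⟨$⟩ˡ_) (sym (go p j))) (Perm.inverseˡ g)
    go (respects g≈h p)         j = trans (sym (g≈h j)) (go p j)

  cover-index≤1 : Normalized f → ActsRegularly (⟨f⟩ f) → r ≤ 1
  cover-index≤1 norm regular = at-most-one λ i j →
    let (h , (mem , e) , _) = regular i j in trans (sym (generated-trivial norm mem i)) e
    where
    at-most-one : ∀ {r} → (∀ (i j : Fin r) → i ≡ j) → r ≤ 1
    at-most-one {zero}        _ = z≤n
    at-most-one {suc zero}    _ = s≤s z≤n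
    at-most-one {suc (suc r)} h = contradiction (h zero (suc zero)) λ ()

module _ {V : Set} {Y : Graph V} {m′ n′ r″} {G : PermutationGroup (suc (suc r″))} (f : ArcFunction Y G)
         (iso : Y ≅ K (suc m′) (suc n′)) where

  open CompleteBipartiteCover f iso

  private
    m n r′ r : ℕ
    m = suc m′
    n = suc n′
    r′ = suc r″
    r = suc r′

  module Left  = CommonNeighbours {m′} {n} {r} g g⁻¹ g⁻¹-g g-g⁻¹
  -- Seen from the other side, fibres are matched by the inverse permutations.
  module Right = CommonNeighbours {n′} {m} {r} (λ b a → g⁻¹ a b) (λ b a → g a b)
                   (λ b a → g-g⁻¹ a b) (λ b a → g⁻¹-g a b)

  closedWalks₂-difference : closedWalks₂ (adjacency (cover f)) ≡ closedWalks₂ (adjacency Y) + 2 * (m * n) * r′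
  closedWalks₂-difference = begin
    closedWalks₂ (adjacency (cover f))
      ≡⟨ closedWalks₂-cover ⟩
    (sum λ a → sum λ j → Left.common a j a j) + (sum λ b → sum λ j → Right.common b j b j)
      ≡⟨ cong₂ _+_ (diagonal m n (λ a j → commonLeft a j a j) λ a j → Left.common-diagonal a j j)
                   (diagonal n m (λ b j → commonRight b j b j) λ b j → Right.common-diagonal b j j) ⟩
    m * (r * n) + n * (r * m)
      ≡⟨ solve 3 (λ m n p → m :* ((con 1 :+ p) :* n) :+ n :* ((con 1 :+ p) :* m)
                    := m :* n :+ n :* m :+ con 2 :* (m :* n) :* p) refl m n r′ ⟩
    m * n + n * m + 2 * (m * n) * r′
      ≡⟨ cong (_+ 2 * (m * n) * r′) closedWalks₂-Y ⟨
    closedWalks₂ (adjacency Y) + 2 * (m * n) * r′ ∎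
    where
    open ≡.≡-Reasoning
    diagonal : ∀ m n (F : Fin m → Fin r → ℕ) → (∀ a j → F a j ≡ δ j j * n) → (sum λ a → sum λ j → F a j) ≡ m * (r * n)
    diagonal m n F e = trans (sum-cong-≗ {m} λ a → trans (sum-cong-≗ {r} λ j →
        trans (e a j) (trans (cong (_* n) (δ-refl j)) (ℕ.*-identityˡ n))) (sum-const r n)) (sum-const m (r * n))

  closedWalks₄-squares : closedWalks₄ (adjacency (cover f)) ≡ Left.totalSquares + Right.totalSquares
  closedWalks₄-squares = trans closedWalks₄-cover (cong₂ _+_
    (sum-cong-≗ {m} λ a → trans (sum-cong-≗ {r} λ j → sum-cong-≗ {m} λ a′ → sum-cong-≗ {r} λ k → cong (Left.common a j a′ k *_) (Left.common-sym a′ k a j))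
      (∑-comm {r} {m} λ j a′ → sum λ k → Left.common a j a′ k * Left.common a j a′ k))
    (sum-cong-≗ {n} λ a → trans (sum-cong-≗ {r} λ j → sum-cong-≗ {n} λ a′ → sum-cong-≗ {r} λ k → cong (Right.common a j a′ k *_) (Right.common-sym a′ k a j))
      (∑-comm {r} {n} λ j a′ → sum λ k → Right.common a j a′ k * Right.common a j a′ k)))

  balanced : Is2evCover f → m ≡ n × Left.totalDefect ≡ 0 × Right.totalDefect ≡ 0
  balanced (L , M , specY , specC , D , M↭L++D , θ , τ , θ≉τ , θ∈D , τ∈D , all) =
    defects-vanish {m′} {n′} {r″} {Left.totalSquares} {Right.totalSquares}
      Left.totalSquares-defect Right.totalSquares-defect
      (≡.subst₂ (λ k w → k * w ≡ k * (m * (m * (n * n)) + n * (n * (m * m))) + 2 * (m * n) * r′ * (2 * (m * n) * r′))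
        length-D closedWalks₄-squares
        (trans (Identity.closedWalks-identity (2 * (m * n) * r′) closedWalks₂-difference)
          (cong (λ t → length D * t + 2 * (m * n) * r′ * (2 * (m * n) * r′)) closedWalks₄-Y)))
    where
    module Identity = IndexBound f bipartite cover-bipartite {L} {M} {D} specY specC M↭L++D {θ} {τ} θ≉τ θ∈D τ∈D all
    -- The cover has (m + n) r vertices and Y has m + n, so (m + n)(r - 1) eigenvalues are new.
    length-D : length D ≡ (m + n) * r′
    length-D = ℕ.+-cancelˡ-≡ (m + n) (length D) ((m + n) * r′)
      (trans (subst (λ p → p + length D ≡ p * r) order≡ (sym Identity.order-difference)) (ℕ.*-suc (m + n) r′))

-- A difference with two distinct elements is not empty, so the cover has more vertices than Y.
2evCover-index≥2 : ∀ {V : Set} {Y : Graph V} {r} {G : PermutationGroup r} (f : ArcFunction Y G) →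
  Bipartite Y → Bipartite (cover f) → Is2evCover f → ∃ λ r″ → r ≡ suc (suc r″)
2evCover-index≥2 {Y = Y} {r} f bip bip′ (L , M , specY , specC , D , M↭L++D , θ , τ , θ≉τ , θ∈D , τ∈D , all) =
  go r Identity.order-difference Identity.length-positive
  where
  module Identity = IndexBound f bip bip′ {L} {M} {D} specY specC M↭L++D {θ} {τ} θ≉τ θ∈D τ∈D all
  go : ∀ r → Graph.order Y * r ≡ Graph.order Y + length D → 1 ≤ length D → ∃ λ r″ → r ≡ suc (suc r″)
  go zero e 1≤ = contradiction (ℕ.m+n≡0⇒n≡0 (Graph.order Y) (trans (sym e) (ℕ.*-zeroʳ (Graph.order Y)))) (ℕ.>⇒≢ 1≤)
  go (suc zero) e 1≤ = contradiction (ℕ.+-cancelˡ-≡ (Graph.order Y) (length D) 0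
    (trans (sym e) (trans (ℕ.*-identityʳ (Graph.order Y)) (sym (ℕ.+-identityʳ (Graph.order Y)))))) (ℕ.>⇒≢ 1≤)
  go (suc (suc r)) _ _ = r , refl

-- From vanishing defects to the distance-regular cover

⊎-Bool : ∀ {A : Set} → (A ⊎ A) ↔ (Bool × A)
⊎-Bool = mk↔ₛ′ [ true ,_ , false ,_ ]′ (λ { (true , x) → inj₁ x ; (false , x) → inj₂ x })
  (λ { (true , _) → refl ; (false , _) → refl }) λ { (inj₁ _) → refl ; (inj₂ _) → refl }

another : ∀ {n} (a : Fin (suc (suc n))) → ∃ (a ≢_)
another zero    = suc zero , λ ()
another (suc a) = zero , λ ()

module _ {V : Set} {Y : Graph V} {n″ r″} {G : PermutationGroup (suc (suc r″))} (f : ArcFunction Y G)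
         (iso : Y ≅ K (suc (suc n″)) (suc (suc n″))) (is2ev : Is2evCover f) where

  open CompleteBipartiteCover f iso

  private
    n r : ℕ
    n = suc (suc n″)
    r = suc (suc r″)

    module L = Left f iso
    module R = Right f iso

    -- One sample, taken in the first two fibres on the left; vanishing defects make every such
    -- count, on either side, equal to n/r.
    μ : ℕ
    μ = commonLeft zero zero (suc zero) zero

    r*μ : r * μ ≡ n
    r*μ = L.common-constant (proj₁ (proj₂ (balanced f iso is2ev))) (λ ()) zero zero

    1≤μ : 1 ≤ μ
    1≤μ = positive r*μ
      where
      positive : ∀ {x} → r * x ≡ n → 1 ≤ x
      positive {zero}  e = contradiction (trans (sym (ℕ.*-zeroʳ r)) e) λ ()
      positive {suc _} _ = s≤s z≤n

    σ : Bool → Fin n → Fin n → Fin r → Fin r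
    σ true  a b = g a b
    σ false b a = g⁻¹ a b

    σ-inverse : ∀ s a b j → σ (not s) b a (σ s a b j) ≡ j
    σ-inverse true  a b j = g⁻¹-g a b j
    σ-inverse false b a j = g-g⁻¹ a b j

    common≡μ : ∀ s {a a′} → a ≢ a′ → ∀ j k → (sum λ b → δ (σ s a b j) (σ s a′ b k)) ≡ μ
    common≡μ true  {a} {a′} a≢a′ j k = ℕ.*-cancelˡ-≡ (commonLeft a j a′ k) μ r
      (trans (L.common-constant (proj₁ (proj₂ (balanced f iso is2ev))) a≢a′ j k) (sym r*μ))
    common≡μ false {b} {b′} b≢b′ j k = ℕ.*-cancelˡ-≡ (commonRight b j b′ k) μ r
      (trans (R.common-constant (proj₂ (proj₂ (balanced f iso is2ev))) b≢b′ j k) (sym r*μ))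

    χ : (V × Fin r) ↔ (Bool × Fin n × Fin r)
    χ = ⊎-Bool ↔-∘ ×-distribʳ-⊎-↔ (proj₁ iso)

    adj⇔ : ∀ s a j t b k → Adj (relabel (cover f) χ) (s , a , j) (t , b , k) ⇔ (t ≡ not s × σ s a b j ≡ k)
    adj⇔ true  a j true  b k = mk⇔ (λ h → contradiction h (coverAdj-ll a j b k)) λ ()
    adj⇔ true  a j false b k = mk⇔ (λ h → refl , Equivalence.to (coverAdj-lr a j b k) h)
                                   λ (_ , e) → Equivalence.from (coverAdj-lr a j b k) e
    adj⇔ false b k true  a j = mk⇔
      (λ h → refl , trans (cong (g⁻¹ a b) (sym (Equivalence.to (coverAdj-rl b k a j) h))) (g⁻¹-g a b j))
      λ (_ , e) → Equivalence.from (coverAdj-rl b k a j) (trans (cong (g a b) (sym e)) (g-g⁻¹ a b k))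
    adj⇔ false a j false b k = mk⇔ (λ h → contradiction h (coverAdj-rr a j b k)) λ ()

    0≢1 : _≢_ {A = Fin r} zero (suc zero)
    0≢1 ()

    module S = SymmetricCover another zero 0≢1 σ σ-inverse 1≤μ common≡μ (relabel (cover f) χ) adj⇔

  index-divides : r ∣ n
  index-divides = divides μ (trans (sym r*μ) (ℕ.*-comm r μ))

  cover-distanceRegular : DistanceRegular (cover f)
  cover-distanceRegular = Transport.distanceRegular {Z = relabel (cover f) χ} (relabel-≅ (cover f) χ) S.distanceRegular

  cover-diameter : HasDiameter (cover f) 4
  cover-diameter = Transport.hasDiameter {Z = relabel (cover f) χ} (relabel-≅ (cover f) χ) S.hasDiameter

Conclusion : ∀ {V : Set} {Y : Graph V} {r} {G : PermutationGroup r} → ArcFunction Y G → Set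
Conclusion {Y = Y} {r} f = (∃ λ n → Y ≅ K n n × r ∣ n) ×
  Bipartite (cover f) × DistanceRegular (cover f) × HasDiameter (cover f) 4

-- The equation between the sides is an argument so that matching it identifies them. One vertex on
-- each side would force r ≤ 1, against the form of r; so n is at least 2 and every fibre has
-- another one beside it.
conclusion-balanced : ∀ {V : Set} {Y : Graph V} {m′ n′ r″} {G : PermutationGroup (suc (suc r″))} (f : ArcFunction Y G) →
  Y ≅ K (suc m′) (suc n′) → Normalized f → ActsRegularly (⟨f⟩ f) → Is2evCover f → suc m′ ≡ suc n′ → Conclusion f
conclusion-balanced {n′ = zero} f iso normalized regular is2ev refl =
  contradiction (cover-index≤1 f iso normalized regular) λ { (s≤s ()) }
conclusion-balanced {n′ = suc n″} f iso normalized regular is2ev refl =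
  (suc (suc n″) , iso , index-divides f iso is2ev) , CompleteBipartiteCover.cover-bipartite f iso ,
  cover-distanceRegular f iso is2ev , cover-diameter f iso is2ev

conclusion-index≥2 : ∀ {V : Set} {Y : Graph V} {m′ n′ r} {G : PermutationGroup r} (f : ArcFunction Y G) →
  Y ≅ K (suc m′) (suc n′) → Normalized f → ActsRegularly (⟨f⟩ f) → Is2evCover f →
  (∃ λ r″ → r ≡ suc (suc r″)) → Conclusion f
conclusion-index≥2 f iso normalized regular is2ev (_ , refl) =
  conclusion-balanced f iso normalized regular is2ev (proj₁ (balanced f iso is2ev))

corollary6p4 : ∀ {V : Set} (Y : Graph V) → Connected Y →
    ∀ (r : ℕ) .{{_ : NonZero r}} (G : PermutationGroup r) (f : ArcFunction Y G) →
    Normalized f → ActsRegularly (⟨f⟩ f) →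
    CompleteBipartite Y → CyclicGroup (⟨f⟩ f) → Is2evCover f →
    (∃ λ n → Y ≅ K n n × r ∣ n) ×
    Bipartite (cover f) × DistanceRegular (cover f) × HasDiameter (cover f) 4
corollary6p4 Y _ r G f normalized regular (suc m′ , suc n′ , _ , _ , iso) _ is2ev =
  conclusion-index≥2 f iso normalized regular is2ev
    (2evCover-index≥2 f (CompleteBipartiteCover.bipartite f iso) (CompleteBipartiteCover.cover-bipartite f iso) is2ev)
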